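{- Let $d\le n$. For all $A,B\in\mathbb{C}^{d\times n}$, $$\mathbf{R}(g_{A,B})\le\mathbf{R}(\mathrm{det}_d)\le(5/6)^{\lfloor d/3\rfloor}2^{d-1}d!.$$ Furthermore, the limit $A^+(\mathbb{N},d)=\lim_{n\to\infty}A^+(n,d)$ exists (is finite) and $A^+(\mathbb{N},d)\le\mathbf{R}(\mathrm{det}_d)\le(5/6)^{\lfloor d/3\rfloor}2^{d-1}d!$.
   Context: For a homogeneous degree-$d$ polynomial $g$ over $\mathbb{C}$, the Waring rank $\mathbf{R}(g)$ is the minimum $r$ such that $g=\ell_1^d+\cdots+\ell_r^d$ for some complex linear forms $\ell_i$ in the same variables. $\mathrm{det}_d$ is the determinant polynomial of the $d\times d$ matrix of variables $(x_{ij})$. For $\alpha\in\{0,1\}^n$ with $|\alpha|=\sum_i\alpha_i=d$ and a $d\times n$ matrix $A$, $A_\alpha$ is the $d\times d$ submatrix formed by the columns $i$ with $\alpha_i=1$, in order. $g_{A,B}:=\sum_{\alpha\in\{0,1\}^n,\,|\alpha|=d}\det(A_\alpha B_\alpha)\,x_1^{\alpha_1}\cdots x_n^{\alpha_n}$. $A^+(n,d)$ is the minimum of $\mathbf{R}(g)$ over all $g\in\mathbb{R}_{\ge0}[x_1,\ldots,x_n]_d$ (nonnegative real coefficients) whose set of monomials with nonzero coefficient is exactly the set of all multilinear monomials $x_{i_1}\cdots x_{i_d}$, $1\le i_1<\cdots<i_d\le n$. -}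

module Defs where

open import Algebra.Bundles using (CommutativeRing)
open import Algebra.Bundles.Raw using (RawRing)
open import Data.Bool.Base using (if_then_else_)
open import Data.Fin.Base using (Fin; zero; suc; toℕ; punchIn; combine; cast)
open import Data.Fin.Subset using (Subset; inside; outside; ∣_∣)
open import Data.Integer.Base using (+_)
open import Data.List.Base as List using (List; []; _∷_; _++_; cartesianProductWith; concatMap)
open import Data.Nat.Base as ℕ using (ℕ; zero; suc)
import Data.Nat.Properties as ℕ
open import Data.Product.Base using (_×_; _,_; ∃; ∃-syntax; map₁)
open import Data.Product.Relation.Binary.Pointwise.NonDependent using (Pointwise)
open import Data.Rational.Base as ℚ using (ℚ)
open import Data.Vec.Base as Vec using (Vec; []; _∷_; _[_]≔_)
open import Data.Vec.Functional using (Vector)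
import Data.Vec.Properties as Vec
open import Function.Bundles using (_⇔_)
open import Level using (0ℓ) renaming (suc to lsuc)
open import Relation.Binary.Core using (Rel)
open import Relation.Binary.PropositionalEquality using (_≡_; sym)
open import Relation.Binary.Structures using (IsTotalOrder)
open import Relation.Nullary using (¬_; Dec; yes; no; does)
open import Relation.Unary using (Pred; Satisfiable)

import Algebra.Definitions.RawSemiring as RawSemiringDefs

-- The real numbers, given by their axioms: an ordered field in which every
-- inhabited subset that is bounded above has a least upper bound.  Classically
-- any two such structures are isomorphic.

record CompleteOrderedField : Set (lsuc 0ℓ) where
  field
    commutativeRing : CommutativeRing 0ℓ 0ℓ

  open CommutativeRing commutativeRing public

  infix 4 _≤_

  field
    _≤_           : Rel Carrier 0ℓ
    isTotalOrder  : IsTotalOrder _≈_ _≤_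
    0≉1           : ¬ (0# ≈ 1#)
    *-inverse     : ∀ x → ¬ (x ≈ 0#) → ∃[ y ] (x * y ≈ 1#)
    +-monoˡ-≤     : ∀ {x y} z → x ≤ y → x + z ≤ y + z
    *-nonneg      : ∀ {x y} → 0# ≤ x → 0# ≤ y → 0# ≤ x * y

  UpperBound : Pred Carrier 0ℓ → Pred Carrier 0ℓ
  UpperBound S b = ∀ x → S x → x ≤ b

  field
    supremum : (S : Pred Carrier 0ℓ) → Satisfiable S → Satisfiable (UpperBound S) →
               ∃[ s ] (UpperBound S s × (∀ b → UpperBound S b → s ≤ b))

-- R[i], with (a , b) standing for a + b i.

complexRing : RawRing 0ℓ 0ℓ → RawRing 0ℓ 0ℓ
complexRing R = record
  { Carrier = Carrier × Carrier
  ; _≈_ = Pointwise _≈_ _≈_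
  ; _+_ = λ (a , b) (c , d) → a + c , b + d
  ; _*_ = λ (a , b) (c , d) → a * c + - (b * d) , a * d + b * c
  ; -_  = λ (a , b) → - a , - b
  ; 0#  = 0# , 0#
  ; 1#  = 1# , 0#
  }
  where open RawRing R

module Matrices (R : RawRing 0ℓ 0ℓ) where
  open RawRing R
  open RawSemiringDefs rawSemiring using (sum; _^_)

  Matrix : ℕ → ℕ → Set
  Matrix m n = Fin m → Fin n → Carrier

  infixl 7 _·_
  _·_ : ∀ {l m n} → Matrix l m → Matrix m n → Matrix l n
  (A · B) i k = sum λ j → A i j * B j k

  -- Laplace expansion along the first row.
  det : ∀ {n} → Matrix n n → Carrier
  det {zero}  M = 1#
  det {suc n} M =
    sum λ j → (- 1#) ^ toℕ j * (M zero j * det (λ i k → M (suc i) (punchIn j k)))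

-- A polynomial in n variables is a finite formal sum of terms, each a
-- coefficient together with an exponent vector.  Exponent vectors may repeat, so
-- two polynomials are equal when the total coefficients of every monomial agree.

module Polynomials (R : RawRing 0ℓ 0ℓ) where
  open RawRing R

  Poly : ℕ → Set
  Poly n = List (Carrier × Vec ℕ n)

  coeff : ∀ {n} → Poly n → Vec ℕ n → Carrier
  coeff []            α = 0#
  coeff ((c , β) ∷ p) α =
    if does (Vec.≡-dec ℕ._≟_ β α) then c + coeff p α else coeff p α

  monomial : ∀ {n} → Carrier → Vec ℕ n → Poly n
  monomial c α = (c , α) ∷ []

  unit : ∀ {n} → Fin n → Vec ℕ n
  unit i = Vec.replicate _ 0 [ i ]≔ 1

  var : ∀ {n} → Fin n → Poly n
  var i = monomial 1# (unit i)

  polyRing : ℕ → RawRing 0ℓ 0ℓ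
  polyRing n = record
    { Carrier = Poly n
    ; _≈_ = λ p q → ∀ α → coeff p α ≈ coeff q α
    ; _+_ = _++_
    ; _*_ = cartesianProductWith λ (a , α) (b , β) → a * b , Vec.zipWith ℕ._+_ α β
    ; -_  = List.map (map₁ -_)
    ; 0#  = []
    ; 1#  = monomial 1# (Vec.replicate n 0)
    }

  module _ {n : ℕ} where
    open RawSemiringDefs (RawRing.rawSemiring (polyRing n)) using (sum)

    linearForm : Vector Carrier n → Poly n
    linearForm a = sum λ i → monomial (a i) (unit i)

-- Subsets of Fin n encode the vectors in {0,1}ⁿ.

exponent : ∀ {n} → Subset n → Vec ℕ n
exponent = Vec.map λ b → if b then 1 else 0

allSubsets : ∀ n → List (Subset n)
allSubsets zero    = [] ∷ []
allSubsets (suc n) =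
  List.map (inside ∷_) (allSubsets n) ++ List.map (outside ∷_) (allSubsets n)

-- The elements of a subset in increasing order.
element : ∀ {n} (α : Subset n) → Fin ∣ α ∣ → Fin n
element (inside  ∷ α) zero    = zero
element (inside  ∷ α) (suc k) = suc (element α k)
element (outside ∷ α) k       = suc (element α k)

IsMinimum : Pred ℕ 0ℓ → Pred ℕ 0ℓ
IsMinimum P m = P m × (∀ k → P k → m ℕ.≤ k)

fromℕ : ℕ → ℚ
fromℕ k = + k ℚ./ 1

HasLimit : (ℕ → ℕ) → ℕ → Set
HasLimit a L =
  ∀ (ε : ℚ) → ℚ.0ℚ ℚ.< ε → ∃[ N ] (∀ n → N ℕ.≤ n → fromℕ ℕ.∣ a n - L ∣ ℚ.< ε)

-- (5/6)^⌊d/3⌋ · 2^(d-1) · d!, meant for d ≥ 1.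
rankBound : ℕ → ℚ
rankBound d = (+ 5 ℚ./ 6) ^ (d ℕ./ 3) ℚ.* fromℕ (2 ℕ.^ (d ℕ.∸ 1)) ℚ.* fromℕ (d ℕ.!)
  where open RawSemiringDefs ℚ.+-*-rawSemiring using (_^_)

module WaringRank (ℝ : CompleteOrderedField) where
  private module ℝ = CompleteOrderedField ℝ

  ℂ : RawRing 0ℓ 0ℓ
  ℂ = complexRing ℝ.rawRing

  open RawRing ℂ using (Carrier)
  open Matrices ℂ public using (Matrix; _·_; det)
  open Polynomials ℂ public
  private module ℝ[x] = Polynomials ℝ.rawRing

  HasWaringDecomposition : ∀ {n} → ℕ → Poly n → Pred ℕ 0ℓ
  HasWaringDecomposition {n} d g r =
    ∃ λ (ℓ : Fin r → Vector Carrier n) → g ≈ sum λ k → linearForm (ℓ k) ^ d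
    where
    open RawRing (polyRing n) using (_≈_; rawSemiring)
    open RawSemiringDefs rawSemiring using (sum; _^_)

  -- R(g) = r, for g homogeneous of degree d.
  IsWaringRank : ∀ {n} → ℕ → Poly n → Pred ℕ 0ℓ
  IsWaringRank d g = IsMinimum (HasWaringDecomposition d g)

  -- The variable x_{ij} is the one with index combine i j.
  detPoly : ∀ d → Poly (d ℕ.* d)
  detPoly d = Matrices.det (polyRing (d ℕ.* d)) {d} λ i j → var (combine i j)

  columns : ∀ {d n} → Matrix d n → (α : Subset n) → ∣ α ∣ ≡ d → Matrix d d
  columns A α ∣α∣≡d i k = A i (element α (cast (sym ∣α∣≡d) k))

  gPoly : ∀ {d n} → Matrix d n → Matrix d n → Poly n
  gPoly {d} {n} A B = concatMap (λ α → term α (∣ α ∣ ℕ.≟ d)) (allSubsets n)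
    where
    term : (α : Subset n) → Dec (∣ α ∣ ≡ d) → Poly n
    term α (yes e) = monomial (det (columns A α e · columns B α e)) (exponent α)
    term α (no _)  = []

  complexify : ∀ {n} → ℝ[x].Poly n → Poly n
  complexify = List.map (map₁ (_, ℝ.0#))

  NonnegativeCoefficients : ∀ {n} → Pred (ℝ[x].Poly n) 0ℓ
  NonnegativeCoefficients g = ∀ α → ℝ.0# ℝ.≤ ℝ[x].coeff g α

  -- The monomials of g are exactly the multilinear monomials of degree d; in
  -- particular g is homogeneous of degree d.
  MultilinearSupport : ∀ {n} → ℕ → Pred (ℝ[x].Poly n) 0ℓ
  MultilinearSupport {n} d g =
    ∀ (β : Vec ℕ n) →
      (¬ (ℝ[x].coeff g β ℝ.≈ ℝ.0#)) ⇔ (∃[ α ] (∣ α ∣ ≡ d × β ≡ exponent α))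

  -- A⁺(n,d) = a
  IsA⁺ : ℕ → ℕ → Pred ℕ 0ℓ
  IsA⁺ n d = IsMinimum λ r →
    ∃[ g ] (NonnegativeCoefficients {n} g × MultilinearSupport d g
            × IsWaringRank d (complexify g) r)

{-# OPTIONS --safe #-}

-- An iterated Laplace expansion along blocks of three rows, together with Derksen's
-- formula for det₃ as a sum of five products of linear forms, writes det_d as
-- (5/6)^⌊d/3⌋ d! products of d linear forms, and polarisation turns each product
-- into 2^(d-1) d-th powers.  By the Cauchy–Binet formula g_{A,B} is the determinant
-- of A · X · Bᵀ with X the diagonal matrix of variables, so it arises from det_d by a
-- linear substitution, which does not increase the rank.  With A = B a real
-- Vandermonde matrix the coefficients of g_{A,A} are squares of nonzero minors, so
-- that A⁺(n,d) ≤ R(det_d); since setting a variable to 0 shows that A⁺(n,d) is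
-- nondecreasing in n, the sequence is eventually constant.

module Submission where

open import Defs
open import Axiom.ExcludedMiddle using (ExcludedMiddle)
open import Data.Nat.Base using (ℕ; _≤_)
open import Data.Product.Base using (_×_; ∃-syntax)
open import Data.Rational.Base as ℚ using ()
open import Level using (0ℓ)

open import Algebra.Bundles using (CommutativeRing)
open import Algebra.Bundles.Raw using (RawRing)
import Algebra.Definitions.RawSemiring as RawSemiringDefs
open import Algebra.Morphism.Structures using (module RingMorphisms)
open import Algebra.Solver.Ring.AlmostCommutativeRing using (fromCommutativeRing; _-Raw-AlmostCommutative⟶_)
open import Data.Bool.Base using (true; false; if_then_else_)
open import Data.Fin.Base
  using (Fin; zero; suc; toℕ; punchIn; punchOut; combine; remQuot; cast; lift; inject₁)
import Data.Fin.Properties as Fin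
open import Data.Fin.Subset using (Subset; inside; outside; ∣_∣; ⊤)
open import Data.Fin.Subset.Properties using (∣⊤∣≡n)
open import Data.Integer.Base as ℤ using (ℤ; +_; -[1+_])
import Data.Integer.Properties as ℤ
open import Data.List.Base as List using (List; []; _∷_)
import Data.List.Properties as List
import Data.Maybe.Base as Maybe
open import Data.Nat.Base as ℕ using (zero; suc)
import Data.Nat.DivMod as ℕ
import Data.Nat.Properties as ℕ
import Data.Nat.Solver
open import Data.Product.Base using (_,_; proj₁; proj₂)
import Data.Rational.Properties as ℚ
import Data.Rational.Unnormalised.Base as ℚᵘ
import Data.Rational.Unnormalised.Properties as ℚᵘ
open import Data.Sum.Base using (_⊎_; inj₁; inj₂)
open import Data.Vec.Base as Vec using (Vec; []; _∷_)
import Data.Vec.Properties as Vec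
open import Data.Vec.Relation.Unary.All using (All; []; _∷_)
open import Function.Base using (_∘_; id)
open import Function.Bundles using (mk⇔; Equivalence)
open import Relation.Binary.PropositionalEquality as ≡ using (_≡_; _≢_)
open import Relation.Binary.Structures using (IsTotalOrder)
open import Relation.Nullary using (¬_; yes; no; does; contradiction)
open import Relation.Nullary.Decidable using (dec⇒maybe; recompute)
open import Relation.Unary using (Pred)

-- Polarisation yields 2^(d-1) signed d-th powers for 2^(d-1) d! times a product, whereas the rank
-- asks for a sum without signs or weights. The inverse of the factor goes into one linear form of
-- the product, and a sign goes into a d-th root of -1. The reals are given by axioms only, so this
-- root is constructed: for odd d it is -1 itself, for even d it is a square root of the root for
-- d/2. Everything stays on the unit circle, where a complex square root reduces to a real one,
-- obtained as a supremum.
--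
-- The factor 5/6 per block of three rows is a count: 5 C(d,3) (d-3)! = (5/6) d!.
--
-- Polynomials are lists of terms with possibly repeated exponents. Their ring laws, and the facts
-- that substitution and setting a variable to 0 are homomorphisms, are checked by pairing with
-- arbitrary functionals on exponents.
--
-- Each rank is a minimum of a set of natural numbers, found with excluded middle by descending from
-- an explicit decomposition. Stabilisation of the sequence A⁺(n,d) is the dual argument: a bounded
-- sequence of natural numbers can increase only finitely often.

private module ℕS = Data.Nat.Solver.+-*-Solver

-- Ring identities with integer coefficients

module IntegerSolver (R : CommutativeRing 0ℓ 0ℓ) where
  open CommutativeRing R hiding (zero)
  open import Algebra.Properties.Ring ring
  open import Algebra.Properties.AbelianGroup +-abelianGroup using (⁻¹-∙-comm)
  open import Relation.Binary.Reasoning.Setoid setoid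

  -- The extra clause for 1 makes `con (+ 1)` in the solver unfold to `1#` rather than `1# + 0#`, so
  -- that solved identities match the goals as they stand.
  fromNat : ℕ → Carrier
  fromNat zero          = 0#
  fromNat (suc zero)    = 1#
  fromNat (suc (suc n)) = 1# + fromNat (suc n)

  fromNat-suc : ∀ n → fromNat (suc n) ≈ 1# + fromNat n
  fromNat-suc zero    = sym (+-identityʳ 1#)
  fromNat-suc (suc n) = refl

  fromNat-+ : ∀ m n → fromNat (m ℕ.+ n) ≈ fromNat m + fromNat n
  fromNat-+ zero    n = sym (+-identityˡ _)
  fromNat-+ (suc m) n = begin
    fromNat (suc (m ℕ.+ n))       ≈⟨ fromNat-suc (m ℕ.+ n) ⟩
    1# + fromNat (m ℕ.+ n)        ≈⟨ +-congˡ (fromNat-+ m n) ⟩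
    1# + (fromNat m + fromNat n)  ≈⟨ +-assoc _ _ _ ⟨
    (1# + fromNat m) + fromNat n  ≈⟨ +-congʳ (fromNat-suc m) ⟨
    fromNat (suc m) + fromNat n   ∎

  fromNat-* : ∀ m n → fromNat (m ℕ.* n) ≈ fromNat m * fromNat n
  fromNat-* zero    n = sym (zeroˡ _)
  fromNat-* (suc m) n = begin
    fromNat (n ℕ.+ m ℕ.* n)                   ≈⟨ fromNat-+ n (m ℕ.* n) ⟩
    fromNat n + fromNat (m ℕ.* n)             ≈⟨ +-cong (sym (*-identityˡ _)) (fromNat-* m n) ⟩
    1# * fromNat n + fromNat m * fromNat n    ≈⟨ distribʳ _ _ _ ⟨
    (1# + fromNat m) * fromNat n              ≈⟨ *-congʳ (fromNat-suc m) ⟨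
    fromNat (suc m) * fromNat n               ∎

  fromInt : ℤ → Carrier
  fromInt (+ n)    = fromNat n
  fromInt -[1+ n ] = - fromNat (suc n)

  fromInt-⊖ : ∀ m n → fromInt (m ℤ.⊖ n) ≈ fromNat m + - fromNat n
  fromInt-⊖ m zero = begin
    fromNat m           ≈⟨ +-identityʳ _ ⟨
    fromNat m + 0#      ≈⟨ +-congˡ -0#≈0# ⟨
    fromNat m + - 0#    ∎
  fromInt-⊖ zero (suc n) = sym (+-identityˡ _)
  fromInt-⊖ (suc m) (suc n) = begin
    fromInt (suc m ℤ.⊖ suc n)                      ≡⟨ ≡.cong fromInt (ℤ.[1+m]⊖[1+n]≡m⊖n m n) ⟩
    fromInt (m ℤ.⊖ n)                              ≈⟨ fromInt-⊖ m n ⟩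
    fromNat m + - fromNat n                        ≈⟨ +-congʳ (+-identityˡ _) ⟨
    (0# + fromNat m) + - fromNat n                 ≈⟨ +-congʳ (+-congʳ (-‿inverseʳ 1#)) ⟨
    ((1# + - 1#) + fromNat m) + - fromNat n        ≈⟨ +-congʳ (+-assoc _ _ _) ⟩
    (1# + (- 1# + fromNat m)) + - fromNat n        ≈⟨ +-congʳ (+-congˡ (+-comm _ _)) ⟩
    (1# + (fromNat m + - 1#)) + - fromNat n        ≈⟨ +-congʳ (+-assoc _ _ _) ⟨
    ((1# + fromNat m) + - 1#) + - fromNat n        ≈⟨ +-assoc _ _ _ ⟩
    (1# + fromNat m) + (- 1# + - fromNat n)        ≈⟨ +-congˡ (⁻¹-∙-comm _ _) ⟩
    (1# + fromNat m) + - (1# + fromNat n)          ≈⟨ +-cong (fromNat-suc m) (-‿cong (fromNat-suc n)) ⟨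
    fromNat (suc m) + - fromNat (suc n)            ∎

  fromInt-+ : ∀ i j → fromInt (i ℤ.+ j) ≈ fromInt i + fromInt j
  fromInt-+ (+ m)    (+ n)    = fromNat-+ m n
  fromInt-+ (+ m)    -[1+ n ] = fromInt-⊖ m (suc n)
  fromInt-+ -[1+ m ] (+ n)    = trans (fromInt-⊖ n (suc m)) (+-comm _ _)
  fromInt-+ -[1+ m ] -[1+ n ] = begin
    - fromNat (suc (suc (m ℕ.+ n)))            ≡⟨ ≡.cong (λ k → - fromNat (suc k)) (ℕ.+-suc m n) ⟨
    - fromNat (suc m ℕ.+ suc n)                ≈⟨ -‿cong (fromNat-+ (suc m) (suc n)) ⟩
    - (fromNat (suc m) + fromNat (suc n))      ≈⟨ ⁻¹-∙-comm _ _ ⟨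
    - fromNat (suc m) + - fromNat (suc n)      ∎

  fromInt-neg : ∀ i → fromInt (ℤ.- i) ≈ - fromInt i
  fromInt-neg (+ zero)    = sym -0#≈0#
  fromInt-neg (+ (suc n)) = refl
  fromInt-neg -[1+ n ]    = sym (-‿involutive _)

  fromInt-*-fromNat : ∀ m j → fromInt (+ m ℤ.* j) ≈ fromNat m * fromInt j
  fromInt-*-fromNat m (+ n) = begin
    fromInt (+ m ℤ.* + n)      ≡⟨ ≡.cong fromInt (ℤ.pos-* m n) ⟨
    fromNat (m ℕ.* n)          ≈⟨ fromNat-* m n ⟩
    fromNat m * fromNat n      ∎
  fromInt-*-fromNat m -[1+ n ] = begin
    fromInt (+ m ℤ.* -[1+ n ])               ≡⟨ ≡.cong fromInt (ℤ.neg-distribʳ-* (+ m) (+ suc n)) ⟨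
    fromInt (ℤ.- (+ m ℤ.* + suc n))          ≈⟨ fromInt-neg (+ m ℤ.* + suc n) ⟩
    - fromInt (+ m ℤ.* + suc n)              ≈⟨ -‿cong (fromInt-*-fromNat m (+ suc n)) ⟩
    - (fromNat m * fromNat (suc n))          ≈⟨ -‿distribʳ-* _ _ ⟩
    fromNat m * - fromNat (suc n)            ∎

  fromInt-* : ∀ i j → fromInt (i ℤ.* j) ≈ fromInt i * fromInt j
  fromInt-* (+ m)    j = fromInt-*-fromNat m j
  fromInt-* -[1+ m ] j = begin
    fromInt (-[1+ m ] ℤ.* j)                 ≡⟨ ≡.cong fromInt (ℤ.neg-distribˡ-* (+ suc m) j) ⟨
    fromInt (ℤ.- (+ suc m ℤ.* j))            ≈⟨ fromInt-neg (+ suc m ℤ.* j) ⟩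
    - fromInt (+ suc m ℤ.* j)                ≈⟨ -‿cong (fromInt-*-fromNat (suc m) j) ⟩
    - (fromNat (suc m) * fromInt j)          ≈⟨ -‿distribˡ-* _ _ ⟩
    - fromNat (suc m) * fromInt j            ∎

  coefficients : ℤ.+-*-rawRing -Raw-AlmostCommutative⟶ fromCommutativeRing R
  coefficients = record
    { ⟦_⟧ = fromInt ; +-homo = fromInt-+ ; *-homo = fromInt-* ; -‿homo = fromInt-neg
    ; 0-homo = refl ; 1-homo = refl }

  coefficients-≟ : ∀ i j → Maybe.Maybe (fromInt i ≈ fromInt j)
  coefficients-≟ i j = Maybe.map (reflexive ∘ ≡.cong fromInt) (dec⇒maybe (i ℤ.≟ j))

  open import Algebra.Solver.Ring ℤ.+-*-rawRing (fromCommutativeRing R) coefficients coefficients-≟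
    public using (solve; _:=_; _:+_; _:*_; _:-_; :-_; con)

-- Finite sums over indices, subsets and increasing tuples

module FiniteSums (R : CommutativeRing 0ℓ 0ℓ) where
  open CommutativeRing R hiding (zero)
  open IntegerSolver R
  import Algebra.Properties.Semiring.Sum semiring as Sum
  open import Relation.Binary.Reasoning.Setoid setoid

  -- The library's sum reduces as soon as its length does, which prevents
  -- unification from recovering summands; hence an opaque copy.
  opaque
    ∑ : ∀ {n} → (Fin n → Carrier) → Carrier
    ∑ = Sum.sum

    ∑≡sum : ∀ {n} (f : Fin n → Carrier) → ∑ f ≡ Sum.sum f
    ∑≡sum f = ≡.refl

    ∑-zero : {f : Fin 0 → Carrier} → ∑ f ≈ 0#
    ∑-zero = refl

    ∑-suc : ∀ {n} {f : Fin (suc n) → Carrier} → ∑ f ≈ f zero + ∑ (λ i → f (suc i))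
    ∑-suc = refl

    ∑-cong : ∀ {n} {f g : Fin n → Carrier} → (∀ i → f i ≈ g i) → ∑ f ≈ ∑ g
    ∑-cong f≈g = Sum.sum-cong-≋ f≈g

    ∑-+ : ∀ {n} {f g : Fin n → Carrier} → ∑ (λ i → f i + g i) ≈ ∑ f + ∑ g
    ∑-+ {f = f} {g} = Sum.∑-distrib-+ f g

    ∑-comm : ∀ {m n} {f : Fin m → Fin n → Carrier} →
             ∑ (λ i → ∑ λ j → f i j) ≈ ∑ (λ j → ∑ λ i → f i j)
    ∑-comm {f = f} = Sum.∑-comm f

    *-∑ : ∀ {n} x {f : Fin n → Carrier} → x * ∑ f ≈ ∑ λ i → x * f i
    *-∑ x {f} = Sum.*-distribˡ-sum x f

    ∑-≈0 : ∀ {n} {f : Fin n → Carrier} → (∀ i → f i ≈ 0#) → ∑ f ≈ 0#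
    ∑-≈0 {n} f≈0 = trans (Sum.sum-cong-≋ f≈0) (Sum.sum-replicate-zero n)

  -- Pascal's recursion on whether the first index belongs to the subset, so that subsets of the
  -- wrong size are never visited. The cardinality proof is irrelevant, hence a summand cannot
  -- depend on how it was obtained.
  subsetSum : ∀ n d → ((α : Subset n) → .(∣ α ∣ ≡ d) → Carrier) → Carrier
  subsetSum zero    zero    f = f [] ≡.refl
  subsetSum zero    (suc d) f = 0#
  subsetSum (suc n) zero    f = subsetSum n zero (λ α e → f (outside ∷ α) e)
  subsetSum (suc n) (suc d) f =
    subsetSum n d (λ α e → f (inside ∷ α) (≡.cong suc e))
    + subsetSum n (suc d) (λ α e → f (outside ∷ α) e)

  subsetSum-cong : ∀ n d {f g : (α : Subset n) → .(∣ α ∣ ≡ d) → Carrier} →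
                   (∀ α .e → f α e ≈ g α e) → subsetSum n d f ≈ subsetSum n d g
  subsetSum-cong zero    zero    f≈g = f≈g [] ≡.refl
  subsetSum-cong zero    (suc d) f≈g = refl
  subsetSum-cong (suc n) zero    f≈g = subsetSum-cong n zero λ α e → f≈g (outside ∷ α) e
  subsetSum-cong (suc n) (suc d) f≈g =
    +-cong (subsetSum-cong n d λ α e → f≈g (inside ∷ α) (≡.cong suc e))
           (subsetSum-cong n (suc d) λ α e → f≈g (outside ∷ α) e)

  subsetSum-zero : ∀ n d → subsetSum n d (λ _ _ → 0#) ≈ 0#
  subsetSum-zero zero    zero    = refl
  subsetSum-zero zero    (suc d) = refl
  subsetSum-zero (suc n) zero    = subsetSum-zero n zero
  subsetSum-zero (suc n) (suc d) =
    trans (+-cong (subsetSum-zero n d) (subsetSum-zero n (suc d))) (+-identityˡ 0#)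

  subsetSum-+ : ∀ n d (f g : (α : Subset n) → .(∣ α ∣ ≡ d) → Carrier) →
                subsetSum n d (λ α e → f α e + g α e) ≈ subsetSum n d f + subsetSum n d g
  subsetSum-+ zero    zero    f g = refl
  subsetSum-+ zero    (suc d) f g = sym (+-identityˡ 0#)
  subsetSum-+ (suc n) zero    f g = subsetSum-+ n zero _ _
  subsetSum-+ (suc n) (suc d) f g =
    trans (+-cong (subsetSum-+ n d _ _) (subsetSum-+ n (suc d) _ _))
          (solve 4 (λ a b c d → a :+ b :+ (c :+ d) := a :+ c :+ (b :+ d)) refl _ _ _ _)

  *-distribˡ-subsetSum : ∀ n d x (f : (α : Subset n) → .(∣ α ∣ ≡ d) → Carrier) →
                         x * subsetSum n d f ≈ subsetSum n d (λ α e → x * f α e)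
  *-distribˡ-subsetSum zero    zero    x f = refl
  *-distribˡ-subsetSum zero    (suc d) x f = zeroʳ x
  *-distribˡ-subsetSum (suc n) zero    x f = *-distribˡ-subsetSum n zero x _
  *-distribˡ-subsetSum (suc n) (suc d) x f =
    trans (distribˡ x _ _) (+-cong (*-distribˡ-subsetSum n d x _) (*-distribˡ-subsetSum n (suc d) x _))

  sum-subsetSum : ∀ {m} n d (f : Fin m → (α : Subset n) → .(∣ α ∣ ≡ d) → Carrier) →
                  (∑ λ i → subsetSum n d (f i)) ≈ subsetSum n d (λ α e → ∑ λ i → f i α e)
  sum-subsetSum {zero}  n d f =
    trans ∑-zero (sym (trans (subsetSum-cong n d λ _ _ → ∑-zero) (subsetSum-zero n d)))
  sum-subsetSum {suc m} n d f =
    trans ∑-suc (trans (+-congˡ (sum-subsetSum n d (f ∘ suc)))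
      (trans (sym (subsetSum-+ n d _ _)) (subsetSum-cong n d λ _ _ → sym ∑-suc)))

  subsetSum-empty : ∀ n d f → n ℕ.< d → subsetSum n d f ≈ 0#
  subsetSum-empty zero    (suc d) f _ = refl
  subsetSum-empty (suc n) (suc d) f (ℕ.s≤s n<d) =
    trans (+-cong (subsetSum-empty n d _ n<d) (subsetSum-empty n (suc d) _ (ℕ.m<n⇒m<1+n n<d)))
          (+-identityˡ 0#)

  subsetSum-full : ∀ n f → subsetSum n n f ≈ f ⊤ (∣⊤∣≡n n)
  subsetSum-full zero    f = refl
  subsetSum-full (suc n) f =
    trans (+-cong (subsetSum-full n _) (subsetSum-empty n (suc n) _ (ℕ.n<1+n n))) (+-identityʳ _)

  -- Sums over i < j, and in `sum³` over i < j < k, split by whether the least index is `zero`.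
  sum² : ∀ n → (Fin n → Fin n → Carrier) → Carrier
  sum² zero    f = 0#
  sum² (suc n) f = ∑ (λ j → f zero (suc j)) + sum² n λ i j → f (suc i) (suc j)

  sum³ : ∀ n → (Fin n → Fin n → Fin n → Carrier) → Carrier
  sum³ zero    f = 0#
  sum³ (suc n) f =
    sum² n (λ j k → f zero (suc j) (suc k)) + sum³ n λ i j k → f (suc i) (suc j) (suc k)

  sum²-cong : ∀ n {f g : Fin n → Fin n → Carrier} → (∀ i j → f i j ≈ g i j) → sum² n f ≈ sum² n g
  sum²-cong zero    f≈g = refl
  sum²-cong (suc n) f≈g =
    +-cong (∑-cong λ j → f≈g zero (suc j)) (sum²-cong n λ i j → f≈g (suc i) (suc j))

  sum³-cong : ∀ n {f g : Fin n → Fin n → Fin n → Carrier} →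
              (∀ i j k → f i j k ≈ g i j k) → sum³ n f ≈ sum³ n g
  sum³-cong zero    f≈g = refl
  sum³-cong (suc n) f≈g =
    +-cong (sum²-cong n λ j k → f≈g zero (suc j) (suc k))
           (sum³-cong n λ i j k → f≈g (suc i) (suc j) (suc k))

  ∑-suc₂ : ∀ {m n} {f : Fin (suc m) → Fin (suc n) → Carrier} →
           ∑ (λ i → ∑ λ j → f i j)
           ≈ (f zero zero + ∑ (λ j → f zero (suc j)))
             + (∑ (λ i → f (suc i) zero) + ∑ λ i → ∑ λ j → f (suc i) (suc j))
  ∑-suc₂ = trans ∑-suc (+-cong ∑-suc (trans (∑-cong λ i → ∑-suc) ∑-+))

  ∑-symmetrise₂ : ∀ {n} (f : Fin n → Fin n → Carrier) → (∀ i → f i i ≈ 0#) →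
                  ∑ (λ i → ∑ λ j → f i j) ≈ sum² n λ i j → f i j + f j i
  ∑-symmetrise₂ {zero}  f diag = ∑-zero
  ∑-symmetrise₂ {suc n} f diag = begin
    ∑ (λ i → ∑ λ j → f i j)              ≈⟨ ∑-suc₂ ⟩
    (f zero zero + a) + (b + c)          ≈⟨ +-congʳ (trans (+-congʳ (diag zero)) (+-identityˡ a)) ⟩
    a + (b + c)                          ≈⟨ +-assoc a b c ⟨
    (a + b) + c
      ≈⟨ +-cong (sym ∑-+) (∑-symmetrise₂ (λ i j → f (suc i) (suc j)) (λ i → diag (suc i))) ⟩
    sum² (suc n) (λ i j → f i j + f j i) ∎
    where
    a = ∑ λ j → f zero (suc j)
    b = ∑ λ i → f (suc i) zero
    c = ∑ λ i → ∑ λ j → f (suc i) (suc j)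

  -- Triples with at least two indices `zero` vanish by hypothesis. Those with exactly one are
  -- gathered in `h`, which vanishes on the diagonal, so the two-index version applies to it. The
  -- order of the six summands is that of `h j k + h k j`.
  ∑-symmetrise₃ : ∀ {n} (f : Fin n → Fin n → Fin n → Carrier) →
                  (∀ i k → f i i k ≈ 0#) → (∀ i k → f i k i ≈ 0#) → (∀ i k → f k i i ≈ 0#) →
                  ∑ (λ i → ∑ λ j → ∑ λ k → f i j k)
                  ≈ sum³ n λ i j k → (f i j k + f j i k + f j k i) + (f i k j + f k i j + f k j i)
  ∑-symmetrise₃ {zero}  f d₁ d₂ d₃ = ∑-zero
  ∑-symmetrise₃ {suc n} f d₁ d₂ d₃ = begin
    ∑ (λ i → ∑ λ j → ∑ λ k → f i j k)
      ≈⟨ ∑-suc ⟩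
    ∑ (λ j → ∑ λ k → f zero j k) + ∑ (λ i → ∑ λ j → ∑ λ k → f (suc i) j k)
      ≈⟨ +-cong at-zero (trans (∑-cong at-suc) (trans ∑-+ (+-congˡ ∑-+))) ⟩
    a + (b + (c + e))
      ≈⟨ solve 4 (λ a b c e → a :+ (b :+ (c :+ e)) := a :+ b :+ c :+ e) refl a b c e ⟩
    a + b + c + e
      ≈⟨ +-congʳ (trans (∑-cong λ i → trans ∑-+ (+-congʳ ∑-+)) (trans ∑-+ (+-congʳ ∑-+))) ⟨
    ∑ (λ j → ∑ λ k → h j k) + e
      ≈⟨ +-cong (∑-symmetrise₂ h h-diag)
                (∑-symmetrise₃ (λ i j k → f (suc i) (suc j) (suc k))
                  (λ i k → d₁ (suc i) (suc k)) (λ i k → d₂ (suc i) (suc k)) (λ i k → d₃ (suc i) (suc k))) ⟩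
    sum³ (suc n) (λ i j k → (f i j k + f j i k + f j k i) + (f i k j + f k i j + f k j i)) ∎
    where
    h : Fin n → Fin n → Carrier
    h j k = f zero (suc j) (suc k) + f (suc j) zero (suc k) + f (suc j) (suc k) zero
    h-diag : ∀ i → h i i ≈ 0#
    h-diag i = trans (+-cong (trans (+-cong (d₃ (suc i) zero) (d₂ (suc i) zero)) (+-identityˡ 0#))
                             (d₁ (suc i) zero))
                     (+-identityˡ 0#)
    a = ∑ λ j → ∑ λ k → f zero (suc j) (suc k)
    b = ∑ λ j → ∑ λ k → f (suc j) zero (suc k)
    c = ∑ λ j → ∑ λ k → f (suc j) (suc k) zero
    e = ∑ λ i → ∑ λ j → ∑ λ k → f (suc i) (suc j) (suc k)
    at-zero : ∑ (λ j → ∑ λ k → f zero j k) ≈ a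
    at-zero = begin
      ∑ (λ j → ∑ λ k → f zero j k)
        ≈⟨ ∑-suc ⟩
      ∑ (λ k → f zero zero k) + ∑ (λ j → ∑ λ k → f zero (suc j) k)
        ≈⟨ +-cong (∑-≈0 (d₁ zero)) (∑-cong λ j → trans ∑-suc (trans (+-congʳ (d₂ zero (suc j))) (+-identityˡ _))) ⟩
      0# + a
        ≈⟨ +-identityˡ a ⟩
      a ∎
    at-suc : ∀ i → ∑ (λ j → ∑ λ k → f (suc i) j k)
                   ≈ ∑ (λ k → f (suc i) zero (suc k))
                     + (∑ (λ j → f (suc i) (suc j) zero) + ∑ λ j → ∑ λ k → f (suc i) (suc j) (suc k))
    at-suc i = trans ∑-suc₂ (+-congʳ (trans (+-congʳ (d₃ zero (suc i))) (+-identityˡ _)))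

-- Determinants

infixr 5 _◂_
_◂_ : ∀ {A : Set} {m} → A → (Fin m → A) → Fin (suc m) → A
(x ◂ f) zero    = x
(x ◂ f) (suc i) = f i

select : ∀ {n d} (α : Subset n) → .(∣ α ∣ ≡ d) → Fin d → Fin n
select α e k = element α (cast (≡.sym e) k)

module Determinants (R : CommutativeRing 0ℓ 0ℓ) where
  open CommutativeRing R hiding (zero)
  open IntegerSolver R
  open FiniteSums R
  open Matrices rawRing using (Matrix; _·_; det)
  open import Algebra.Definitions.RawSemiring (RawRing.rawSemiring rawRing) using (_^_)
  open import Relation.Binary.Reasoning.Setoid setoid

  sgn : ∀ {n} → Fin n → Carrier
  sgn j = (- 1#) ^ toℕ j

  opaque
    unfolding ∑

    Det : ∀ {n} → Matrix n n → Carrier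
    Det = det

    Det≡det : ∀ {n} (M : Matrix n n) → Det M ≡ det M
    Det≡det M = ≡.refl

    Det-zero : {M : Matrix 0 0} → Det M ≈ 1#
    Det-zero = refl

    Det-suc : ∀ {n} {M : Matrix (suc n) (suc n)} →
              Det M ≈ ∑ λ j → sgn j * (M zero j * Det (λ i k → M (suc i) (punchIn j k)))
    Det-suc = refl

  Det-cong : ∀ {n} {M N : Matrix n n} → (∀ i j → M i j ≈ N i j) → Det M ≈ Det N
  Det-cong {zero}  M≈N = trans Det-zero (sym Det-zero)
  Det-cong {suc n} M≈N =
    trans Det-suc (trans (∑-cong λ j → *-congˡ (*-cong (M≈N zero j) (Det-cong λ i k → M≈N (suc i) (punchIn j k))))
                         (sym Det-suc))

  Det-cong-≡ : ∀ {n} {M N : Matrix n n} → (∀ i j → M i j ≡ N i j) → Det M ≈ Det N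
  Det-cong-≡ M≡N = Det-cong λ i j → reflexive (M≡N i j)

  -- The terms (j, k) and (k, j) of a symmetric weight cancel.
  ∑-alternating : ∀ {n} (w : Fin (2 ℕ.+ n) → Fin (2 ℕ.+ n) → Carrier)
                  (F : (Fin n → Fin (2 ℕ.+ n)) → Carrier) →
                  (∀ {σ τ} → (∀ k → σ k ≡ τ k) → F σ ≈ F τ) →
                  (∀ i j → w i j ≈ w j i) →
                  ∑ (λ i → ∑ λ k → sgn i * (sgn k * (w i (punchIn i k) * F (λ l → punchIn i (punchIn k l))))) ≈ 0#
  ∑-alternating {n} w F F-cong w-sym = begin
    ∑ (λ i → ∑ λ k → t i k)
      ≈⟨ ∑-suc ⟩
    ∑ (λ k → t zero k) + ∑ (λ i → ∑ λ k → t (suc i) k)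
      ≈⟨ +-cong (∑-cong λ k → *-identityˡ _) (trans (∑-cong λ i → ∑-suc) ∑-+) ⟩
    a + (∑ (λ i → t (suc i) zero) + ∑ (λ i → ∑ λ k → t (suc i) (suc k)))
      ≈⟨ +-congˡ (+-cong (trans (∑-cong flip-sign) (sym (*-∑ _))) (rest n w F F-cong w-sym)) ⟩
    a + (- 1# * a + 0#)
      ≈⟨ solve 1 (λ a → a :+ (:- con (+ 1) :* a :+ con (+ 0)) := con (+ 0)) refl a ⟩
    0# ∎
    where
    t : Fin (2 ℕ.+ n) → Fin (suc n) → Carrier
    t i k = sgn i * (sgn k * (w i (punchIn i k) * F (λ l → punchIn i (punchIn k l))))
    a = ∑ λ k → sgn k * (w zero (suc k) * F (λ l → suc (punchIn k l)))
    flip-sign : ∀ i → t (suc i) zero ≈ - 1# * (sgn i * (w zero (suc i) * F (λ l → suc (punchIn i l))))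
    flip-sign i = trans (*-congˡ (*-congˡ (*-congʳ (w-sym (suc i) zero))))
      (solve 3 (λ s w f → :- con (+ 1) :* s :* (con (+ 1) :* (w :* f)) := :- con (+ 1) :* (s :* (w :* f)))
             refl (sgn i) (w zero (suc i)) (F (λ l → suc (punchIn i l))))
    rest : ∀ n (w : Fin (2 ℕ.+ n) → Fin (2 ℕ.+ n) → Carrier)
           (F : (Fin n → Fin (2 ℕ.+ n)) → Carrier) →
           (∀ {σ τ} → (∀ k → σ k ≡ τ k) → F σ ≈ F τ) →
           (∀ i j → w i j ≈ w j i) →
           ∑ (λ (i : Fin (suc n)) → ∑ λ (k : Fin n) →
             sgn (suc i) * (sgn (suc k) * (w (suc i) (suc (punchIn i k)) * F (λ l → punchIn (suc i) (punchIn (suc k) l))))) ≈ 0#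
    rest zero    w F F-cong w-sym = ∑-≈0 λ i → ∑-zero
    rest (suc n) w F F-cong w-sym =
      trans (∑-cong λ i → ∑-cong λ k → trans
              (solve 4 (λ s t w f → :- con (+ 1) :* s :* (:- con (+ 1) :* t :* (w :* f)) := s :* (t :* (w :* f)))
                     refl (sgn i) (sgn k) _ _)
              (*-congˡ (*-congˡ (*-congˡ (F-cong λ { zero → ≡.refl ; (suc l) → ≡.refl })))))
        (∑-alternating (λ i j → w (suc i) (suc j)) (λ σ → F (lift 1 σ))
          (λ σ≡τ → F-cong λ { zero → ≡.refl ; (suc l) → ≡.cong suc (σ≡τ l) })
          (λ i j → w-sym (suc i) (suc j)))

  ∑-exchange : ∀ {m n} {s u : Fin m → Carrier} {t v : Fin n → Carrier} {D : Fin m → Fin n → Carrier} →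
               ∑ (λ j → s j * (u j * ∑ λ i → t i * (v i * D j i)))
               ≈ ∑ (λ i → t i * (v i * ∑ λ j → s j * (u j * D j i)))
  ∑-exchange {s = s} {u} {t} {v} {D} =
    trans (∑-cong λ j → trans (*-congˡ (*-∑ (u j))) (*-∑ (s j)))
      (trans ∑-comm (∑-cong λ i → trans (∑-cong λ j →
        solve 5 (λ s u t v D → s :* (u :* (t :* (v :* D))) := t :* (v :* (s :* (u :* D)))) refl
              (s j) (u j) (t i) (v i) (D j i))
        (sym (trans (*-congˡ (*-∑ (v i))) (*-∑ (t i))))))

  -- Expand along the first row and, by induction, every minor away from the corner along its first
  -- column. After the two sums are exchanged, the inner one is the row expansion of the minor
  -- belonging to row i + 1; the product of the two signs is the same either way.
  Det-expand-column : ∀ {n} {M : Matrix (suc n) (suc n)} →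
                      Det M ≈ ∑ λ i → sgn i * (M i zero * Det (λ r c → M (punchIn i r) (suc c)))
  Det-expand-column {zero}  {M} =
    trans Det-suc (trans ∑-suc (trans (+-cong (*-congˡ (*-congˡ (trans Det-zero (sym Det-zero)))) (trans ∑-zero (sym ∑-zero))) (sym ∑-suc)))
  Det-expand-column {suc n} {M} = begin
    Det M
      ≈⟨ trans Det-suc ∑-suc ⟩
    corner + ∑ (λ j → sgn (suc j) * (M zero (suc j) * Det (λ r c → M (suc r) (punchIn (suc j) c))))
      ≈⟨ +-congˡ (∑-cong λ j → *-congˡ (*-congˡ Det-expand-column)) ⟩
    corner + ∑ (λ j → sgn (suc j) * (M zero (suc j) * ∑ λ i → sgn i * (M (suc i) zero * D j i)))
      ≈⟨ +-congˡ ∑-exchange ⟩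
    corner + ∑ (λ i → sgn i * (M (suc i) zero * ∑ λ j → sgn (suc j) * (M zero (suc j) * D j i)))
      ≈⟨ +-congˡ (∑-cong λ i → trans
           (*-congˡ (*-congˡ (trans (∑-cong λ j → *-assoc _ _ _) (sym (*-∑ _)))))
           (solve 3 (λ s m x → s :* (m :* (:- con (+ 1) :* x)) := :- con (+ 1) :* s :* (m :* x)) refl _ _ _)) ⟩
    corner + ∑ (λ i → sgn (suc i) * (M (suc i) zero * ∑ λ j → sgn j * (M zero (suc j) * D j i)))
      ≈⟨ +-congˡ (∑-cong λ i → *-congˡ (*-congˡ Det-suc)) ⟨
    corner + ∑ (λ i → sgn (suc i) * (M (suc i) zero * Det (λ r c → M (punchIn (suc i) r) (suc c))))
      ≈⟨ ∑-suc ⟨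
    ∑ (λ i → sgn i * (M i zero * Det (λ r c → M (punchIn i r) (suc c)))) ∎
    where
    corner = sgn {suc (suc n)} zero * (M zero zero * Det (λ r c → M (suc r) (suc c)))
    D : Fin (suc n) → Fin (suc n) → Carrier
    D j i = Det (λ r c → M (suc (punchIn i r)) (suc (punchIn j c)))

  Det-row-linear : ∀ {n} (u v : Fin (suc n) → Carrier) x (X : Matrix n (suc n)) →
                   Det ((λ j → u j + x * v j) ◂ X) ≈ Det (u ◂ X) + x * Det (v ◂ X)
  Det-row-linear u v x X = begin
    Det ((λ j → u j + x * v j) ◂ X)
      ≈⟨ Det-suc ⟩
    ∑ (λ j → sgn j * ((u j + x * v j) * D j))
      ≈⟨ trans (∑-cong λ j →
           solve 5 (λ s u x v D → s :* ((u :+ x :* v) :* D) := s :* (u :* D) :+ x :* (s :* (v :* D))) refl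
                 (sgn j) (u j) x (v j) (D j))
           (trans ∑-+ (+-congˡ (sym (*-∑ x)))) ⟩
    ∑ (λ j → sgn j * (u j * D j)) + x * ∑ (λ j → sgn j * (v j * D j))
      ≈⟨ +-cong Det-suc (*-congˡ Det-suc) ⟨
    Det (u ◂ X) + x * Det (v ◂ X) ∎
    where
    D : Fin _ → Carrier
    D j = Det (λ i k → X i (punchIn j k))

  Det-expand₂ : ∀ {n} (u v : Fin (2 ℕ.+ n) → Carrier) (X : Matrix n (2 ℕ.+ n)) →
                Det (u ◂ v ◂ X) ≈ ∑ λ j → ∑ λ k →
                  sgn j * (sgn k * (u j * v (punchIn j k) * Det (λ r s → X r (punchIn j (punchIn k s)))))
  Det-expand₂ u v X =
    trans Det-suc (∑-cong λ j → trans (*-congˡ (*-congˡ Det-suc))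
      (trans (trans (*-congˡ (*-∑ (u j))) (*-∑ (sgn j))) (∑-cong λ k →
        solve 5 (λ s u t v D → s :* (u :* (t :* (v :* D))) := s :* (t :* (u :* v :* D))) refl _ _ _ _ _)))

  -- The weight `u i * u j` is symmetric, so the terms of the double expansion cancel in pairs.
  Det-equal-rows : ∀ {n} (u : Fin (2 ℕ.+ n) → Carrier) (X : Matrix n (2 ℕ.+ n)) → Det (u ◂ u ◂ X) ≈ 0#
  Det-equal-rows u X = trans (Det-expand₂ u u X)
    (∑-alternating (λ i j → u i * u j) (λ σ → Det λ r s → X r (σ s))
      (λ σ≡τ → Det-cong-≡ λ r s → ≡.cong (X r) (σ≡τ s)) (λ i j → *-comm _ _))

  -- The two expansions add up to one with the symmetric weight `u i * v j + v i * u j`.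
  Det-swap-rows : ∀ {n} (u v : Fin (2 ℕ.+ n) → Carrier) (X : Matrix n (2 ℕ.+ n)) →
                  Det (u ◂ v ◂ X) ≈ - Det (v ◂ u ◂ X)
  Det-swap-rows u v X = x+y≈0⇒x≈-y (begin
    Det (u ◂ v ◂ X) + Det (v ◂ u ◂ X)
      ≈⟨ +-cong (Det-expand₂ u v X) (Det-expand₂ v u X) ⟩
    _
      ≈⟨ trans (∑-cong λ j → trans (∑-cong λ k →
           solve 5 (λ s t a b D → s :* (t :* ((a :+ b) :* D)) := s :* (t :* (a :* D)) :+ s :* (t :* (b :* D))) refl
             (sgn j) (sgn k) (u j * v (punchIn j k)) (v j * u (punchIn j k)) (F (λ l → punchIn j (punchIn k l)))) ∑-+) ∑-+ ⟨
    ∑ (λ j → ∑ λ k → sgn j * (sgn k * ((u j * v (punchIn j k) + v j * u (punchIn j k)) * F (λ l → punchIn j (punchIn k l)))))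
      ≈⟨ ∑-alternating (λ i j → u i * v j + v i * u j) F
           (λ σ≡τ → Det-cong-≡ λ r s → ≡.cong (X r) (σ≡τ s))
           (λ i j → solve 4 (λ a b c d → a :* b :+ c :* d := d :* c :+ b :* a) refl (u i) (v j) (v i) (u j)) ⟩
    0# ∎)
    where
    F : (Fin _ → Fin _) → Carrier
    F σ = Det λ r s → X r (σ s)
    x+y≈0⇒x≈-y : ∀ {x y} → x + y ≈ 0# → x ≈ - y
    x+y≈0⇒x≈-y {x} {y} x+y≈0 = trans
      (solve 2 (λ x y → x := x :+ y :+ :- y) refl x y) (trans (+-congʳ x+y≈0) (+-identityˡ _))

  -- The matrix determinant lemma. Row i is replaced by `c`, which is moved to the top at the cost
  -- of `sgn i`. Terms of higher order in `a` are absent because they would contain the row `c`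
  -- twice.
  Det-rank-one-update : ∀ {n} (N : Matrix (suc n) (suc n)) (a c : Fin (suc n) → Carrier) →
                        Det (λ i j → N i j + a i * c j)
                        ≈ Det N + ∑ λ i → sgn i * (a i * Det (c ◂ λ r → N (punchIn i r)))
  Det-rank-one-update {zero} N a c = begin
    Det (λ i j → N i j + a i * c j)
      ≈⟨ trans Det-suc (trans ∑-suc (+-cong (*-congˡ (*-congˡ Det-zero)) ∑-zero)) ⟩
    1# * ((N zero zero + a zero * c zero) * 1#) + 0#
      ≈⟨ solve 3 (λ n a c → con (+ 1) :* ((n :+ a :* c) :* con (+ 1)) :+ con (+ 0)
                   := (con (+ 1) :* (n :* con (+ 1)) :+ con (+ 0))
                      :+ (con (+ 1) :* (a :* (con (+ 1) :* (c :* con (+ 1)) :+ con (+ 0))) :+ con (+ 0))) refl _ _ _ ⟩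
    (1# * (N zero zero * 1#) + 0#) + (1# * (a zero * (1# * (c zero * 1#) + 0#)) + 0#)
      ≈⟨ +-cong (expand₁ (N zero zero)) (trans ∑-suc (+-cong (*-congˡ (*-congˡ (expand₁ (c zero)))) ∑-zero)) ⟨
    Det N + ∑ (λ i → sgn i * (a i * Det (c ◂ λ r → N (punchIn i r)))) ∎
    where
    expand₁ : ∀ x {M : Matrix 1 1} → Det M ≈ 1# * (M zero zero * 1#) + 0#
    expand₁ _ = trans Det-suc (trans ∑-suc (+-cong (*-congˡ (*-congˡ Det-zero)) ∑-zero))
  Det-rank-one-update {suc n} N a c = begin
    Det (λ i j → N i j + a i * c j)
      ≈⟨ Det-suc ⟩
    ∑ (λ j → sgn j * (u j * Det (λ i k → N (suc i) (punchIn j k) + a (suc i) * c (punchIn j k))))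
      ≈⟨ ∑-cong (λ j → *-congˡ (*-congˡ (trans
           (Det-rank-one-update (λ i k → N (suc i) (punchIn j k)) (a ∘ suc) (c ∘ punchIn j))
           (+-congˡ (∑-cong λ i → *-congˡ (*-congˡ (Det-cong-≡ λ { zero s → ≡.refl ; (suc r) s → ≡.refl }))))))) ⟩
    ∑ (λ j → sgn j * (u j * (P j + ∑ λ i → sgn i * (a (suc i) * D j i))))
      ≈⟨ trans (∑-cong λ j → trans (*-congˡ (distribˡ _ _ _)) (distribˡ _ _ _)) ∑-+ ⟩
    ∑ (λ j → sgn j * (u j * P j)) + ∑ (λ j → sgn j * (u j * ∑ λ i → sgn i * (a (suc i) * D j i)))
      ≈⟨ +-cong (sym Det-suc) ∑-exchange ⟩
    Det (u ◂ N′) + ∑ (λ i → sgn i * (a (suc i) * ∑ λ j → sgn j * (u j * D j i)))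
      ≈⟨ +-congˡ (∑-cong λ i → *-congˡ (*-congˡ Det-suc)) ⟨
    Det (u ◂ N′) + ∑ (λ i → sgn i * (a (suc i) * Det (u ◂ c ◂ X i)))
      ≈⟨ +-cong (Det-row-linear (N zero) c (a zero) N′) (∑-cong λ i → move-row i) ⟩
    (Det (N zero ◂ N′) + a zero * Det (c ◂ N′)) + ∑ (λ i → sgn (suc i) * (a (suc i) * Det (c ◂ N zero ◂ X i)))
      ≈⟨ trans (+-assoc _ _ _) (+-congˡ (+-congʳ (sym (*-identityˡ _)))) ⟩
    Det (N zero ◂ N′) + (1# * (a zero * Det (c ◂ N′)) + ∑ (λ i → sgn (suc i) * (a (suc i) * Det (c ◂ N zero ◂ X i))))
      ≈⟨ +-cong (Det-cong-≡ λ { zero s → ≡.refl ; (suc r) s → ≡.refl })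
                (trans (+-congˡ (∑-cong λ i → *-congˡ (*-congˡ (Det-cong-≡
                  λ { zero s → ≡.refl ; (suc zero) s → ≡.refl ; (suc (suc r)) s → ≡.refl })))) (sym ∑-suc)) ⟩
    Det N + ∑ (λ i → sgn i * (a i * Det (c ◂ λ r → N (punchIn i r)))) ∎
    where
    N′ : Matrix (suc n) (2 ℕ.+ n)
    N′ i = N (suc i)
    u : Fin (2 ℕ.+ n) → Carrier
    u j = N zero j + a zero * c j
    X : Fin (suc n) → Matrix n (2 ℕ.+ n)
    X i r = N (suc (punchIn i r))
    P : Fin (2 ℕ.+ n) → Carrier
    P j = Det λ i k → N (suc i) (punchIn j k)
    D : Fin (2 ℕ.+ n) → Fin (suc n) → Carrier
    D j i = Det λ r s → (c ◂ X i) r (punchIn j s)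
    -- Below `u` the row `c` already occurs, so the part `a zero * c` of `u` drops out. Moving `c`
    -- above `N zero` costs the sign that turns `sgn i` into `sgn (suc i)`.
    move-row : ∀ i → sgn i * (a (suc i) * Det (u ◂ c ◂ X i))
                     ≈ sgn (suc i) * (a (suc i) * Det (c ◂ N zero ◂ X i))
    move-row i = trans
      (*-congˡ (*-congˡ (trans (Det-row-linear (N zero) c (a zero) (c ◂ X i))
        (+-cong (Det-swap-rows (N zero) c (X i)) (*-congˡ (Det-equal-rows c (X i)))))))
      (solve 4 (λ s a D b → s :* (a :* (:- D :+ b :* con (+ 0))) := :- con (+ 1) :* s :* (a :* D)) refl
             (sgn i) (a (suc i)) (Det (c ◂ N zero ◂ X i)) (a zero))

  -- Column `zero` of `A` and row `zero` of `C` contribute a rank-one matrix to the product. In the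
  -- resulting update the unperturbed determinant is the sum over the subsets avoiding `zero`. The
  -- correction, with induction applied to its minors, factors into a column expansion for `A` and a
  -- row expansion for `C`, which accounts for the subsets containing `zero`.
  cauchy-binet : ∀ n d (A : Matrix d n) (C : Matrix n d) →
                 Det (λ i j → ∑ λ k → A i k * C k j)
                 ≈ subsetSum n d λ α e → Det (λ i k → A i (select α e k)) * Det (λ k j → C (select α e k) j)
  cauchy-binet zero    zero    A C = trans Det-zero (sym (trans (*-cong Det-zero Det-zero) (*-identityˡ _)))
  cauchy-binet zero    (suc d) A C =
    trans Det-suc (∑-≈0 λ j → trans (*-congˡ (trans (*-congʳ ∑-zero) (zeroˡ _))) (zeroʳ _))
  cauchy-binet (suc n) zero    A C =
    trans (Det-cong λ ()) (trans (cauchy-binet n zero (λ ()) (λ _ ()))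
      (subsetSum-cong n zero λ α e → *-cong (Det-cong λ ()) (Det-cong λ ())))
  cauchy-binet (suc n) (suc d) A C = begin
    Det (λ i j → ∑ λ k → A i k * C k j)
      ≈⟨ Det-cong (λ i j → trans ∑-suc (+-comm _ _)) ⟩
    Det (λ i j → N i j + A i zero * C zero j)
      ≈⟨ Det-rank-one-update N (λ i → A i zero) (C zero) ⟩
    Det N + ∑ (λ i → sgn i * (A i zero * Det (C zero ◂ λ r → N (punchIn i r))))
      ≈⟨ +-cong (cauchy-binet n (suc d) _ _) (∑-cong λ i → *-congˡ (*-congˡ (trans Det-suc
           (∑-cong λ j → *-congˡ (*-congˡ (cauchy-binet n d (λ r k → A (punchIn i r) (suc k)) (λ k s → C (suc k) (punchIn j s)))))))) ⟩
    without + ∑ (λ i → sgn i * (A i zero * ∑ λ j → sgn j * (C zero j * subsetSum n d λ α e → P i α e * Q j α e)))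
      ≈⟨ +-congˡ regroup ⟩
    without + subsetSum n d (λ α e → ∑ (λ i → sgn i * (A i zero * P i α e)) * ∑ (λ j → sgn j * (C zero j * Q j α e)))
      ≈⟨ +-congˡ (subsetSum-cong n d λ α e → *-cong Det-expand-column Det-suc) ⟨
    without + subsetSum n d (λ α e → Det (λ i k → A i (select (inside ∷ α) (≡.cong suc e) k))
                                     * Det (λ k j → C (select (inside ∷ α) (≡.cong suc e) k) j))
      ≈⟨ +-comm _ _ ⟩
    subsetSum (suc n) (suc d) (λ α e → Det (λ i k → A i (select α e k)) * Det (λ k j → C (select α e k) j)) ∎
    where
    N : Matrix (suc d) (suc d)
    N i j = ∑ λ k → A i (suc k) * C (suc k) j
    without = subsetSum n (suc d) λ α e →
      Det (λ i k → A i (suc (select α e k))) * Det (λ k j → C (suc (select α e k)) j)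
    P Q : Fin (suc d) → (α : Subset n) → .(∣ α ∣ ≡ d) → Carrier
    P i α e = Det λ r k → A (punchIn i r) (suc (select α e k))
    Q j α e = Det λ k s → C (suc (select α e k)) (punchIn j s)
    regroup : ∑ (λ i → sgn i * (A i zero * ∑ λ j → sgn j * (C zero j * subsetSum n d λ α e → P i α e * Q j α e)))
              ≈ subsetSum n d (λ α e → ∑ (λ i → sgn i * (A i zero * P i α e)) * ∑ (λ j → sgn j * (C zero j * Q j α e)))
    regroup = begin
      ∑ (λ i → sgn i * (A i zero * ∑ λ j → sgn j * (C zero j * subsetSum n d λ α e → P i α e * Q j α e)))
        ≈⟨ ∑-cong (λ i → *-congˡ (*-congˡ (trans
             (∑-cong λ j → trans (*-congˡ (*-distribˡ-subsetSum n d _ _)) (*-distribˡ-subsetSum n d _ _))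
             (sum-subsetSum n d _)))) ⟩
      ∑ (λ i → sgn i * (A i zero * subsetSum n d λ α e → ∑ λ j → sgn j * (C zero j * (P i α e * Q j α e))))
        ≈⟨ trans (∑-cong λ i → trans (*-congˡ (*-distribˡ-subsetSum n d _ _)) (*-distribˡ-subsetSum n d _ _))
                 (sum-subsetSum n d _) ⟩
      subsetSum n d (λ α e → ∑ λ i → sgn i * (A i zero * ∑ λ j → sgn j * (C zero j * (P i α e * Q j α e))))
        ≈⟨ subsetSum-cong n d (λ α e → trans
             (∑-cong λ i → trans
               (*-congˡ (*-congˡ (trans (∑-cong λ j →
                  solve 4 (λ s c p q → s :* (c :* (p :* q)) := p :* (s :* (c :* q))) refl (sgn j) (C zero j) (P i α e) (Q j α e))
                  (sym (*-∑ (P i α e))))))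
               (solve 4 (λ s a p x → s :* (a :* (p :* x)) := x :* (s :* (a :* p))) refl (sgn i) (A i zero) (P i α e) _))
             (trans (sym (*-∑ _)) (*-comm _ _))) ⟩
      subsetSum n d (λ α e → ∑ (λ i → sgn i * (A i zero * P i α e)) * ∑ (λ j → sgn j * (C zero j * Q j α e))) ∎

select-⊤ : ∀ n (k : Fin n) → select ⊤ (∣⊤∣≡n n) k ≡ k
select-⊤ (suc n) zero    = ≡.refl
select-⊤ (suc n) (suc k) = ≡.cong suc (select-⊤ n k)

-- Products of matrices, Vandermonde determinants, Laplace expansion along three rows

module DeterminantProducts (R : CommutativeRing 0ℓ 0ℓ) where
  open CommutativeRing R hiding (zero)
  open IntegerSolver R
  open FiniteSums R
  open Determinants R
  open Matrices rawRing using (Matrix)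
  open import Algebra.Definitions.RawSemiring (RawRing.rawSemiring rawRing) using (_^_)
  open import Relation.Binary.Reasoning.Setoid setoid

  Det-* : ∀ n (A C : Matrix n n) → Det (λ i j → ∑ λ k → A i k * C k j) ≈ Det A * Det C
  Det-* n A C = trans (cauchy-binet n n A C) (trans (subsetSum-full n _)
    (*-cong (Det-cong-≡ λ i k → ≡.cong (A i) (select-⊤ n k))
            (Det-cong-≡ λ k j → ≡.cong (λ l → C l j) (select-⊤ n k))))

  Det-transpose : ∀ {n} (M : Matrix n n) → Det (λ i j → M j i) ≈ Det M
  Det-transpose {zero}  M = Det-cong λ ()
  Det-transpose {suc n} M = trans Det-suc (trans
    (∑-cong λ j → *-congˡ (*-congˡ (Det-transpose λ i k → M (punchIn j i) (suc k))))
    (sym Det-expand-column))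

  ∏ : ∀ {n} → (Fin n → Carrier) → Carrier
  ∏ {zero}  f = 1#
  ∏ {suc n} f = f zero * ∏ (f ∘ suc)

  Det-scale-rows : ∀ {n} (y : Fin n → Carrier) (M : Matrix n n) →
                   Det (λ i j → y i * M i j) ≈ ∏ y * Det M
  Det-scale-rows {zero}  y M = trans (Det-cong λ ()) (sym (*-identityˡ _))
  Det-scale-rows {suc n} y M = begin
    Det (λ i j → y i * M i j)
      ≈⟨ Det-suc ⟩
    ∑ (λ j → sgn j * ((y zero * M zero j) * Det (λ i k → y (suc i) * M (suc i) (punchIn j k))))
      ≈⟨ ∑-cong (λ j → trans (*-congˡ (*-congˡ (Det-scale-rows (y ∘ suc) (λ i k → M (suc i) (punchIn j k)))))
           (solve 5 (λ s a m p D → s :* (a :* m :* (p :* D)) := a :* p :* (s :* (m :* D))) refl _ _ _ _ _)) ⟩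
    ∑ (λ j → ∏ y * (sgn j * (M zero j * Det (λ i k → M (suc i) (punchIn j k)))))
      ≈⟨ trans (*-congˡ Det-suc) (*-∑ (∏ y)) ⟨
    ∏ y * Det M ∎

  Det-scale-columns : ∀ {n} (y : Fin n → Carrier) (M : Matrix n n) →
                      Det (λ i j → M i j * y j) ≈ ∏ y * Det M
  Det-scale-columns {zero}  y M = trans (Det-cong λ ()) (sym (*-identityˡ _))
  Det-scale-columns {suc n} y M = begin
    Det (λ i j → M i j * y j)
      ≈⟨ Det-expand-column ⟩
    ∑ (λ i → sgn i * ((M i zero * y zero) * Det (λ r c → M (punchIn i r) (suc c) * y (suc c))))
      ≈⟨ ∑-cong (λ i → trans (*-congˡ (*-congˡ (Det-scale-columns (y ∘ suc) (λ r c → M (punchIn i r) (suc c)))))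
           (solve 5 (λ s a m p D → s :* (m :* a :* (p :* D)) := a :* p :* (s :* (m :* D))) refl _ _ _ _ _)) ⟩
    ∑ (λ i → ∏ y * (sgn i * (M i zero * Det (λ r c → M (punchIn i r) (suc c)))))
      ≈⟨ trans (*-congˡ Det-expand-column) (*-∑ (∏ y)) ⟨
    ∏ y * Det M ∎

  vandermonde : ∀ {m n} → (Fin n → Carrier) → Matrix m n
  vandermonde x i j = x j ^ toℕ i

  -- Left multiplication by this matrix subtracts x times each row from the next.
  subtract-rows : ∀ {n} → Carrier → Matrix n n
  subtract-rows x zero    zero          = 1#
  subtract-rows x zero    (suc k)       = 0#
  subtract-rows x (suc i) (suc k)       = subtract-rows x i k
  subtract-rows x (suc zero) zero       = - x
  subtract-rows x (suc (suc i)) zero    = 0#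

  Det-subtract-rows : ∀ n x → Det (subtract-rows {n} x) ≈ 1#
  Det-subtract-rows zero    x = Det-zero
  Det-subtract-rows (suc n) x = begin
    Det (subtract-rows x)
      ≈⟨ trans Det-suc ∑-suc ⟩
    1# * (1# * Det (subtract-rows {n} x)) + ∑ (λ j → sgn (suc j) * (0# * _))
      ≈⟨ +-cong (trans (*-identityˡ _) (trans (*-identityˡ _) (Det-subtract-rows n x)))
                (∑-≈0 λ j → trans (*-congˡ (zeroˡ _)) (zeroʳ _)) ⟩
    1# + 0#
      ≈⟨ +-identityʳ 1# ⟩
    1# ∎

  subtract-rows-zero : ∀ {n} x (v : Fin (suc n) → Carrier) → ∑ (λ k → subtract-rows x zero k * v k) ≈ v zero
  subtract-rows-zero x v = trans ∑-suc
    (trans (+-cong (*-identityˡ _) (∑-≈0 λ k → zeroˡ _)) (+-identityʳ _))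

  subtract-rows-suc : ∀ {n} x (v : Fin (suc n) → Carrier) (i : Fin n) →
                      ∑ (λ k → subtract-rows x (suc i) k * v k) ≈ v (suc i) - x * v (inject₁ i)
  subtract-rows-suc x v zero = trans ∑-suc (trans (+-congˡ (subtract-rows-zero x (v ∘ suc)))
    (solve 3 (λ x a b → :- x :* a :+ b := b :- x :* a) refl x (v zero) (v (suc zero))))
  subtract-rows-suc x v (suc i) = trans ∑-suc
    (trans (+-cong (zeroˡ _) (subtract-rows-suc x (v ∘ suc) i)) (+-identityˡ _))

  -- Subtracting `x zero` times each row from the next, done as left multiplication by a matrix of
  -- determinant 1, clears the first column below its top entry. Below the top row, each other
  -- column then has the common factor `x (suc c) - x zero`.
  Det-vandermonde : ∀ {n} (x : Fin (suc n) → Carrier) →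
                    Det (vandermonde x) ≈ ∏ (λ j → x (suc j) - x zero) * Det (vandermonde (x ∘ suc))
  Det-vandermonde {n} x = begin
    Det V
      ≈⟨ *-identityˡ _ ⟨
    1# * Det V
      ≈⟨ *-congʳ (Det-subtract-rows (suc n) (x zero)) ⟨
    Det (subtract-rows (x zero)) * Det V
      ≈⟨ Det-* (suc n) (subtract-rows (x zero)) V ⟨
    Det W
      ≈⟨ trans Det-expand-column ∑-suc ⟩
    1# * (W zero zero * Det (λ r c → W (suc r) (suc c)))
      + ∑ (λ i → sgn (suc i) * (W (suc i) zero * Det (λ r c → W (punchIn (suc i) r) (suc c))))
      ≈⟨ +-cong (trans (*-identityˡ _) (*-congʳ (subtract-rows-zero (x zero) (λ k → V k zero))))
                (∑-≈0 λ i → trans (*-congˡ (trans (*-congʳ (first-column i)) (zeroˡ _))) (zeroʳ _)) ⟩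
    1# * Det (λ r c → W (suc r) (suc c)) + 0#
      ≈⟨ trans (+-identityʳ _) (*-identityˡ _) ⟩
    Det (λ r c → W (suc r) (suc c))
      ≈⟨ Det-cong (λ r c → trans (W-suc r (suc c))
           (solve 3 (λ a b p → a :* p :- b :* p := p :* (a :- b)) refl (x (suc c)) (x zero) (x (suc c) ^ toℕ r))) ⟩
    Det (λ r c → x (suc c) ^ toℕ r * (x (suc c) - x zero))
      ≈⟨ Det-scale-columns (λ c → x (suc c) - x zero) (vandermonde (x ∘ suc)) ⟩
    ∏ (λ j → x (suc j) - x zero) * Det (vandermonde (x ∘ suc)) ∎
    where
    V W : Matrix (suc n) (suc n)
    V = vandermonde x
    W i j = ∑ λ k → subtract-rows (x zero) i k * V k j
    W-suc : ∀ i j → W (suc i) j ≈ x j * x j ^ toℕ i - x zero * x j ^ toℕ i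
    W-suc i j = trans (subtract-rows-suc (x zero) (λ k → V k j) i)
      (reflexive (≡.cong (λ m → x j * x j ^ toℕ i - x zero * x j ^ m) (Fin.toℕ-inject₁ i)))
    first-column : ∀ i → W (suc i) zero ≈ 0#
    first-column i = trans (W-suc i zero) (-‿inverseʳ _)

  δ : ∀ {n} → Fin n → Fin n → Carrier
  δ zero    zero    = 1#
  δ zero    (suc j) = 0#
  δ (suc i) zero    = 0#
  δ (suc i) (suc j) = δ i j

  δ-punchIn : ∀ {n} i (j k : Fin n) → δ (punchIn i j) (punchIn i k) ≡ δ j k
  δ-punchIn zero    j       k       = ≡.refl
  δ-punchIn (suc i) zero    zero    = ≡.refl
  δ-punchIn (suc i) zero    (suc k) = ≡.refl
  δ-punchIn (suc i) (suc j) zero    = ≡.refl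
  δ-punchIn (suc i) (suc j) (suc k) = δ-punchIn i j k

  ∑-δ : ∀ {n} (i : Fin n) {f : Fin n → Carrier} → ∑ (λ j → δ i j * f j) ≈ f i
  ∑-δ zero = trans ∑-suc (trans (+-cong (*-identityˡ _) (∑-≈0 λ j → zeroˡ _)) (+-identityʳ _))
  ∑-δ (suc i) = trans ∑-suc (trans (+-cong (zeroˡ _) (∑-δ i)) (+-identityˡ _))

  Det-unit-row : ∀ {n} i (X : Matrix n (suc n)) → Det (δ i ◂ X) ≈ sgn i * Det (λ r c → X r (punchIn i c))
  Det-unit-row i X = trans Det-suc (trans
    (∑-cong λ j → solve 3 (λ s d D → s :* (d :* D) := d :* (s :* D)) refl (sgn j) (δ i j) _) (∑-δ i))

  Det-expand-unit₁ : ∀ {n} u (X : Matrix n (suc n)) → Det (u ◂ X) ≈ ∑ λ i → u i * Det (δ i ◂ X)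
  Det-expand-unit₁ u X = trans Det-suc (∑-cong λ i → trans
    (solve 3 (λ s u D → s :* (u :* D) := u :* (s :* D)) refl (sgn i) (u i) _)
    (*-congˡ (sym (Det-unit-row i X))))

  -- Linearity in the second row comes from the first row by a swap and a swap back; the third row
  -- is later reduced to the second in the same way.
  Det-expand-unit₂ : ∀ {n} a v (X : Matrix n (2 ℕ.+ n)) → Det (a ◂ v ◂ X) ≈ ∑ λ j → v j * Det (a ◂ δ j ◂ X)
  Det-expand-unit₂ a v X = begin
    Det (a ◂ v ◂ X)                           ≈⟨ Det-swap-rows a v X ⟩
    - Det (v ◂ a ◂ X)                         ≈⟨ -‿cong (Det-expand-unit₁ v (a ◂ X)) ⟩
    - ∑ (λ j → v j * Det (δ j ◂ a ◂ X))       ≈⟨ solve 1 (λ x → :- x := :- con (+ 1) :* x) refl _ ⟩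
    - 1# * ∑ (λ j → v j * Det (δ j ◂ a ◂ X))
      ≈⟨ trans (*-∑ _) (∑-cong λ j → trans
           (solve 2 (λ v D → :- con (+ 1) :* (v :* D) := v :* :- D) refl (v j) _)
           (*-congˡ (sym (Det-swap-rows a (δ j) X)))) ⟩
    ∑ (λ j → v j * Det (a ◂ δ j ◂ X))         ∎

  Det-cong-tail : ∀ {n} {u : Fin (suc n) → Carrier} {X Y : Matrix n (suc n)} {c} →
                  (∀ j → Det (λ r s → X r (punchIn j s)) ≈ c * Det (λ r s → Y r (punchIn j s))) →
                  Det (u ◂ X) ≈ c * Det (u ◂ Y)
  Det-cong-tail {u = u} {c = c} X≈Y = trans Det-suc (trans
    (∑-cong λ j → trans (*-congˡ (*-congˡ (X≈Y j)))
      (solve 4 (λ s u c D → s :* (u :* (c :* D)) := c :* (s :* (u :* D))) refl (sgn j) (u j) c _))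
    (sym (trans (*-congˡ Det-suc) (*-∑ _))))

  minor-◂₂ : ∀ {n} (v w : Fin (3 ℕ.+ n) → Carrier) (X : Matrix n (3 ℕ.+ n)) j →
             Det (λ r s → (v ◂ w ◂ X) r (punchIn j s))
             ≈ Det ((v ∘ punchIn j) ◂ (w ∘ punchIn j) ◂ λ r s → X r (punchIn j s))
  minor-◂₂ v w X j = Det-cong-≡ λ { zero s → ≡.refl ; (suc zero) s → ≡.refl ; (suc (suc r)) s → ≡.refl }

  Det-swap-rows₂₃ : ∀ {n} u v w (X : Matrix n (3 ℕ.+ n)) → Det (u ◂ v ◂ w ◂ X) ≈ - Det (u ◂ w ◂ v ◂ X)
  Det-swap-rows₂₃ u v w X = trans
    (Det-cong-tail λ j → trans (minor-◂₂ v w X j) (trans (Det-swap-rows _ _ _)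
      (trans (-‿cong (sym (minor-◂₂ w v X j))) (solve 1 (λ x → :- x := :- con (+ 1) :* x) refl _))))
    (solve 1 (λ x → :- con (+ 1) :* x := :- x) refl _)

  Det-equal-rows₂₃ : ∀ {n} u v (X : Matrix n (3 ℕ.+ n)) → Det (u ◂ v ◂ v ◂ X) ≈ 0#
  Det-equal-rows₂₃ u v X = trans
    (Det-cong-tail {Y = v ◂ v ◂ X} λ j → trans (minor-◂₂ v v X j) (trans (Det-equal-rows _ _) (sym (zeroˡ _))))
    (zeroˡ _)

  Det-expand-unit₃ : ∀ {n} a b w (X : Matrix n (3 ℕ.+ n)) →
                     Det (a ◂ b ◂ w ◂ X) ≈ ∑ λ k → w k * Det (a ◂ b ◂ δ k ◂ X)
  Det-expand-unit₃ a b w X = begin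
    Det (a ◂ b ◂ w ◂ X)                           ≈⟨ Det-swap-rows₂₃ a b w X ⟩
    - Det (a ◂ w ◂ b ◂ X)                         ≈⟨ -‿cong (Det-expand-unit₂ a w (b ◂ X)) ⟩
    - ∑ (λ k → w k * Det (a ◂ δ k ◂ b ◂ X))       ≈⟨ solve 1 (λ x → :- x := :- con (+ 1) :* x) refl _ ⟩
    - 1# * ∑ (λ k → w k * Det (a ◂ δ k ◂ b ◂ X))
      ≈⟨ trans (*-∑ _) (∑-cong λ k → trans
           (solve 2 (λ v D → :- con (+ 1) :* (v :* D) := v :* :- D) refl (w k) _)
           (*-congˡ (sym (Det-swap-rows₂₃ a b (δ k) X)))) ⟩
    ∑ (λ k → w k * Det (a ◂ b ◂ δ k ◂ X))         ∎

  det₃ : (a b c a′ b′ c′ a″ b″ c″ : Carrier) → Carrier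
  det₃ a b c a′ b′ c′ a″ b″ c″ =
    a * (b′ * c″) - b * (a′ * c″) + b * (c′ * a″) - a * (c′ * b″) + c * (a′ * b″) - c * (b′ * a″)

  -- The Laplace cofactor of columns i, j, k with its sign built in. As a determinant it alternates
  -- in the three indices, which replaces explicit bookkeeping of signs.
  unitMinor : ∀ {n} → Matrix n (3 ℕ.+ n) → (i j k : Fin (3 ℕ.+ n)) → Carrier
  unitMinor X i j k = Det (δ i ◂ δ j ◂ δ k ◂ X)

  -- Expanding three rows in unit vectors gives a sum over all triples. Those with a repeated index
  -- vanish, and the six orderings of i < j < k collect into a 3 × 3 determinant because
  -- `unitMinor X` alternates.
  laplace₃ : ∀ {n} u v w (X : Matrix n (3 ℕ.+ n)) →
             Det (u ◂ v ◂ w ◂ X)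
             ≈ sum³ (3 ℕ.+ n) λ i j k →
                 det₃ (u i) (u j) (u k) (v i) (v j) (v k) (w i) (w j) (w k) * unitMinor X i j k
  laplace₃ {n} u v w X = begin
    Det (u ◂ v ◂ w ◂ X)
      ≈⟨ Det-expand-unit₁ u _ ⟩
    ∑ (λ i → u i * Det (δ i ◂ v ◂ w ◂ X))
      ≈⟨ ∑-cong (λ i → trans (*-congˡ (trans (Det-expand-unit₂ (δ i) v _)
           (∑-cong λ j → trans (*-congˡ (Det-expand-unit₃ (δ i) (δ j) w X)) (*-∑ (v j)))))
           (trans (*-∑ (u i)) (∑-cong λ j → *-∑ (u i)))) ⟩
    ∑ (λ i → ∑ λ j → ∑ λ k → f i j k)
      ≈⟨ ∑-symmetrise₃ f
           (λ i k → vanish (Det-equal-rows (δ i) _))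
           (λ i k → vanish (trans (Det-swap-rows₂₃ (δ i) (δ k) (δ i) X)
                                  (trans (-‿cong (Det-equal-rows (δ i) _)) (solve 0 (:- con (+ 0) := con (+ 0)) refl))))
           (λ i k → vanish (Det-equal-rows₂₃ (δ k) (δ i) X)) ⟩
    sum³ (3 ℕ.+ n) (λ i j k → (f i j k + f j i k + f j k i) + (f i k j + f k i j + f k j i))
      ≈⟨ sum³-cong (3 ℕ.+ n) (λ i j k → collect i j k) ⟩
    sum³ (3 ℕ.+ n) (λ i j k → det₃ (u i) (u j) (u k) (v i) (v j) (v k) (w i) (w j) (w k) * E i j k) ∎
    where
    E = unitMinor X
    f : (i j k : Fin (3 ℕ.+ n)) → Carrier
    f i j k = u i * (v j * (w k * E i j k))
    vanish : ∀ {a b c d} → d ≈ 0# → a * (b * (c * d)) ≈ 0#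
    vanish d≈0 = trans (*-congˡ (*-congˡ (*-congˡ d≈0)))
      (solve 3 (λ a b c → a :* (b :* (c :* con (+ 0))) := con (+ 0)) refl _ _ _)
    replace : ∀ {a b c d e} → d ≈ e → a * (b * (c * d)) ≈ a * (b * (c * e))
    replace d≈e = *-congˡ (*-congˡ (*-congˡ d≈e))
    swap₁₂ : ∀ i j k → E j i k ≈ - E i j k
    swap₁₂ i j k = Det-swap-rows (δ j) (δ i) _
    swap₂₃ : ∀ i j k → E i k j ≈ - E i j k
    swap₂₃ i j k = Det-swap-rows₂₃ (δ i) (δ k) (δ j) X
    collect : ∀ i j k → (f i j k + f j i k + f j k i) + (f i k j + f k i j + f k j i)
                        ≈ det₃ (u i) (u j) (u k) (v i) (v j) (v k) (w i) (w j) (w k) * E i j k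
    collect i j k = trans
      (+-cong (+-cong (+-congˡ (replace (swap₁₂ i j k)))
                      (replace (trans (swap₂₃ j i k) (-‿cong (swap₁₂ i j k)))))
              (+-cong (+-cong (replace (swap₂₃ i j k))
                              (replace (trans (swap₁₂ i k j) (-‿cong (swap₂₃ i j k)))))
                      (replace (trans (swap₁₂ j k i) (-‿cong (trans (swap₂₃ j i k) (-‿cong (swap₁₂ i j k))))))))
      (solve 10 (λ a b c a′ b′ c′ a″ b″ c″ E →
          a :* (b′ :* (c″ :* E)) :+ b :* (a′ :* (c″ :* :- E)) :+ b :* (c′ :* (a″ :* :- :- E))
            :+ (a :* (c′ :* (b″ :* :- E)) :+ c :* (a′ :* (b″ :* :- :- E)) :+ c :* (b′ :* (a″ :* :- :- :- E)))
          := (a :* (b′ :* c″) :- b :* (a′ :* c″) :+ b :* (c′ :* a″) :- a :* (c′ :* b″)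
              :+ c :* (a′ :* b″) :- c :* (b′ :* a″)) :* E)
        refl (u i) (u j) (u k) (v i) (v j) (v k) (w i) (w j) (w k) (E i j k))

  -- A unit row on top deletes its column from the rows below, and `punchIn` renumbers the rest; any
  -- three distinct columns can be written in this way. This exposes the cofactor as a signed minor,
  -- to which a decomposition can be applied recursively.
  unitMinor-punchIn : ∀ {n} (X : Matrix n (3 ℕ.+ n)) i j k →
                      unitMinor X i (punchIn i j) (punchIn i (punchIn j k))
                      ≈ sgn i * (sgn j * (sgn k * Det λ r c → X r (punchIn i (punchIn j (punchIn k c)))))
  unitMinor-punchIn X i j k =
    trans (Det-unit-row i _) (*-congˡ (trans
      (Det-cong-≡ {N = δ j ◂ δ (punchIn j k) ◂ λ r c → X r (punchIn i c)} λ
        { zero c → δ-punchIn i j c ; (suc zero) c → δ-punchIn i (punchIn j k) c ; (suc (suc r)) c → ≡.refl })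
      (trans (Det-unit-row j _) (*-congˡ (trans
        (Det-cong-≡ {N = δ k ◂ λ r c → X r (punchIn i (punchIn j c))} λ
          { zero c → δ-punchIn j k c ; (suc r) c → ≡.refl })
        (Det-unit-row k _))))))

-- Polynomial rings

module Homomorphisms (R S : CommutativeRing 0ℓ 0ℓ) where
  private
    module R = CommutativeRing R
    module S = CommutativeRing S

  open RingMorphisms R.rawRing S.rawRing public using (IsRingHomomorphism)

  mkIsRingHomomorphism :
    {φ : R.Carrier → S.Carrier} →
    (∀ {x y} → x R.≈ y → φ x S.≈ φ y) →
    (∀ x y → φ (x R.+ y) S.≈ φ x S.+ φ y) → φ R.0# S.≈ S.0# →
    (∀ x y → φ (x R.* y) S.≈ φ x S.* φ y) → φ R.1# S.≈ S.1# →
    (∀ x → φ (R.- x) S.≈ S.- φ x) → IsRingHomomorphism φ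
  mkIsRingHomomorphism cong +-homo 0-homo *-homo 1-homo neg-homo = record
    { isSemiringHomomorphism = record
      { isNearSemiringHomomorphism = record
        { +-isMonoidHomomorphism = record
          { isMagmaHomomorphism = record
            { isRelHomomorphism = record { cong = cong } ; homo = +-homo }
          ; ε-homo = 0-homo }
        ; *-homo = *-homo }
      ; 1#-homo = 1-homo }
    ; -‿homo = neg-homo }

  module Preservation {φ : R.Carrier → S.Carrier} (isHom : IsRingHomomorphism φ) where
    open IsRingHomomorphism isHom
    open S hiding (zero)
    private
      module RΣ = FiniteSums R
      module SΣ = FiniteSums S
      module RD = Determinants R
      module SD = Determinants S
    open RawSemiringDefs (RawRing.rawSemiring R.rawRing) using () renaming (_^_ to _^ᴿ_)
    open RawSemiringDefs (RawRing.rawSemiring S.rawRing) using (_^_)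

    ∑-homo : ∀ {n} {f : Fin n → R.Carrier} → φ (RΣ.∑ f) ≈ SΣ.∑ (λ i → φ (f i))
    ∑-homo {zero}  = trans (⟦⟧-cong RΣ.∑-zero) (trans 0#-homo (sym SΣ.∑-zero))
    ∑-homo {suc n} = trans (⟦⟧-cong RΣ.∑-suc) (trans (+-homo _ _)
      (trans (+-congˡ ∑-homo) (sym SΣ.∑-suc)))

    fromNat-homo : ∀ k → φ (IntegerSolver.fromNat R k) ≈ IntegerSolver.fromNat S k
    fromNat-homo zero          = 0#-homo
    fromNat-homo (suc zero)    = 1#-homo
    fromNat-homo (suc (suc k)) = trans (+-homo _ _) (+-cong 1#-homo (fromNat-homo (suc k)))

    ^-homo : ∀ x k → φ (x ^ᴿ k) ≈ φ x ^ k
    ^-homo x zero    = 1#-homo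
    ^-homo x (suc k) = trans (*-homo _ _) (*-congˡ (^-homo x k))

    sgn-homo : ∀ {n} (j : Fin n) → φ (RD.sgn j) ≈ SD.sgn j
    sgn-homo zero    = 1#-homo
    sgn-homo (suc j) = trans (*-homo _ _)
      (*-cong (trans (-‿homo _) (-‿cong 1#-homo)) (sgn-homo j))

    Det-homo : ∀ {n} {M : Fin n → Fin n → R.Carrier} → φ (RD.Det M) ≈ SD.Det (λ i j → φ (M i j))
    Det-homo {zero}  = trans (⟦⟧-cong RD.Det-zero) (trans 1#-homo (sym SD.Det-zero))
    Det-homo {suc n} = trans (⟦⟧-cong RD.Det-suc) (trans ∑-homo
      (trans (SΣ.∑-cong λ j → trans (*-homo _ _)
               (*-cong (sgn-homo j) (trans (*-homo _ _) (*-congˡ Det-homo))))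
             (sym SD.Det-suc)))

module Coefficients (R : CommutativeRing 0ℓ 0ℓ) where
  open CommutativeRing R hiding (zero)
  open IntegerSolver R
  open Polynomials rawRing

  module _ {n : ℕ} where
    open RawRing (polyRing n) using () renaming (_+_ to _+ₚ_; -_ to -ₚ_)

    coeff-+ : ∀ (p q : Poly n) α → coeff (p +ₚ q) α ≈ coeff p α + coeff q α
    coeff-+ []            q α = sym (+-identityˡ _)
    coeff-+ ((c , β) ∷ p) q α with does (Vec.≡-dec ℕ._≟_ β α)
    ... | true  = trans (+-congˡ (coeff-+ p q α)) (sym (+-assoc _ _ _))
    ... | false = coeff-+ p q α

    coeff-neg : ∀ (p : Poly n) α → coeff (-ₚ p) α ≈ - coeff p α
    coeff-neg []            α = solve 0 (con (+ 0) := :- con (+ 0)) refl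
    coeff-neg ((c , β) ∷ p) α with does (Vec.≡-dec ℕ._≟_ β α)
    ... | true  = trans (+-congˡ (coeff-neg p α)) (solve 2 (λ x y → :- x :+ :- y := :- (x :+ y)) refl c _)
    ... | false = coeff-neg p α

-- A polynomial is determined by the linear functionals p ↦ Σ c · f β over its
-- terms, and products are easy to pair with a functional.
module Pairing {R S : CommutativeRing 0ℓ 0ℓ}
               {φ : CommutativeRing.Carrier R → CommutativeRing.Carrier S}
               (isHom : Homomorphisms.IsRingHomomorphism R S φ) where
  private module R = CommutativeRing R
  open Coefficients R
  open CommutativeRing S hiding (zero)
  open IntegerSolver S
  open Polynomials R.rawRing
  open Homomorphisms.IsRingHomomorphism R S isHom
  open import Relation.Binary.Reasoning.Setoid setoid

  ⟨_,_⟩ : ∀ {n} → Poly n → (Vec ℕ n → Carrier) → Carrier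
  ⟨ []          , f ⟩ = 0#
  ⟨ (c , β) ∷ p , f ⟩ = φ c * f β + ⟨ p , f ⟩

  module _ {n : ℕ} where
    open RawRing (polyRing n) using () renaming (_≈_ to _≈ₚ_; _+_ to _+ₚ_; _*_ to _*ₚ_; -_ to -ₚ_)

    ⟨⟩-cong : ∀ (p : Poly n) {f g} → (∀ α → f α ≈ g α) → ⟨ p , f ⟩ ≈ ⟨ p , g ⟩
    ⟨⟩-cong []            f≈g = refl
    ⟨⟩-cong ((c , β) ∷ p) f≈g = +-cong (*-congˡ (f≈g β)) (⟨⟩-cong p f≈g)

    ⟨⟩-zeroʳ : ∀ (p : Poly n) → ⟨ p , (λ _ → 0#) ⟩ ≈ 0#
    ⟨⟩-zeroʳ []            = refl
    ⟨⟩-zeroʳ ((c , β) ∷ p) = trans (+-cong (zeroʳ _) (⟨⟩-zeroʳ p)) (+-identityˡ 0#)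

    ⟨⟩-+ʳ : ∀ (p : Poly n) f g → ⟨ p , (λ α → f α + g α) ⟩ ≈ ⟨ p , f ⟩ + ⟨ p , g ⟩
    ⟨⟩-+ʳ []            f g = sym (+-identityˡ 0#)
    ⟨⟩-+ʳ ((c , β) ∷ p) f g = trans (+-congˡ (⟨⟩-+ʳ p f g))
      (solve 5 (λ c a b x y → c :* (a :+ b) :+ (x :+ y) := c :* a :+ x :+ (c :* b :+ y)) refl (φ c) (f β) (g β) _ _)

    ⟨⟩-*ʳ : ∀ (p : Poly n) x f → ⟨ p , (λ α → x * f α) ⟩ ≈ x * ⟨ p , f ⟩
    ⟨⟩-*ʳ []            x f = sym (zeroʳ x)
    ⟨⟩-*ʳ ((c , β) ∷ p) x f = trans (+-congˡ (⟨⟩-*ʳ p x f))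
      (solve 4 (λ c x a y → c :* (x :* a) :+ x :* y := x :* (c :* a :+ y)) refl (φ c) x (f β) _)

    -- Interchange of two finite sums; with commutativity of adding exponents it gives commutativity
    -- of the product.
    ⟨⟩-comm : ∀ (p q : Poly n) (h : Vec ℕ n → Vec ℕ n → Carrier) →
              ⟨ p , (λ α → ⟨ q , h α ⟩) ⟩ ≈ ⟨ q , (λ β → ⟨ p , (λ α → h α β) ⟩) ⟩
    ⟨⟩-comm []            q h = sym (⟨⟩-zeroʳ q)
    ⟨⟩-comm ((c , α) ∷ p) q h =
      trans (+-cong (sym (⟨⟩-*ʳ q (φ c) (h α))) (⟨⟩-comm p q h)) (sym (⟨⟩-+ʳ q _ _))

    ⟨⟩-+ : ∀ (p q : Poly n) f → ⟨ p +ₚ q , f ⟩ ≈ ⟨ p , f ⟩ + ⟨ q , f ⟩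
    ⟨⟩-+ []            q f = sym (+-identityˡ _)
    ⟨⟩-+ ((c , β) ∷ p) q f = trans (+-congˡ (⟨⟩-+ p q f)) (sym (+-assoc _ _ _))

    ⟨⟩-neg : ∀ (p : Poly n) f → ⟨ -ₚ p , f ⟩ ≈ - ⟨ p , f ⟩
    ⟨⟩-neg []            f = solve 0 (con (+ 0) := :- con (+ 0)) refl
    ⟨⟩-neg ((c , β) ∷ p) f = trans (+-cong (*-congʳ (-‿homo c)) (⟨⟩-neg p f))
      (solve 3 (λ c a y → :- c :* a :+ :- y := :- (c :* a :+ y)) refl (φ c) (f β) _)

    private
      ⟨⟩-term-* : ∀ a α (q : Poly n) f →
                  ⟨ List.map (λ (b , β) → a R.* b , Vec.zipWith ℕ._+_ α β) q , f ⟩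
                  ≈ φ a * ⟨ q , (λ β → f (Vec.zipWith ℕ._+_ α β)) ⟩
      ⟨⟩-term-* a α []            f = sym (zeroʳ _)
      ⟨⟩-term-* a α ((b , β) ∷ q) f = trans (+-cong (*-congʳ (*-homo a b)) (⟨⟩-term-* a α q f))
        (solve 4 (λ a b x y → a :* b :* x :+ a :* y := a :* (b :* x :+ y)) refl (φ a) (φ b) _ _)

    ⟨⟩-* : ∀ (p q : Poly n) f →
           ⟨ p *ₚ q , f ⟩ ≈ ⟨ p , (λ α → ⟨ q , (λ β → f (Vec.zipWith ℕ._+_ α β)) ⟩) ⟩
    ⟨⟩-* []            q f = refl
    ⟨⟩-* ((a , α) ∷ p) q f =
      trans (⟨⟩-+ (List.map _ q) _ f) (+-cong (⟨⟩-term-* a α q f) (⟨⟩-* p q f))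

    ⟨⟩-monomial : ∀ c (α : Vec ℕ n) f → ⟨ monomial c α , f ⟩ ≈ φ c * f α
    ⟨⟩-monomial c α f = +-identityʳ _

    remove : Vec ℕ n → Poly n → Poly n
    remove β [] = []
    remove β ((c , γ) ∷ p) with Vec.≡-dec ℕ._≟_ γ β
    ... | yes _ = remove β p
    ... | no  _ = (c , γ) ∷ remove β p

    remove-head : ∀ c β (p : Poly n) → remove β ((c , β) ∷ p) ≡ remove β p
    remove-head c β p with Vec.≡-dec ℕ._≟_ β β
    ... | yes _   = ≡.refl
    ... | no  β≢β = contradiction ≡.refl β≢β

    length-remove : ∀ β (p : Poly n) → List.length (remove β p) ≤ List.length p
    length-remove β [] = ℕ.z≤n
    length-remove β ((c , γ) ∷ p) with Vec.≡-dec ℕ._≟_ γ β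
    ... | yes _ = ℕ.m≤n⇒m≤1+n (length-remove β p)
    ... | no  _ = ℕ.s≤s (length-remove β p)

    coeff-remove : ∀ β α (p : Poly n) → coeff p α R.≈ R.0# → coeff (remove β p) α R.≈ R.0#
    coeff-remove β α p with Vec.≡-dec ℕ._≟_ α β
    ... | yes ≡.refl = λ _ → removed p
      where
      removed : ∀ p → coeff (remove α p) α R.≈ R.0#
      removed [] = R.refl
      removed ((c , γ) ∷ p) with Vec.≡-dec ℕ._≟_ γ α in eq
      ... | yes _ = removed p
      ... | no  _ rewrite eq = removed p
    ... | no α≢β = R.trans (kept p)
      where
      kept : ∀ p → coeff (remove β p) α R.≈ coeff p α
      kept [] = R.refl
      kept ((c , γ) ∷ p) with Vec.≡-dec ℕ._≟_ γ β
      kept ((c , γ) ∷ p) | yes ≡.refl with Vec.≡-dec ℕ._≟_ γ α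
      ... | yes γ≡α = contradiction (≡.sym γ≡α) α≢β
      ... | no  _   = kept p
      kept ((c , γ) ∷ p) | no _ with Vec.≡-dec ℕ._≟_ γ α
      ... | yes _ = R.+-congˡ (kept p)
      ... | no  _ = kept p

    ⟨⟩-remove : ∀ β (p : Poly n) f → ⟨ p , f ⟩ ≈ φ (coeff p β) * f β + ⟨ remove β p , f ⟩
    ⟨⟩-remove β [] f = sym (trans (+-identityʳ _) (trans (*-congʳ 0#-homo) (zeroˡ _)))
    ⟨⟩-remove β ((c , γ) ∷ p) f with Vec.≡-dec ℕ._≟_ γ β
    ... | yes ≡.refl = trans (+-congˡ (⟨⟩-remove γ p f)) (trans
      (solve 4 (λ c x y r → c :* y :+ (x :* y :+ r) := (c :+ x) :* y :+ r) refl (φ c) (φ (coeff p γ)) (f γ) _)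
      (+-congʳ (*-congʳ (sym (+-homo _ _)))))
    ... | no _ = trans (+-congˡ (⟨⟩-remove β p f))
      (solve 3 (λ x y z → x :+ (y :+ z) := y :+ (x :+ z)) refl _ _ _)

    -- All terms sharing the exponent of the head are split off together: their total coefficient is
    -- 0, and deleting them leaves the other coefficients at 0. The remainder is shorter but not a
    -- subterm, hence the bound `k`.
    ⟨⟩-zeroˡ : ∀ k (p : Poly n) f → List.length p ≤ k → p ≈ₚ [] → ⟨ p , f ⟩ ≈ 0#
    ⟨⟩-zeroˡ k       []              f _ p≈0 = refl
    ⟨⟩-zeroˡ (suc k) p@((c , β) ∷ p′) f (ℕ.s≤s p′≤k) p≈0 = begin
      ⟨ p , f ⟩
        ≈⟨ ⟨⟩-remove β p f ⟩
      φ (coeff p β) * f β + ⟨ remove β p , f ⟩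
        ≈⟨ +-cong (trans (*-congʳ (trans (⟦⟧-cong (p≈0 β)) 0#-homo)) (zeroˡ _))
                  (⟨⟩-zeroˡ k (remove β p) f
                    (≡.subst (λ q → List.length q ≤ k) (≡.sym (remove-head c β p′))
                      (ℕ.≤-trans (length-remove β p′) p′≤k))
                    (λ α → coeff-remove β α p (p≈0 α))) ⟩
      0# + 0#
        ≈⟨ +-identityˡ 0# ⟩
      0# ∎

    ⟨⟩-resp-≈ : ∀ (p q : Poly n) f → p ≈ₚ q → ⟨ p , f ⟩ ≈ ⟨ q , f ⟩
    ⟨⟩-resp-≈ p q f p≈q = begin
      ⟨ p , f ⟩                              ≈⟨ solve 2 (λ x y → x := x :+ :- y :+ y) refl _ _ ⟩
      ⟨ p , f ⟩ + - ⟨ q , f ⟩ + ⟨ q , f ⟩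
        ≈⟨ +-congʳ (trans (⟨⟩-+ p (-ₚ q) f) (+-congˡ (⟨⟩-neg q f))) ⟨
      ⟨ p +ₚ -ₚ q , f ⟩ + ⟨ q , f ⟩
        ≈⟨ +-congʳ (⟨⟩-zeroˡ _ (p +ₚ -ₚ q) f ℕ.≤-refl λ α → R.trans (coeff-+ p (-ₚ q) α)
             (R.trans (R.+-cong (p≈q α) (coeff-neg q α)) (R.-‿inverseʳ _))) ⟩
      0# + ⟨ q , f ⟩                         ≈⟨ +-identityˡ _ ⟩
      ⟨ q , f ⟩                              ∎

module PolynomialRing (R : CommutativeRing 0ℓ 0ℓ) where
  open CommutativeRing R hiding (zero)
  open Polynomials rawRing
  open Coefficients R
  open import Relation.Binary.Reasoning.Setoid setoid

  id-isHom : Homomorphisms.IsRingHomomorphism R R id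
  id-isHom = Homomorphisms.mkIsRingHomomorphism R R id
    (λ _ _ → refl) refl (λ _ _ → refl) refl (λ _ → refl)

  -- A record, so that both sides can be inferred from a proof of equality.
  infix 4 _≋_
  record _≋_ {n} (p q : Poly n) : Set where
    field coeff≈ : ∀ α → coeff p α ≈ coeff q α

  open _≋_ public

  private module Id = Pairing {R} {R} id-isHom
  open Id using (⟨_,_⟩)

  module _ {n : ℕ} where
    indicator : Vec ℕ n → Vec ℕ n → Carrier
    indicator α β = if does (Vec.≡-dec ℕ._≟_ β α) then 1# else 0#

    coeff≈⟨⟩ : ∀ (p : Poly n) α → coeff p α ≈ ⟨ p , indicator α ⟩
    coeff≈⟨⟩ [] α = refl
    coeff≈⟨⟩ ((c , β) ∷ p) α with does (Vec.≡-dec ℕ._≟_ β α)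
    ... | true  = +-cong (sym (*-identityʳ c)) (coeff≈⟨⟩ p α)
    ... | false = trans (coeff≈⟨⟩ p α) (sym (trans (+-congʳ (zeroʳ c)) (+-identityˡ _)))

    -- Coefficients are themselves pairings, with indicator functionals.
    ≋-from-⟨⟩ : ∀ (p q : Poly n) → (∀ f → ⟨ p , f ⟩ ≈ ⟨ q , f ⟩) → p ≋ q
    ≋-from-⟨⟩ p q h .coeff≈ α = trans (coeff≈⟨⟩ p α) (trans (h (indicator α)) (sym (coeff≈⟨⟩ q α)))

  polynomialRing : ℕ → CommutativeRing 0ℓ 0ℓ
  polynomialRing n = record
    { Carrier = Poly n ; _≈_ = _≋_ ; _+_ = _+ₚ_ ; _*_ = _*ₚ_ ; -_ = -ₚ_ ; 0# = 0ₚ ; 1# = 1ₚ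
    ; isCommutativeRing = record
      { isRing = record
        { +-isAbelianGroup = record
          { isGroup = record
            { isMonoid = record
              { isSemigroup = record
                { isMagma = record
                  { isEquivalence = record
                    { refl = λ where .coeff≈ α → refl
                    ; sym = λ p≋q → λ where .coeff≈ α → sym (coeff≈ p≋q α)
                    ; trans = ≋-trans }
                  ; ∙-cong = λ {p} {q} {r} {s} p≋q r≋s → ≋-from-⟨⟩ (p +ₚ r) (q +ₚ s) λ f →
                      trans (Id.⟨⟩-+ p r f) (trans
                        (+-cong (Id.⟨⟩-resp-≈ p q f (coeff≈ p≋q)) (Id.⟨⟩-resp-≈ r s f (coeff≈ r≋s))) (sym (Id.⟨⟩-+ q s f)))
                  }
                ; assoc = λ p q r → λ where .coeff≈ α → reflexive (≡.cong (λ t → coeff t α) (List.++-assoc p q r)) }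
              ; identity = (λ p → λ where .coeff≈ α → refl) , λ p → λ where .coeff≈ α → reflexive (≡.cong (λ t → coeff t α) (List.++-identityʳ p)) }
            ; inverse = (λ p → λ where .coeff≈ α → trans (coeff-+ (-ₚ p) p α) (trans (+-congʳ (coeff-neg p α)) (-‿inverseˡ _)))
                      , (λ p → λ where .coeff≈ α → trans (coeff-+ p (-ₚ p) α) (trans (+-congˡ (coeff-neg p α)) (-‿inverseʳ _)))
            ; ⁻¹-cong = λ {p} {q} p≋q → λ where
                .coeff≈ α → trans (coeff-neg p α) (trans (-‿cong (coeff≈ p≋q α)) (sym (coeff-neg q α))) }
          ; comm = λ p q → λ where .coeff≈ α → trans (coeff-+ p q α) (trans (+-comm _ _) (sym (coeff-+ q p α))) }
        ; *-cong = λ {p} {q} {r} {s} p≋q r≋s → ≋-from-⟨⟩ (p *ₚ r) (q *ₚ s) λ f →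
            trans (Id.⟨⟩-* p r f) (trans (Id.⟨⟩-resp-≈ p q _ (coeff≈ p≋q))
              (trans (Id.⟨⟩-cong q λ α → Id.⟨⟩-resp-≈ r s _ (coeff≈ r≋s)) (sym (Id.⟨⟩-* q s f))))
        ; *-assoc = λ p q r → ≋-from-⟨⟩ ((p *ₚ q) *ₚ r) (p *ₚ (q *ₚ r)) λ f → begin
            ⟨ (p *ₚ q) *ₚ r , f ⟩
              ≈⟨ trans (Id.⟨⟩-* (p *ₚ q) r f) (Id.⟨⟩-* p q _) ⟩
            ⟨ p , (λ α → ⟨ q , (λ β → ⟨ r , (λ γ → f (Vec.zipWith ℕ._+_ (Vec.zipWith ℕ._+_ α β) γ)) ⟩) ⟩) ⟩
              ≈⟨ Id.⟨⟩-cong p (λ α → Id.⟨⟩-cong q λ β → Id.⟨⟩-cong r λ γ →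
                   reflexive (≡.cong f (Vec.zipWith-assoc ℕ.+-assoc α β γ))) ⟩
            ⟨ p , (λ α → ⟨ q , (λ β → ⟨ r , (λ γ → f (Vec.zipWith ℕ._+_ α (Vec.zipWith ℕ._+_ β γ))) ⟩) ⟩) ⟩
              ≈⟨ trans (Id.⟨⟩-* p (q *ₚ r) f) (Id.⟨⟩-cong p λ α → Id.⟨⟩-* q r _) ⟨
            ⟨ p *ₚ (q *ₚ r) , f ⟩ ∎
        ; *-identity = *ₚ-identityˡ , λ p → ≋-trans (*ₚ-comm p 1ₚ) (*ₚ-identityˡ p)
        ; distrib = (λ p q r → ≋-trans (*ₚ-comm p (q +ₚ r))
                       (≋-from-⟨⟩ ((q +ₚ r) *ₚ p) ((p *ₚ q) +ₚ (p *ₚ r)) λ f → begin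
                         ⟨ (q +ₚ r) *ₚ p , f ⟩
                           ≈⟨ Id.⟨⟩-resp-≈ ((q +ₚ r) *ₚ p) ((q *ₚ p) +ₚ (r *ₚ p)) f (coeff≈ (*ₚ-distribʳ p q r)) ⟩
                         ⟨ (q *ₚ p) +ₚ (r *ₚ p) , f ⟩
                           ≈⟨ Id.⟨⟩-+ (q *ₚ p) (r *ₚ p) f ⟩
                         ⟨ q *ₚ p , f ⟩ + ⟨ r *ₚ p , f ⟩
                           ≈⟨ +-cong (Id.⟨⟩-resp-≈ (q *ₚ p) (p *ₚ q) f (coeff≈ (*ₚ-comm q p)))
                                     (Id.⟨⟩-resp-≈ (r *ₚ p) (p *ₚ r) f (coeff≈ (*ₚ-comm r p))) ⟩
                         ⟨ p *ₚ q , f ⟩ + ⟨ p *ₚ r , f ⟩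
                           ≈⟨ Id.⟨⟩-+ (p *ₚ q) (p *ₚ r) f ⟨
                         ⟨ (p *ₚ q) +ₚ (p *ₚ r) , f ⟩ ∎))
                  , *ₚ-distribʳ }
      ; *-comm = *ₚ-comm } }
    where
    open RawRing (polyRing n) using ()
      renaming (_+_ to _+ₚ_; _*_ to _*ₚ_; -_ to -ₚ_; 0# to 0ₚ; 1# to 1ₚ)

    ≋-trans : ∀ {p q r : Poly n} → p ≋ q → q ≋ r → p ≋ r
    ≋-trans p≋q q≋r .coeff≈ α = trans (coeff≈ p≋q α) (coeff≈ q≋r α)

    *ₚ-comm : ∀ p q → (p *ₚ q) ≋ (q *ₚ p)
    *ₚ-comm p q = ≋-from-⟨⟩ (p *ₚ q) (q *ₚ p) λ f →
      trans (Id.⟨⟩-* p q f) (trans (Id.⟨⟩-comm p q _)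
        (trans (Id.⟨⟩-cong q λ β → Id.⟨⟩-cong p λ α → reflexive (≡.cong f (Vec.zipWith-comm ℕ.+-comm α β)))
          (sym (Id.⟨⟩-* q p f))))

    *ₚ-identityˡ : ∀ p → (1ₚ *ₚ p) ≋ p
    *ₚ-identityˡ p = ≋-from-⟨⟩ (1ₚ *ₚ p) p λ f →
      trans (Id.⟨⟩-* 1ₚ p f) (trans (Id.⟨⟩-monomial 1# _ (λ α → ⟨ p , (λ β → f (Vec.zipWith ℕ._+_ α β)) ⟩)) (trans (*-identityˡ _)
        (Id.⟨⟩-cong p λ α → reflexive (≡.cong f (Vec.zipWith-identityˡ {f = ℕ._+_} {e = 0} (λ _ → ≡.refl) α)))))

    *ₚ-distribʳ : ∀ p q r → ((q +ₚ r) *ₚ p) ≋ ((q *ₚ p) +ₚ (r *ₚ p))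
    *ₚ-distribʳ p q r = ≋-from-⟨⟩ ((q +ₚ r) *ₚ p) ((q *ₚ p) +ₚ (r *ₚ p)) λ f →
      trans (Id.⟨⟩-* (q +ₚ r) p f) (trans (Id.⟨⟩-+ q r _)
        (trans (sym (+-cong (Id.⟨⟩-* q p f) (Id.⟨⟩-* r p f))) (sym (Id.⟨⟩-+ (q *ₚ p) (r *ₚ p) f))))

vectorSum : ∀ {k n} → (Fin k → Vec ℕ n) → Vec ℕ n
vectorSum {zero}  v = Vec.replicate _ 0
vectorSum {suc k} v = Vec.zipWith ℕ._+_ (v zero) (vectorSum (v ∘ suc))

vectorSum-0∷ : ∀ {k n} (v : Fin k → Vec ℕ n) → vectorSum (λ i → 0 ∷ v i) ≡ 0 ∷ vectorSum v
vectorSum-0∷ {zero}  v = ≡.refl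
vectorSum-0∷ {suc k} v = ≡.cong (Vec.zipWith ℕ._+_ (0 ∷ v zero)) (vectorSum-0∷ (v ∘ suc))

-- The left side is the exponent of the product of the variables that α picks from the diagonal
-- matrix.
vectorSum-select : ∀ {n d} (α : Subset n) (e : ∣ α ∣ ≡ d) →
                   vectorSum (λ k → Vec.replicate n 0 Vec.[ select α e k ]≔ 1) ≡ exponent α
vectorSum-select []            ≡.refl = ≡.refl
vectorSum-select {suc n} {suc d} (inside ∷ α) e = ≡.trans
  (≡.cong (Vec.zipWith ℕ._+_ (1 ∷ Vec.replicate n 0))
    (≡.trans (vectorSum-0∷ (λ k → Vec.replicate n 0 Vec.[ select α (ℕ.suc-injective e) k ]≔ 1))
             (≡.cong (0 ∷_) (vectorSum-select α (ℕ.suc-injective e)))))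
  (≡.cong (1 ∷_) (Vec.zipWith-identityˡ {f = ℕ._+_} {e = 0} (λ _ → ≡.refl) (exponent α)))
vectorSum-select {suc n} (outside ∷ α) e = ≡.trans
  (vectorSum-0∷ (λ k → Vec.replicate n 0 Vec.[ select α e k ]≔ 1))
  (≡.cong (0 ∷_) (vectorSum-select α e))

-- Substitution into polynomials

module Evaluation {R S : CommutativeRing 0ℓ 0ℓ}
                  {φ : CommutativeRing.Carrier R → CommutativeRing.Carrier S}
                  (isHom : Homomorphisms.IsRingHomomorphism R S φ) where
  private module R = CommutativeRing R
  open CommutativeRing S hiding (zero)
  open IntegerSolver S
  open Polynomials R.rawRing
  open PolynomialRing R using (polynomialRing)
  open Pairing {R} {S} isHom
  open Homomorphisms.IsRingHomomorphism R S isHom using (⟦⟧-cong; 1#-homo)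
  open import Algebra.Properties.Semiring.Exp semiring using (_^_; ^-homo-*)

  power : ∀ {n} → (Fin n → Carrier) → Vec ℕ n → Carrier
  power y []      = 1#
  power y (k ∷ α) = y zero ^ k * power (y ∘ suc) α

  power-+ : ∀ {n} (y : Fin n → Carrier) α β → power y (Vec.zipWith ℕ._+_ α β) ≈ power y α * power y β
  power-+ y []      []      = sym (*-identityˡ 1#)
  power-+ y (k ∷ α) (l ∷ β) = trans (*-cong (^-homo-* (y zero) k l) (power-+ (y ∘ suc) α β))
    (solve 4 (λ a b c d → a :* b :* (c :* d) := a :* c :* (b :* d)) refl _ _ _ _)

  power-0 : ∀ {n} (y : Fin n → Carrier) → power y (Vec.replicate n 0) ≈ 1#
  power-0 {zero}  y = refl
  power-0 {suc n} y = trans (*-identityˡ _) (power-0 (y ∘ suc))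

  power-unit : ∀ {n} (y : Fin n → Carrier) i → power y (unit i) ≈ y i
  power-unit y zero    = trans (*-congˡ (power-0 (y ∘ suc))) (trans (*-identityʳ _) (*-identityʳ _))
  power-unit y (suc i) = trans (*-identityˡ _) (power-unit (y ∘ suc) i)

  module _ {n : ℕ} (y : Fin n → Carrier) where
    evaluate : Poly n → Carrier
    evaluate p = ⟨ p , power y ⟩

    -- `power y` turns sums of exponents into products, which makes the pairing with it
    -- multiplicative. Coefficients travel along `φ`, so that with `φ = const` linear forms can be
    -- substituted for variables.
    evaluate-isHom : Homomorphisms.IsRingHomomorphism (polynomialRing n) S evaluate
    evaluate-isHom = Homomorphisms.mkIsRingHomomorphism (polynomialRing n) S
      (λ {p} {q} p≋q → ⟨⟩-resp-≈ p q (power y) (PolynomialRing.coeff≈ p≋q))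
      (λ p q → ⟨⟩-+ p q (power y))
      refl
      (λ p q → trans (⟨⟩-* p q (power y)) (trans
        (⟨⟩-cong p λ α → trans (⟨⟩-cong q (power-+ y α)) (trans (⟨⟩-*ʳ q (power y α) (power y)) (*-comm _ _)))
        (trans (⟨⟩-*ʳ p _ (power y)) (*-comm _ _))))
      (trans (⟨⟩-monomial R.1# (Vec.replicate n 0) (power y)) (trans (*-cong 1#-homo (power-0 y)) (*-identityˡ 1#)))
      (λ p → ⟨⟩-neg p (power y))

    evaluate-monomial-unit : ∀ c i → evaluate (monomial c (unit i)) ≈ φ c * y i
    evaluate-monomial-unit c i = trans (⟨⟩-monomial c (unit i) (power y)) (*-congˡ (power-unit y i))

module Restriction (R : CommutativeRing 0ℓ 0ℓ) where
  open CommutativeRing R hiding (zero)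
  open Polynomials rawRing
  open PolynomialRing R
  open Pairing {R} {R} id-isHom

  -- Sets the first variable to 0: exponent vectors lose a leading 0, and correspondingly subsets a
  -- leading `outside`.
  restrict : ∀ {n} → Poly (suc n) → Poly n
  restrict []                      = []
  restrict ((c , zero  ∷ β) ∷ p)   = (c , β) ∷ restrict p
  restrict ((c , suc _ ∷ β) ∷ p)   = restrict p

  module _ {n : ℕ} where
    extend : (Vec ℕ n → Carrier) → Vec ℕ (suc n) → Carrier
    extend f (zero  ∷ β) = f β
    extend f (suc _ ∷ β) = 0#

    -- Extension by zero is adjoint to restriction, which moves the homomorphism laws over to
    -- functionals.
    ⟨restrict⟩ : ∀ p f → ⟨ restrict p , f ⟩ ≈ ⟨ p , extend f ⟩
    ⟨restrict⟩ []                    f = refl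
    ⟨restrict⟩ ((c , zero  ∷ β) ∷ p) f = +-congˡ (⟨restrict⟩ p f)
    ⟨restrict⟩ ((c , suc _ ∷ β) ∷ p) f =
      trans (⟨restrict⟩ p f) (sym (trans (+-congʳ (zeroʳ c)) (+-identityˡ _)))

    coeff-restrict : ∀ (p : Poly (suc n)) β → coeff (restrict p) β ≡ coeff p (0 ∷ β)
    coeff-restrict []                    β = ≡.refl
    coeff-restrict ((c , zero  ∷ γ) ∷ p) β with does (Vec.≡-dec ℕ._≟_ γ β)
    ... | true  = ≡.cong (λ x → c + x) (coeff-restrict p β)
    ... | false = coeff-restrict p β
    coeff-restrict ((c , suc _ ∷ γ) ∷ p) β = coeff-restrict p β

    extend-shift : ∀ (f : Vec ℕ n → Carrier) α β γ →
                   extend f (Vec.zipWith ℕ._+_ (zero ∷ α) (γ ∷ β)) ≡ extend (λ δ → f (Vec.zipWith ℕ._+_ α δ)) (γ ∷ β)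
    extend-shift f α β zero    = ≡.refl
    extend-shift f α β (suc _) = ≡.refl

    restrict-isHom : Homomorphisms.IsRingHomomorphism (polynomialRing (suc n)) (polynomialRing n) restrict
    restrict-isHom = Homomorphisms.mkIsRingHomomorphism (polynomialRing (suc n)) (polynomialRing n)
      (λ {p} {q} p≋q → λ where
        .coeff≈ β → trans (reflexive (coeff-restrict p β))
          (trans (coeff≈ p≋q (0 ∷ β)) (sym (reflexive (coeff-restrict q β)))))
      (λ p q → ≋-from-⟨⟩ (restrict (p P₊.+ q)) (restrict p P.+ restrict q) λ f →
        trans (⟨restrict⟩ (p P₊.+ q) f) (trans (⟨⟩-+ p q (extend f))
          (sym (trans (⟨⟩-+ (restrict p) (restrict q) f) (+-cong (⟨restrict⟩ p f) (⟨restrict⟩ q f))))))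
      (CommutativeRing.refl (polynomialRing n))
      (λ p q → ≋-from-⟨⟩ (restrict (p P₊.* q)) (restrict p P.* restrict q) λ f →
        trans (⟨restrict⟩ (p P₊.* q) f) (trans (⟨⟩-* p q (extend f)) (trans (⟨⟩-cong p (inner q f))
          (sym (trans (⟨⟩-* (restrict p) (restrict q) f) (⟨restrict⟩ p _))))))
      (CommutativeRing.refl (polynomialRing n))
      (λ p → ≋-from-⟨⟩ (restrict (P₊.- p)) (P.- restrict p) λ f →
        trans (⟨restrict⟩ (P₊.- p) f) (trans (⟨⟩-neg p (extend f))
          (sym (trans (⟨⟩-neg (restrict p) f) (-‿cong (⟨restrict⟩ p f))))))
      where
      module P  = CommutativeRing (polynomialRing n)
      module P₊ = CommutativeRing (polynomialRing (suc n))
      inner : ∀ q f α → ⟨ q , (λ β → extend f (Vec.zipWith ℕ._+_ α β)) ⟩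
                        ≈ extend (λ α → ⟨ restrict q , (λ β → f (Vec.zipWith ℕ._+_ α β)) ⟩) α
      inner q f (zero  ∷ α) = trans (⟨⟩-cong q λ { (γ ∷ β) → reflexive (extend-shift f α β γ) }) (sym (⟨restrict⟩ q _))
      inner q f (suc _ ∷ α) = trans (⟨⟩-cong q λ { (γ ∷ β) → refl }) (⟨⟩-zeroʳ q)

-- Linear forms and the polynomial of products of minors

module LinearForms (R : CommutativeRing 0ℓ 0ℓ) (n : ℕ) where
  open CommutativeRing R hiding (zero)
  open IntegerSolver R
  open Polynomials rawRing
  open PolynomialRing R
  open Pairing {R} {R} id-isHom using (⟨⟩-monomial)
  private module P = CommutativeRing (polynomialRing n)
  open FiniteSums (polynomialRing n)
  open Matrices rawRing using (Matrix)
  private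
    module D = Determinants R
    module PD = Determinants (polynomialRing n)
    open DeterminantProducts R using (Det-transpose)
    open DeterminantProducts (polynomialRing n) using (∏; Det-scale-rows)

  monomial-cong : ∀ {c d} α → c ≈ d → monomial c α P.≈ monomial d α
  monomial-cong {c} {d} α c≈d = ≋-from-⟨⟩ (monomial c α) (monomial d α) λ f →
    trans (⟨⟩-monomial c α f) (trans (*-congʳ c≈d) (sym (⟨⟩-monomial d α f)))

  monomial-+ : ∀ c d α → monomial (c + d) α P.≈ monomial c α P.+ monomial d α
  monomial-+ c d α = ≋-from-⟨⟩ (monomial (c + d) α) (monomial c α P.+ monomial d α) λ f →
    solve 3 (λ c d x → (c :+ d) :* x :+ con (+ 0) := c :* x :+ (d :* x :+ con (+ 0))) refl c d (f α)

  monomial-0 : ∀ α → monomial 0# α P.≈ P.0#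
  monomial-0 α = ≋-from-⟨⟩ (monomial 0# α) P.0# λ f → trans (+-identityʳ _) (zeroˡ _)

  const : Carrier → Poly n
  const c = monomial c (Vec.replicate n 0)

  const-* : ∀ c d α → const c P.* monomial d α P.≈ monomial (c * d) α
  const-* c d α = P.reflexive (≡.cong (monomial (c * d)) (Vec.zipWith-identityˡ {f = ℕ._+_} {e = 0} (λ _ → ≡.refl) α))

  const-isHom : Homomorphisms.IsRingHomomorphism R (polynomialRing n) const
  const-isHom = Homomorphisms.mkIsRingHomomorphism R (polynomialRing n)
    (monomial-cong _) (λ c d → monomial-+ c d _) (monomial-0 _)
    (λ c d → P.sym (const-* c d _)) P.refl
    (λ c → P.refl)

  linearForm≈∑ : ∀ a → linearForm a P.≈ ∑ λ i → monomial (a i) (unit i)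
  linearForm≈∑ a = P.reflexive (≡.sym (∑≡sum λ i → monomial (a i) (unit i)))

  linearForm-+ : ∀ a b → linearForm (λ i → a i + b i) P.≈ linearForm a P.+ linearForm b
  linearForm-+ a b = P.trans (linearForm≈∑ _) (P.trans (∑-cong λ i → monomial-+ (a i) (b i) (unit i))
    (P.trans ∑-+ (P.sym (P.+-cong (linearForm≈∑ a) (linearForm≈∑ b)))))

  linearForm-* : ∀ c a → linearForm (λ i → c * a i) P.≈ const c P.* linearForm a
  linearForm-* c a = P.trans (linearForm≈∑ _) (P.trans (∑-cong λ i → P.sym (const-* c (a i) (unit i)))
    (P.sym (P.trans (P.*-congˡ {const c} (linearForm≈∑ a)) (*-∑ (const c)))))

  var-linear : ∀ i → ∃[ a ] (var i P.≈ linearForm a)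
  var-linear i = δᵢ , P.sym (P.trans (linearForm≈∑ δᵢ) (P.trans
      (∑-cong λ j → P.trans (P.sym (P.trans (const-* (δᵢ j) 1# (unit j)) (monomial-cong (unit j) (*-identityʳ _))))
                            (P.*-congʳ {var j} (const-δ i j)))
      (PΔ.∑-δ i)))
    where
    module PΔ = DeterminantProducts (polynomialRing n)
    δᵢ = DeterminantProducts.δ R i
    const-δ : ∀ {m} (i j : Fin m) → const (DeterminantProducts.δ R i j) P.≈ PΔ.δ i j
    const-δ zero    zero    = P.refl
    const-δ zero    (suc j) = monomial-0 _
    const-δ (suc i) zero    = monomial-0 _
    const-δ (suc i) (suc j) = const-δ i j

  ∏-var : ∀ {k} (s : Fin k → Fin n) → ∏ (λ i → var (s i)) P.≈ monomial 1# (vectorSum λ i → unit (s i))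
  ∏-var {zero}  s = P.refl
  ∏-var {suc k} s = P.trans (P.*-congˡ {var (s zero)} (∏-var (s ∘ suc))) (monomial-cong _ (*-identityˡ 1#))

  minorPolynomial : ∀ {d} → Matrix d n → Matrix d n → Poly n
  minorPolynomial {d} A B = subsetSum n d λ α e →
    monomial (D.Det (λ i k → A i (select α e k)) * D.Det (λ i k → B i (select α e k))) (exponent α)

  -- Cauchy–Binet for A · X · Bᵀ, where X is the diagonal matrix of variables.
  Det-linearForm : ∀ {d} (A B : Matrix d n) →
                   PD.Det (λ i j → linearForm λ k → A i k * B j k) P.≈ minorPolynomial A B
  Det-linearForm {d} A B = begin
    PD.Det (λ i j → linearForm λ k → A i k * B j k)
      ≈⟨ PD.Det-cong (λ i j → P.trans (linearForm≈∑ _) (∑-cong λ k → entry i j k)) ⟩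
    PD.Det (λ i j → ∑ λ k → const (A i k) P.* (var k P.* const (B j k)))
      ≈⟨ PD.cauchy-binet n d (λ i k → const (A i k)) (λ k j → var k P.* const (B j k)) ⟩
    subsetSum n d (λ α e → PD.Det (λ i k → const (A i (select α e k)))
                           P.* PD.Det (λ k j → var (select α e k) P.* const (B j (select α e k))))
      -- `vectorSum-select` needs a relevant cardinality proof, which decidability recovers from the
      -- irrelevant one.
      ≈⟨ subsetSum-cong n d (λ α e → term α e (recompute (∣ α ∣ ℕ.≟ d) e)) ⟩
    minorPolynomial A B ∎
    where
    open import Relation.Binary.Reasoning.Setoid P.setoid
    open Homomorphisms.Preservation R (polynomialRing n) const-isHom using (Det-homo)
    entry : ∀ i j k → monomial (A i k * B j k) (unit k) P.≈ const (A i k) P.* (var k P.* const (B j k))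
    entry i j k = P.sym (P.trans
      (P.*-congˡ {const (A i k)} (P.trans (P.*-comm (var k) (const (B j k))) (const-* (B j k) 1# (unit k))))
      (P.trans (const-* (A i k) (B j k * 1#) (unit k)) (monomial-cong (unit k) (*-congˡ (*-identityʳ _)))))
    term : ∀ α .(e : ∣ α ∣ ≡ d) → ∣ α ∣ ≡ d →
      PD.Det (λ i k → const (A i (select α e k)))
      P.* PD.Det (λ k j → var (select α e k) P.* const (B j (select α e k)))
      P.≈ monomial (D.Det (λ i k → A i (select α e k)) * D.Det (λ i k → B i (select α e k))) (exponent α)
    term α e e′ = begin
      PD.Det (λ i k → const (A i (select α e k)))
        P.* PD.Det (λ k j → var (select α e k) P.* const (B j (select α e k)))
        ≈⟨ P.*-cong (P.sym Det-homo)
             (P.trans (Det-scale-rows (λ k → var (select α e k)) (λ k j → const (B j (select α e k))))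
               (P.*-cong {∏ (λ k → var (select α e k))} (∏-var (select α e))
                 (P.trans (P.sym Det-homo) (monomial-cong _ (Det-transpose λ i k → B i (select α e k)))))) ⟩
      const a P.* (monomial 1# (vectorSum λ k → unit (select α e k)) P.* const b)
        ≡⟨ ≡.cong (λ v → const a P.* (monomial 1# v P.* const b)) (vectorSum-select α e′) ⟩
      const a P.* (monomial 1# (exponent α) P.* const b)
        ≈⟨ P.*-congˡ {const a} (P.trans (P.*-comm (monomial 1# (exponent α)) (const b)) (const-* b 1# (exponent α))) ⟩
      const a P.* monomial (b * 1#) (exponent α)
        ≈⟨ P.trans (const-* a (b * 1#) (exponent α)) (monomial-cong _ (*-congˡ (*-identityʳ b))) ⟩
      monomial (a * b) (exponent α) ∎
      where
      a = D.Det λ i k → A i (select α e k)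
      b = D.Det λ i k → B i (select α e k)

-- Real and complex numbers

module RealRoots (em : ExcludedMiddle 0ℓ) (ℝ : CompleteOrderedField) where
  open CompleteOrderedField ℝ hiding (zero) renaming (_≤_ to infix 4 _≤ᴿ_)
  open IntegerSolver commutativeRing
  open import Relation.Binary.Reasoning.Setoid setoid
  private module ≤ᴿ = IsTotalOrder isTotalOrder

  ≤-by : ∀ {x y} z → 0# ≤ᴿ z → y ≈ x + z → x ≤ᴿ y
  ≤-by {x} {y} z 0≤z y≈x+z = ≤ᴿ.trans (≤ᴿ.reflexive (sym (+-identityˡ x)))
    (≤ᴿ.trans (+-monoˡ-≤ x 0≤z) (≤ᴿ.reflexive (trans (+-comm z x) (sym y≈x+z))))

  difference-nonneg : ∀ {x y} → x ≤ᴿ y → 0# ≤ᴿ y - x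
  difference-nonneg {x} {y} x≤y = ≤ᴿ.trans (≤ᴿ.reflexive (sym (-‿inverseʳ x))) (+-monoˡ-≤ (- x) x≤y)

  nonneg-resp : ∀ {x y} → x ≈ y → 0# ≤ᴿ x → 0# ≤ᴿ y
  nonneg-resp x≈y 0≤x = ≤ᴿ.trans 0≤x (≤ᴿ.reflexive x≈y)

  +-nonneg : ∀ {x y} → 0# ≤ᴿ x → 0# ≤ᴿ y → 0# ≤ᴿ x + y
  +-nonneg {x} {y} 0≤x 0≤y = ≤ᴿ.trans 0≤x (≤-by y 0≤y refl)

  square-nonneg : ∀ x → 0# ≤ᴿ x * x
  square-nonneg x with ≤ᴿ.total 0# x
  ... | inj₁ 0≤x = *-nonneg 0≤x 0≤x
  ... | inj₂ x≤0 = nonneg-resp (solve 1 (λ x → (con (+ 0) :- x) :* (con (+ 0) :- x) := x :* x) refl x)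
                     (*-nonneg (difference-nonneg x≤0) (difference-nonneg x≤0))

  0≤1 : 0# ≤ᴿ 1#
  0≤1 = nonneg-resp (*-identityˡ 1#) (square-nonneg 1#)

  nonneg-sum-zero : ∀ {x y} → 0# ≤ᴿ x → 0# ≤ᴿ y → x + y ≈ 0# → y ≈ 0#
  nonneg-sum-zero {x} {y} 0≤x 0≤y x+y≈0 =
    ≤ᴿ.antisym (≤ᴿ.trans (≤-by x 0≤x (+-comm x y)) (≤ᴿ.reflexive x+y≈0)) 0≤y

  fromNat-nonneg : ∀ n → 0# ≤ᴿ fromNat n
  fromNat-nonneg zero    = ≤ᴿ.refl
  fromNat-nonneg (suc n) = nonneg-resp (sym (fromNat-suc n)) (+-nonneg 0≤1 (fromNat-nonneg n))

  -- Characteristic 0 follows from the order: a vanishing sum of the nonnegative numbers `fromNat n`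
  -- and 1 would force 1 to vanish.
  fromNat-suc≉0 : ∀ n → ¬ (fromNat (suc n) ≈ 0#)
  fromNat-suc≉0 n h = 0≉1 (sym (nonneg-sum-zero (fromNat-nonneg n) 0≤1
    (trans (+-comm _ _) (trans (sym (fromNat-suc n)) h))))

  fromNat-injective : ∀ m n → fromNat m ≈ fromNat n → m ≡ n
  fromNat-injective zero    zero    h = ≡.refl
  fromNat-injective zero    (suc n) h = contradiction (sym h) (fromNat-suc≉0 n)
  fromNat-injective (suc m) zero    h = contradiction h (fromNat-suc≉0 m)
  fromNat-injective (suc m) (suc n) h = ≡.cong suc (fromNat-injective m n (begin
    fromNat m               ≈⟨ solve 1 (λ x → x := con (+ 1) :+ x :- con (+ 1)) refl _ ⟩
    1# + fromNat m - 1#     ≈⟨ +-congʳ (trans (sym (fromNat-suc m)) (trans h (fromNat-suc n))) ⟩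
    1# + fromNat n - 1#     ≈⟨ solve 1 (λ x → con (+ 1) :+ x :- con (+ 1) := x) refl _ ⟩
    fromNat n               ∎))

  *-nonzero : ∀ {x y} → ¬ (x ≈ 0#) → ¬ (y ≈ 0#) → ¬ (x * y ≈ 0#)
  *-nonzero {x} {y} x≉0 y≉0 xy≈0 with *-inverse x x≉0
  ... | i , xi≈1 = y≉0 (begin
    y            ≈⟨ *-identityˡ y ⟨
    1# * y       ≈⟨ *-congʳ xi≈1 ⟨
    x * i * y    ≈⟨ solve 3 (λ x i y → x :* i :* y := i :* (x :* y)) refl x i y ⟩
    i * (x * y)  ≈⟨ *-congˡ xy≈0 ⟩
    i * 0#       ≈⟨ zeroʳ i ⟩
    0#           ∎)

  square-zero : ∀ {x} → x * x ≈ 0# → x ≈ 0#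
  square-zero {x} xx≈0 with em {x ≈ 0#}
  ... | yes x≈0 = x≈0
  ... | no  x≉0 = contradiction xx≈0 (*-nonzero x≉0 x≉0)

  half : Carrier
  half = proj₁ (*-inverse (1# + 1#) (fromNat-suc≉0 1))

  half+half : half + half ≈ 1#
  half+half = trans (solve 1 (λ h → h :+ h := (con (+ 1) :+ con (+ 1)) :* h) refl half)
    (proj₂ (*-inverse (1# + 1#) (fromNat-suc≉0 1)))

  inverse-nonneg : ∀ {x y} → 0# ≤ᴿ x → x * y ≈ 1# → 0# ≤ᴿ y
  inverse-nonneg {x} {y} 0≤x xy≈1 = nonneg-resp
    (trans (sym (*-assoc x y y)) (trans (*-congʳ xy≈1) (*-identityˡ y)))
    (*-nonneg 0≤x (square-nonneg y))

  half-nonneg : 0# ≤ᴿ half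
  half-nonneg = inverse-nonneg (fromNat-nonneg 2) (proj₂ (*-inverse (1# + 1#) (fromNat-suc≉0 1)))

  -- If u ≤ x, then u² - x², 2u(x - u) and (x - u)² are all nonnegative and add up to 0, so x = u.
  square-cancel-≤ : ∀ {x u} → 0# ≤ᴿ u → x * x ≤ᴿ u * u → x ≤ᴿ u
  square-cancel-≤ {x} {u} 0≤u xx≤uu with ≤ᴿ.total x u
  ... | inj₁ x≤u = x≤u
  ... | inj₂ u≤x = ≤ᴿ.reflexive (begin
    x          ≈⟨ solve 2 (λ x u → x := x :- u :+ u) refl x u ⟩
    x - u + u  ≈⟨ +-congʳ x-u≈0 ⟩
    0# + u     ≈⟨ +-identityˡ u ⟩
    u          ∎)
    where
    0≤x-u = difference-nonneg u≤x
    x-u≈0 : x - u ≈ 0#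
    x-u≈0 = square-zero (nonneg-sum-zero
      (+-nonneg (difference-nonneg xx≤uu) (+-nonneg (*-nonneg 0≤u 0≤x-u) (*-nonneg 0≤u 0≤x-u)))
      (square-nonneg (x - u))
      (solve 2 (λ x u → u :* u :- x :* x :+ (u :* (x :- u) :+ u :* (x :- u)) :+ (x :- u) :* (x :- u) := con (+ 0)) refl x u))

  module SquareRoot (c : Carrier) (0≤c : 0# ≤ᴿ c) (c≉0 : ¬ (c ≈ 0#)) where
    S : Pred Carrier 0ℓ
    S x = x * x ≤ᴿ c

    -- From x ≤ (x² + 1)/2 ≤ (c + 1)/2.
    bounded : UpperBound S (half * (c + 1#))
    bounded x xx≤c = ≤-by (half * ((x - 1#) * (x - 1#) + (c - x * x)))
      (*-nonneg half-nonneg (+-nonneg (square-nonneg _) (difference-nonneg xx≤c)))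
      (begin
        half * (c + 1#)
          ≈⟨ solve 3 (λ h c x → h :* (c :+ con (+ 1))
               := (h :+ h) :* x :+ h :* ((x :- con (+ 1)) :* (x :- con (+ 1)) :+ (c :- x :* x))) refl half c x ⟩
        (half + half) * x + _
          ≈⟨ +-congʳ (trans (*-congʳ half+half) (*-identityˡ x)) ⟩
        x + half * ((x - 1#) * (x - 1#) + (c - x * x)) ∎)

    sup = supremum S (0# , ≤ᴿ.trans (≤ᴿ.reflexive (zeroˡ 0#)) 0≤c) (_ , bounded)

    s : Carrier
    s = proj₁ sup

    s-upper : UpperBound S s
    s-upper = proj₁ (proj₂ sup)

    s-least : ∀ b → UpperBound S b → s ≤ᴿ b
    s-least = proj₂ (proj₂ sup)

    0≤s : 0# ≤ᴿ s
    0≤s = s-upper 0# (≤ᴿ.trans (≤ᴿ.reflexive (zeroˡ 0#)) 0≤c)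

    -- The witness is c/(1 + c): its square is at most c since c ≤ (1 + c)², and if the supremum
    -- were 0 it would vanish, and c with it.
    s≉0 : ¬ (s ≈ 0#)
    s≉0 s≈0 = c≉0 (begin
      c                    ≈⟨ *-identityʳ c ⟨
      c * 1#               ≈⟨ *-congˡ (proj₂ 1+c⁻¹) ⟨
      c * ((1# + c) * i)   ≈⟨ solve 2 (λ c i → c :* ((con (+ 1) :+ c) :* i) := (c :* i) :* (con (+ 1) :+ c)) refl c i ⟩
      (c * i) * (1# + c)   ≈⟨ *-congʳ ci≈0 ⟩
      0# * (1# + c)        ≈⟨ zeroˡ _ ⟩
      0#                   ∎)
      where
      0≤1+c = +-nonneg 0≤1 0≤c
      1+c⁻¹ = *-inverse (1# + c) λ h → 0≉1 (sym (nonneg-sum-zero 0≤c 0≤1 (trans (+-comm c 1#) h)))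
      i = proj₁ 1+c⁻¹
      0≤i = inverse-nonneg 0≤1+c (proj₂ 1+c⁻¹)
      ci∈S : S (c * i)
      ci∈S = ≤-by (c * (i * i) * (1# + c + c * c))
        (*-nonneg (*-nonneg 0≤c (square-nonneg i)) (+-nonneg 0≤1+c (square-nonneg c)))
        (begin
          c
            ≈⟨ solve 1 (λ c → c := c :* (con (+ 1) :* con (+ 1))) refl c ⟩
          c * (1# * 1#)
            ≈⟨ *-congˡ (*-cong (proj₂ 1+c⁻¹) (proj₂ 1+c⁻¹)) ⟨
          c * (((1# + c) * i) * ((1# + c) * i))
            ≈⟨ solve 2 (λ c i → c :* (((con (+ 1) :+ c) :* i) :* ((con (+ 1) :+ c) :* i))
                 := c :* i :* (c :* i) :+ c :* (i :* i) :* (con (+ 1) :+ c :+ c :* c)) refl c i ⟩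
          c * i * (c * i) + c * (i * i) * (1# + c + c * c) ∎)
      ci≈0 : c * i ≈ 0#
      ci≈0 = ≤ᴿ.antisym (≤ᴿ.trans (s-upper (c * i) ci∈S) (≤ᴿ.reflexive s≈0)) (*-nonneg 0≤c 0≤i)

    s⁻¹ = *-inverse s s≉0
    c/s = c * proj₁ s⁻¹

    s*c/s : s * c/s ≈ c
    s*c/s = trans (solve 3 (λ s c i → s :* (c :* i) := c :* (s :* i)) refl s c (proj₁ s⁻¹))
      (trans (*-congˡ (proj₂ s⁻¹)) (*-identityʳ c))

    -- By AM–GM the mean of s and c / s is again an upper bound.
    u : Carrier
    u = half * (s + c/s)

    0≤u : 0# ≤ᴿ u
    0≤u = *-nonneg half-nonneg (+-nonneg 0≤s (*-nonneg 0≤c (inverse-nonneg 0≤s (proj₂ s⁻¹))))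

    u+u : u + u ≈ s + c/s
    u+u = trans (solve 2 (λ h x → h :* x :+ h :* x := (h :+ h) :* x) refl half (s + c/s))
      (trans (*-congʳ half+half) (*-identityˡ _))

    u²≈ : u * u ≈ c + half * half * ((s - c/s) * (s - c/s))
    u²≈ = begin
      u * u
        ≈⟨ solve 3 (λ h s x → h :* (s :+ x) :* (h :* (s :+ x))
             := (h :+ h) :* (h :+ h) :* (s :* x) :+ h :* h :* ((s :- x) :* (s :- x))) refl half s c/s ⟩
      (half + half) * (half + half) * (s * c/s) + half * half * ((s - c/s) * (s - c/s))
        ≈⟨ +-congʳ (trans (*-cong (trans (*-cong half+half half+half) (*-identityˡ 1#)) s*c/s) (*-identityˡ c)) ⟩
      c + half * half * ((s - c/s) * (s - c/s)) ∎

    c≤u² : c ≤ᴿ u * u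
    c≤u² = ≤-by _ (*-nonneg (square-nonneg half) (square-nonneg _)) u²≈

    -- Minimality of s gives s ≤ u, hence 2s ≤ s + c/s; multiply by s and cancel.
    s²≤c : s * s ≤ᴿ c
    s²≤c = ≤-by (s * ((u - s) + (u - s))) (*-nonneg 0≤s (+-nonneg 0≤u-s 0≤u-s)) (begin
      c                                        ≈⟨ s*c/s ⟨
      s * c/s                                  ≈⟨ solve 2 (λ s x → s :* x := s :* s :+ s :* (s :+ x :- (s :+ s))) refl s c/s ⟩
      s * s + s * (s + c/s - (s + s))          ≈⟨ +-congˡ (*-congˡ (+-congʳ u+u)) ⟨
      s * s + s * (u + u - (s + s))            ≈⟨ solve 2 (λ s u → s :* s :+ s :* (u :+ u :- (s :+ s)) := s :* s :+ s :* ((u :- s) :+ (u :- s))) refl s u ⟩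
      s * s + s * ((u - s) + (u - s))          ∎)
      where
      0≤u-s = difference-nonneg (s-least u λ x xx≤c → square-cancel-≤ 0≤u (≤ᴿ.trans xx≤c c≤u²))

    u⁻¹ = *-inverse u λ u≈0 → c≉0 (≤ᴿ.antisym
      (≤ᴿ.trans c≤u² (≤ᴿ.reflexive (trans (*-congʳ u≈0) (zeroˡ u)))) 0≤c)
    w = proj₁ u⁻¹

    c/u∈S : S (c * w)
    c/u∈S = ≤-by (c * (w * w) * (u * u - c))
      (*-nonneg (*-nonneg 0≤c (square-nonneg w)) (difference-nonneg c≤u²))
      (begin
        c
          ≈⟨ solve 1 (λ c → c := c :* (con (+ 1) :* con (+ 1))) refl c ⟩
        c * (1# * 1#)
          ≈⟨ *-congˡ (*-cong (proj₂ u⁻¹) (proj₂ u⁻¹)) ⟨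
        c * ((u * w) * (u * w))
          ≈⟨ solve 3 (λ c u w → c :* ((u :* w) :* (u :* w)) := c :* w :* (c :* w) :+ c :* (w :* w) :* (u :* u :- c)) refl c u w ⟩
        c * w * (c * w) + c * (w * w) * (u * u - c) ∎)

    -- Since c/u lies in `S`, c ≤ us; doubling gives 2c ≤ (s + c/s)s = s² + c.
    c≤s² : c ≤ᴿ s * s
    c≤s² = ≤-by (u * (s - c * w) + u * (s - c * w)) (+-nonneg 0≤z 0≤z) (begin
      s * s
        ≈⟨ solve 2 (λ s x → s :* s := s :* x :+ ((s :+ x) :* s :- (s :* x :+ s :* x))) refl s c/s ⟩
      s * c/s + ((s + c/s) * s - (s * c/s + s * c/s))
        ≈⟨ +-cong s*c/s (+-cong (*-congʳ (sym u+u)) (-‿cong (+-cong c≈cuw c≈cuw))) ⟩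
      c + ((u + u) * s - (c * (u * w) + c * (u * w)))
        ≈⟨ solve 4 (λ c u s w → c :+ ((u :+ u) :* s :- (c :* (u :* w) :+ c :* (u :* w)))
             := c :+ (u :* (s :- c :* w) :+ u :* (s :- c :* w))) refl c u s w ⟩
      c + (u * (s - c * w) + u * (s - c * w)) ∎)
      where
      0≤z = *-nonneg 0≤u (difference-nonneg (s-upper (c * w) c/u∈S))
      c≈cuw : s * c/s ≈ c * (u * w)
      c≈cuw = trans s*c/s (sym (trans (*-congˡ (proj₂ u⁻¹)) (*-identityʳ c)))

    s²≈c : s * s ≈ c
    s²≈c = ≤ᴿ.antisym s²≤c c≤s²

  inverse-square-root : ∀ c → 0# ≤ᴿ c → ¬ (c ≈ 0#) → ∃[ t ] (t * t * c ≈ 1#)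
  inverse-square-root c 0≤c c≉0 = t , (begin
    t * t * c          ≈⟨ *-congˡ s²≈c ⟨
    t * t * (s * s)    ≈⟨ solve 2 (λ t s → t :* t :* (s :* s) := s :* t :* (s :* t)) refl t s ⟩
    s * t * (s * t)    ≈⟨ *-cong (proj₂ s⁻¹) (proj₂ s⁻¹) ⟩
    1# * 1#            ≈⟨ *-identityˡ 1# ⟩
    1#                 ∎)
    where
    open SquareRoot c 0≤c c≉0
    t = proj₁ s⁻¹

module ComplexNumbers (em : ExcludedMiddle 0ℓ) (ℝ : CompleteOrderedField) where
  private module ℝ = CompleteOrderedField ℝ
  open RealRoots em ℝ
  open IntegerSolver ℝ.commutativeRing

  complexField : CommutativeRing 0ℓ 0ℓ
  complexField = record
    { Carrier = Carrier ; _≈_ = _≈_ ; _+_ = _+_ ; _*_ = _*_ ; -_ = -_ ; 0# = 0# ; 1# = 1#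
    ; isCommutativeRing = record
      { isRing = record
        { +-isAbelianGroup = record
          { isGroup = record
            { isMonoid = record
              { isSemigroup = record
                { isMagma = record
                  { isEquivalence = record
                    { refl = ℝ.refl , ℝ.refl
                    ; sym = λ (p , q) → ℝ.sym p , ℝ.sym q
                    ; trans = λ (p , q) (r , s) → ℝ.trans p r , ℝ.trans q s }
                  ; ∙-cong = λ (p , q) (r , s) → ℝ.+-cong p r , ℝ.+-cong q s }
                ; assoc = λ _ _ _ → ℝ.+-assoc _ _ _ , ℝ.+-assoc _ _ _ }
              ; identity = (λ _ → ℝ.+-identityˡ _ , ℝ.+-identityˡ _) , (λ _ → ℝ.+-identityʳ _ , ℝ.+-identityʳ _) }
            ; inverse = (λ _ → ℝ.-‿inverseˡ _ , ℝ.-‿inverseˡ _) , (λ _ → ℝ.-‿inverseʳ _ , ℝ.-‿inverseʳ _)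
            ; ⁻¹-cong = λ (p , q) → ℝ.-‿cong p , ℝ.-‿cong q }
          ; comm = λ _ _ → ℝ.+-comm _ _ , ℝ.+-comm _ _ }
        ; *-cong = λ (p , q) (r , s) →
            ℝ.+-cong (ℝ.*-cong p r) (ℝ.-‿cong (ℝ.*-cong q s)) , ℝ.+-cong (ℝ.*-cong p s) (ℝ.*-cong q r)
        ; *-assoc = λ (a , b) (c , d) (e , f) →
            solve 6 (λ a b c d e f → (a :* c :- b :* d) :* e :- (a :* d :+ b :* c) :* f
                                     := a :* (c :* e :- d :* f) :- b :* (c :* f :+ d :* e)) ℝ.refl a b c d e f
          , solve 6 (λ a b c d e f → (a :* c :- b :* d) :* f :+ (a :* d :+ b :* c) :* e
                                     := a :* (c :* f :+ d :* e) :+ b :* (c :* e :- d :* f)) ℝ.refl a b c d e f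
        ; *-identity =
            (λ (a , b) → solve 2 (λ a b → con (+ 1) :* a :- con (+ 0) :* b := a) ℝ.refl a b
                       , solve 2 (λ a b → con (+ 1) :* b :+ con (+ 0) :* a := b) ℝ.refl a b)
          , (λ (a , b) → solve 2 (λ a b → a :* con (+ 1) :- b :* con (+ 0) := a) ℝ.refl a b
                       , solve 2 (λ a b → a :* con (+ 0) :+ b :* con (+ 1) := b) ℝ.refl a b)
        ; distrib =
            (λ (a , b) (c , d) (e , f) →
                solve 6 (λ a b c d e f → a :* (c :+ e) :- b :* (d :+ f)
                          := a :* c :- b :* d :+ (a :* e :- b :* f)) ℝ.refl a b c d e f
              , solve 6 (λ a b c d e f → a :* (d :+ f) :+ b :* (c :+ e)
                          := a :* d :+ b :* c :+ (a :* f :+ b :* e)) ℝ.refl a b c d e f)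
          , (λ (a , b) (c , d) (e , f) →
                solve 6 (λ a b c d e f → (c :+ e) :* a :- (d :+ f) :* b
                          := c :* a :- d :* b :+ (e :* a :- f :* b)) ℝ.refl a b c d e f
              , solve 6 (λ a b c d e f → (c :+ e) :* b :+ (d :+ f) :* a
                          := c :* b :+ d :* a :+ (e :* b :+ f :* a)) ℝ.refl a b c d e f) }
      ; *-comm = λ (a , b) (c , d) →
            solve 4 (λ a b c d → a :* c :- b :* d := c :* a :- d :* b) ℝ.refl a b c d
          , solve 4 (λ a b c d → a :* d :+ b :* c := c :* b :+ d :* a) ℝ.refl a b c d } }
    where open RawRing (WaringRank.ℂ ℝ)

  open CommutativeRing complexField hiding (zero)

  embed : ℝ.Carrier → Carrier
  embed x = x , ℝ.0#

  embed-isHom : Homomorphisms.IsRingHomomorphism ℝ.commutativeRing complexField embed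
  embed-isHom = Homomorphisms.mkIsRingHomomorphism ℝ.commutativeRing complexField
    (λ x≈y → x≈y , ℝ.refl)
    (λ x y → ℝ.refl , ℝ.sym (ℝ.+-identityˡ _))
    (ℝ.refl , ℝ.refl)
    (λ x y → solve 2 (λ x y → x :* y := x :* y :- con (+ 0) :* con (+ 0)) ℝ.refl x y
           , solve 2 (λ x y → con (+ 0) := x :* con (+ 0) :+ con (+ 0) :* y) ℝ.refl x y)
    (ℝ.refl , ℝ.refl)
    (λ x → ℝ.refl , solve 0 (con (+ 0) := :- con (+ 0)) ℝ.refl)

  UnitModulus : Carrier → Set
  UnitModulus (a , b) = a ℝ.* a ℝ.+ b ℝ.* b ℝ.≈ ℝ.1#

  -- For η ≠ −1 on the unit circle, a square root is (1 + η) / |1 + η|, and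
  -- |1 + η|² = 2 + 2 Re η.
  unit-square-root : ∀ η → UnitModulus η → ∃[ ω ] (ω * ω ≈ η × UnitModulus ω)
  unit-square-root (a , b) aa+bb≈1 with em {u ℝ.≈ ℝ.0#}
    where
    u = (ℝ.1# ℝ.+ a) ℝ.+ (ℝ.1# ℝ.+ a)
  -- `u` equals |1 + η|², so here η = -1, with square root i.
  ... | yes u≈0 = (ℝ.0# , ℝ.1#)
      , ( ℝ.trans (solve 1 (λ a → con (+ 0) :* con (+ 0) :- con (+ 1) :* con (+ 1) := a :- (con (+ 1) :+ a)) ℝ.refl a)
            (ℝ.trans (ℝ.+-congˡ (ℝ.-‿cong 1+a≈0)) (solve 1 (λ a → a :- con (+ 0) := a) ℝ.refl a))
        , ℝ.trans (solve 0 (con (+ 0) :* con (+ 1) :+ con (+ 1) :* con (+ 0) := con (+ 0)) ℝ.refl) (ℝ.sym b≈0))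
      , solve 0 (con (+ 0) :* con (+ 0) :+ con (+ 1) :* con (+ 1) := con (+ 1)) ℝ.refl
    where
    1+a≈0 : ℝ.1# ℝ.+ a ℝ.≈ ℝ.0#
    1+a≈0 = ℝ.trans (ℝ.sym (ℝ.trans (ℝ.*-congʳ half+half) (ℝ.*-identityˡ _)))
      (ℝ.trans (solve 2 (λ h x → (h :+ h) :* x := h :* (x :+ x)) ℝ.refl half (ℝ.1# ℝ.+ a))
        (ℝ.trans (ℝ.*-congˡ u≈0) (ℝ.zeroʳ half)))
    b≈0 : b ℝ.≈ ℝ.0#
    b≈0 = square-zero (ℝ.trans
      (solve 2 (λ a b → b :* b := (a :* a :+ b :* b) :- con (+ 1) :- (con (+ 1) :+ a) :* (a :- con (+ 1))) ℝ.refl a b)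
      (ℝ.trans (ℝ.+-cong (ℝ.+-congʳ aa+bb≈1) (ℝ.-‿cong (ℝ.*-congʳ 1+a≈0)))
        (solve 1 (λ a → con (+ 1) :- con (+ 1) :- con (+ 0) :* (a :- con (+ 1)) := con (+ 0)) ℝ.refl a)))
  ... | no u≉0 = (t ℝ.* (ℝ.1# ℝ.+ a) , t ℝ.* b)
      , ( ℝ.trans (solve 3 (λ t a b → t :* (con (+ 1) :+ a) :* (t :* (con (+ 1) :+ a)) :- t :* b :* (t :* b)
                     := t :* t :* ((con (+ 1) :+ a) :+ (con (+ 1) :+ a)) :* a
                        :- t :* t :* ((a :* a :+ b :* b) :- con (+ 1))) ℝ.refl t a b)
            (ℝ.trans (ℝ.+-cong (ℝ.*-congʳ ttu≈1) (ℝ.-‿cong (ℝ.*-congˡ (ℝ.+-congʳ aa+bb≈1))))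
              (solve 2 (λ t a → con (+ 1) :* a :- t :* t :* (con (+ 1) :- con (+ 1)) := a) ℝ.refl t a))
        , ℝ.trans (solve 3 (λ t a b → t :* (con (+ 1) :+ a) :* (t :* b) :+ t :* b :* (t :* (con (+ 1) :+ a))
                     := t :* t :* ((con (+ 1) :+ a) :+ (con (+ 1) :+ a)) :* b) ℝ.refl t a b)
            (ℝ.trans (ℝ.*-congʳ ttu≈1) (ℝ.*-identityˡ b)))
      , ℝ.trans (ℝ.trans
          (solve 3 (λ t a b → t :* (con (+ 1) :+ a) :* (t :* (con (+ 1) :+ a)) :+ t :* b :* (t :* b)
                     := t :* t :* ((con (+ 1) :+ a) :+ (con (+ 1) :+ a))
                        :+ t :* t :* ((a :* a :+ b :* b) :- con (+ 1))) ℝ.refl t a b)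
          (ℝ.+-cong ttu≈1 (ℝ.*-congˡ (ℝ.+-congʳ aa+bb≈1))))
          (solve 1 (λ t → con (+ 1) :+ t :* t :* (con (+ 1) :- con (+ 1)) := con (+ 1)) ℝ.refl t)
    where
    u = (ℝ.1# ℝ.+ a) ℝ.+ (ℝ.1# ℝ.+ a)
    0≤u : ℝ.0# ℝ.≤ u
    0≤u = nonneg-resp
      (ℝ.trans (solve 2 (λ a b → (con (+ 1) :+ a) :* (con (+ 1) :+ a) :+ b :* b
                  := con (+ 1) :+ a :+ a :+ (a :* a :+ b :* b)) ℝ.refl a b)
        (ℝ.trans (ℝ.+-congˡ aa+bb≈1)
          (solve 1 (λ a → con (+ 1) :+ a :+ a :+ con (+ 1) := (con (+ 1) :+ a) :+ (con (+ 1) :+ a)) ℝ.refl a)))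
      (+-nonneg (square-nonneg (ℝ.1# ℝ.+ a)) (square-nonneg b))
    t = proj₁ (inverse-square-root u 0≤u u≉0)
    ttu≈1 = proj₂ (inverse-square-root u 0≤u u≉0)

  open import Algebra.Properties.CommutativeSemiring.Exp commutativeSemiring using (_^_; ^-homo-*; ^-distrib-*; ^-congˡ)
  private module ℂ = IntegerSolver complexField

  parity : ∀ n → ∃[ m ] (n ≡ m ℕ.+ m ⊎ n ≡ suc (m ℕ.+ m))
  parity zero    = zero , inj₁ ≡.refl
  parity (suc n) with parity n
  ... | m , inj₁ n≡ = m , inj₂ (≡.cong suc n≡)
  ... | m , inj₂ n≡ = suc m , inj₁ (≡.cong suc (≡.trans n≡ (≡.sym (ℕ.+-suc m m))))

  -- For odd d take -1; for d = 2m take a square root of the root for m. Unit modulus is carried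
  -- along because square roots are available there, and `k` bounds the halving.
  root-of-minus-one-acc : ∀ k d → d ≤ k → 1 ≤ d → ∃[ ω ] (ω ^ d ≈ - 1# × UnitModulus ω)
  root-of-minus-one-acc zero    zero d≤k ()
  root-of-minus-one-acc (suc k) d d≤k 1≤d with parity d
  ... | zero  , inj₁ ≡.refl = contradiction 1≤d λ ()
  ... | suc m , inj₁ ≡.refl =
    let η , η^m≈-1 , |η|≈1 = root-of-minus-one-acc k (suc m)
          (ℕ.≤-trans (ℕ.s≤s (ℕ.m≤m+n m m)) (ℕ.≤-trans (ℕ.≤-reflexive (≡.sym (ℕ.+-suc m m))) (ℕ.≤-pred d≤k))) (ℕ.s≤s ℕ.z≤n)
        ω , ωω≈η , |ω|≈1 = unit-square-root η |η|≈1
    in ω , trans (^-homo-* ω (suc m) (suc m)) (trans (sym (^-distrib-* ω ω (suc m)))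
             (trans (^-congˡ (suc m) ωω≈η) η^m≈-1)) , |ω|≈1
  ... | m , inj₂ ≡.refl = - 1#
    , trans (*-congˡ (trans (^-homo-* (- 1#) m m) (trans (sym (^-distrib-* (- 1#) (- 1#) m))
        (trans (^-congˡ m (ℂ.solve 0 (ℂ._:*_ (ℂ.:-_ (ℂ.con (+ 1))) (ℂ.:-_ (ℂ.con (+ 1))) ℂ.:= ℂ.con (+ 1)) refl)) (1^ m)))))
        (*-identityʳ _)
    , solve 0 (:- con (+ 1) :* :- con (+ 1) :+ :- con (+ 0) :* :- con (+ 0) := con (+ 1)) ℝ.refl
    where
    1^ : ∀ m → 1# ^ m ≈ 1#
    1^ zero    = refl
    1^ (suc m) = trans (*-identityˡ _) (1^ m)

  root-of-minus-one : ∀ d → 1 ≤ d → ∃[ ω ] (ω ^ d ≈ - 1#)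
  root-of-minus-one d 1≤d = let ω , ω^d≈-1 , _ = root-of-minus-one-acc d d ℕ.≤-refl 1≤d in ω , ω^d≈-1

-- Sums of products and sums of powers

-- The numbers of terms of `sum²` and `sum³`, that is, C(n,2) and C(n,3).
choose₂ choose₃ : ℕ → ℕ
choose₂ zero    = 0
choose₂ (suc n) = n ℕ.+ choose₂ n
choose₃ zero    = 0
choose₃ (suc n) = choose₂ n ℕ.+ choose₃ n

module Decompositions (P : CommutativeRing 0ℓ 0ℓ) where
  open CommutativeRing P hiding (zero)
  open FiniteSums P

  -- The number of summands is an index, so counting happens in the types. Each constructor stores
  -- an equation, so `Q` may be any predicate, whether or not it respects `≈`.
  data SumOf (Q : Pred Carrier 0ℓ) : ℕ → Carrier → Set where
    empty : ∀ {p} → p ≈ 0# → SumOf Q 0 p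
    add   : ∀ {k p q r} → Q q → SumOf Q k r → p ≈ q + r → SumOf Q (suc k) p

  data ProductOf (L : Pred Carrier 0ℓ) : ℕ → Carrier → Set where
    unit : ∀ {p} → p ≈ 1# → ProductOf L 0 p
    mul  : ∀ {k p a q} → L a → ProductOf L k q → p ≈ a * q → ProductOf L (suc k) p

  module _ {Q : Pred Carrier 0ℓ} where
    SumOf-resp : ∀ {k p q} → p ≈ q → SumOf Q k p → SumOf Q k q
    SumOf-resp p≈q (empty p≈0)   = empty (trans (sym p≈q) p≈0)
    SumOf-resp p≈q (add x xs eq) = add x xs (trans (sym p≈q) eq)

    SumOf-cong : ∀ {k l p} → k ≡ l → SumOf Q k p → SumOf Q l p
    SumOf-cong ≡.refl xs = xs

    SumOf-single : ∀ {p} → Q p → SumOf Q 1 p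
    SumOf-single x = add x (empty refl) (sym (+-identityʳ _))

    SumOf-+ : ∀ {k l p q} → SumOf Q k p → SumOf Q l q → SumOf Q (k ℕ.+ l) (p + q)
    SumOf-+ (empty p≈0)   ys = SumOf-resp (sym (trans (+-congʳ p≈0) (+-identityˡ _))) ys
    SumOf-+ (add x xs eq) ys = add x (SumOf-+ xs ys) (trans (+-congʳ eq) (+-assoc _ _ _))

    SumOf-∑ : ∀ n {m} {f : Fin n → Carrier} → (∀ i → SumOf Q m (f i)) → SumOf Q (n ℕ.* m) (∑ f)
    SumOf-∑ zero    xs = empty ∑-zero
    SumOf-∑ (suc n) xs = SumOf-resp (sym ∑-suc) (SumOf-+ (xs zero) (SumOf-∑ n λ i → xs (suc i)))

    SumOf-sum² : ∀ n {m} {f : Fin n → Fin n → Carrier} →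
                 (∀ i j → i ≢ j → SumOf Q m (f i j)) → SumOf Q (choose₂ n ℕ.* m) (sum² n f)
    SumOf-sum² zero    xs = empty refl
    SumOf-sum² (suc n) {m} xs = SumOf-cong (≡.sym (ℕ.*-distribʳ-+ m n (choose₂ n)))
      (SumOf-+ (SumOf-∑ n λ j → xs zero (suc j) λ ())
               (SumOf-sum² n λ i j i≢j → xs (suc i) (suc j) (i≢j ∘ Fin.suc-injective)))

    -- The distinctness of the three indices is passed on, because the columns of a cofactor are
    -- later renumbered by `punchOut`.
    SumOf-sum³ : ∀ n {m} {f : Fin n → Fin n → Fin n → Carrier} →
                 (∀ i j k → i ≢ j → i ≢ k → j ≢ k → SumOf Q m (f i j k)) →
                 SumOf Q (choose₃ n ℕ.* m) (sum³ n f)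
    SumOf-sum³ zero    xs = empty refl
    SumOf-sum³ (suc n) {m} xs = SumOf-cong (≡.sym (ℕ.*-distribʳ-+ m (choose₂ n) (choose₃ n)))
      (SumOf-+ (SumOf-sum² n λ j k j≢k → xs zero (suc j) (suc k) (λ ()) (λ ()) (j≢k ∘ Fin.suc-injective))
               (SumOf-sum³ n λ i j k i≢j i≢k j≢k → xs (suc i) (suc j) (suc k)
                 (i≢j ∘ Fin.suc-injective) (i≢k ∘ Fin.suc-injective) (j≢k ∘ Fin.suc-injective)))

    SumOf⇒∑ : ∀ {k p} → SumOf Q k p → ∃[ f ] ((∀ (i : Fin k) → Q (f i)) × p ≈ ∑ f)
    SumOf⇒∑ (empty p≈0) = (λ ()) , (λ ()) , trans p≈0 (sym ∑-zero)
    SumOf⇒∑ (add {q = q} x xs eq) =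
      let f , Qf , r≈∑f = SumOf⇒∑ xs
      in q ◂ f , (λ { zero → x ; (suc i) → Qf i }) , trans eq (trans (+-congˡ r≈∑f) (sym ∑-suc))

  SumOf-bind : ∀ {Q Q′ : Pred Carrier 0ℓ} {m k p} → (∀ {q} → Q q → SumOf Q′ m q) →
               SumOf Q k p → SumOf Q′ (k ℕ.* m) p
  SumOf-bind f (empty p≈0)   = empty p≈0
  SumOf-bind f (add x xs eq) = SumOf-resp (sym eq) (SumOf-+ (f x) (SumOf-bind f xs))

  SumOf-scale : ∀ {Q Q′ : Pred Carrier 0ℓ} c {k p} → (∀ {q} → Q q → Q′ (c * q)) →
                SumOf Q k p → SumOf Q′ k (c * p)
  SumOf-scale c f (empty p≈0)   = empty (trans (*-congˡ p≈0) (zeroʳ c))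
  SumOf-scale c f (add x xs eq) = add (f x) (SumOf-scale c f xs) (trans (*-congˡ eq) (distribˡ c _ _))

  ProductOf-resp : ∀ {L k p q} → p ≈ q → ProductOf L k p → ProductOf L k q
  ProductOf-resp p≈q (unit p≈1)    = unit (trans (sym p≈q) p≈1)
  ProductOf-resp p≈q (mul a xs eq) = mul a xs (trans (sym p≈q) eq)

  ProductOf-* : ∀ {L k l p q} → ProductOf L k p → ProductOf L l q → ProductOf L (k ℕ.+ l) (p * q)
  ProductOf-* (unit p≈1)    ys = ProductOf-resp (sym (trans (*-congʳ p≈1) (*-identityˡ _))) ys
  ProductOf-* (mul a xs eq) ys = mul a (ProductOf-* xs ys) (trans (*-congʳ eq) (*-assoc _ _ _))

  SumOf-ProductOf-* : ∀ {L a b k l p q} → SumOf (ProductOf L a) k p → SumOf (ProductOf L b) l q →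
                      SumOf (ProductOf L (a ℕ.+ b)) (k ℕ.* l) (p * q)
  SumOf-ProductOf-* (empty p≈0) ys = empty (trans (*-congʳ p≈0) (zeroˡ _))
  SumOf-ProductOf-* {q = q} (add {q = x₀} {r} x xs eq) ys =
    SumOf-resp (sym (trans (*-congʳ eq) (distribʳ q x₀ r)))
      (SumOf-+ (SumOf-scale x₀ (ProductOf-* x) ys) (SumOf-ProductOf-* xs ys))

-- The recursion of d!, d! = 6 C(d,3) (d-3)!, with 5 in place of 6; the base values are 0!, 1! and
-- 2!.
productCount : ℕ → ℕ
productCount 0                   = 1
productCount 1                   = 1
productCount 2                   = 2
productCount (suc (suc (suc d))) = choose₃ (3 ℕ.+ d) ℕ.* (5 ℕ.* productCount d)

-- Expanding along blocks of three rows, each 3 × 3 minor costs five products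
-- (Derksen) instead of the six of Leibniz' formula.
module DeterminantDecomposition (P : CommutativeRing 0ℓ 0ℓ) where
  open CommutativeRing P hiding (zero)
  open IntegerSolver P
  open FiniteSums P
  open Determinants P
  open DeterminantProducts P
  open Decompositions P
  open Matrices rawRing using (Matrix)
  open import Algebra.Definitions.RawSemiring (RawRing.rawSemiring rawRing) using (_^_)

  module _ (L : Pred Carrier 0ℓ)
           (L-+ : ∀ {a b} → L a → L b → L (a + b)) (L-neg : ∀ {a} → L a → L (- a))
           (half : Carrier) (half+half : half + half ≈ 1#) (L-half : ∀ {a} → L a → L (half * a)) where

    -- In Derksen's identity four of the five products carry the coefficient 1/2, which is absorbed
    -- by their first factor; the third product has coefficient 1.
    derksen : ∀ {a b c a′ b′ c′ a″ b″ c″} → L a → L b → L c → L a′ → L b′ → L c′ → L a″ → L b″ → L c″ →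
              SumOf (ProductOf L 3) 5 (det₃ a b c a′ b′ c′ a″ b″ c″)
    derksen {a} {b} {c} {a′} {b′} {c′} {a″} {b″} {c″} A B C A′ B′ C′ A″ B″ C″ =
      add (triple (L-half (L-+ B C)) (L-+ A′ (L-neg B′)) (L-+ A″ B″))
      (add (triple (L-half (L-+ A B)) (L-+ B′ (L-neg C′)) (L-+ B″ C″))
      (add (triple B (L-+ C′ (L-neg A′)) (L-+ C″ A″))
      (add (triple (L-half (L-+ C (L-neg B))) (L-+ B′ A′) (L-+ B″ (L-neg A″)))
      (add (triple (L-half (L-+ A (L-neg B))) (L-+ C′ B′) (L-+ C″ (L-neg B″)))
      (empty refl) refl) refl) refl) refl)
      -- Multiplying by `half + half` turns the identity into one with integer coefficients in which
      -- `half` is an indeterminate.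
      (trans (sym (trans (*-congʳ half+half) (*-identityˡ _)))
        (trans (solve 10 (λ h a b c a′ b′ c′ a″ b″ c″ →
          (h :+ h) :* (a :* (b′ :* c″) :- b :* (a′ :* c″) :+ b :* (c′ :* a″) :- a :* (c′ :* b″)
                       :+ c :* (a′ :* b″) :- c :* (b′ :* a″))
          := h :* (b :+ c) :* ((a′ :- b′) :* (a″ :+ b″))
             :+ (h :* (a :+ b) :* ((b′ :- c′) :* (b″ :+ c″))
             :+ ((h :+ h) :* (b :* ((c′ :- a′) :* (c″ :+ a″)))
             :+ (h :* (c :- b) :* ((b′ :+ a′) :* (b″ :- a″))
             :+ (h :* (a :- b) :* ((c′ :+ b′) :* (c″ :- b″)) :+ con (+ 0))))))
          refl half a b c a′ b′ c′ a″ b″ c″)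
        (+-congˡ (+-congˡ (+-congʳ (trans (*-congʳ half+half) (*-identityˡ _)))))))
      where
      triple : ∀ {x y z} → L x → L y → L z → ProductOf L 3 (x * (y * z))
      triple x y z = mul x (mul y (mul z (unit refl) (sym (*-identityʳ _))) refl) refl

    -- A sign is absorbed by the first factor of each product, so there must be one.
    SumOf-sign : ∀ {k m p} e → SumOf (ProductOf L (suc k)) m p → SumOf (ProductOf L (suc k)) m ((- 1#) ^ e * p)
    SumOf-sign zero    xs = SumOf-resp (sym (*-identityˡ _)) xs
    SumOf-sign (suc e) xs = SumOf-resp (sym (*-assoc _ _ _)) (SumOf-scale (- 1#) negate (SumOf-sign e xs))
      where
      negate : ∀ {k q} → ProductOf L (suc k) q → ProductOf L (suc k) (- 1# * q)
      negate (mul {q = q} a ys eq) = mul (L-neg a) ys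
        (trans (*-congˡ eq) (solve 2 (λ a q → :- con (+ 1) :* (a :* q) := :- a :* q) refl _ q))

    Det-decomposition : ∀ d (M : Matrix d d) → (∀ i j → L (M i j)) →
                        SumOf (ProductOf L d) (productCount d) (Det M)
    Det-decomposition 0 M LM = SumOf-single (unit Det-zero)
    Det-decomposition 1 M LM = SumOf-single (mul (LM zero zero) (unit refl)
      (trans Det-suc (trans ∑-suc (trans (+-cong (*-congˡ (*-congˡ Det-zero)) ∑-zero)
        (solve 1 (λ x → con (+ 1) :* (x :* con (+ 1)) :+ con (+ 0) := x :* con (+ 1)) refl _)))))
    Det-decomposition 2 M LM = SumOf-resp (sym Det-suc) (SumOf-∑ 2 λ j →
      SumOf-sign (toℕ j) (SumOf-scale (M zero j) (λ X → mul (LM zero j) X refl)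
        (Det-decomposition 1 _ λ r c → LM (suc r) (punchIn j c))))
    Det-decomposition (suc (suc (suc d))) M LM = SumOf-resp
      (sym (trans (Det-cong-≡ λ { zero _ → ≡.refl ; (suc zero) _ → ≡.refl
                                ; (suc (suc zero)) _ → ≡.refl ; (suc (suc (suc r))) _ → ≡.refl })
        (laplace₃ (M zero) (M (suc zero)) (M (suc (suc zero))) X)))
      (SumOf-sum³ (3 ℕ.+ d) block)
      where
      X : Matrix d (3 ℕ.+ d)
      X r = M (suc (suc (suc r)))
      block : ∀ i j k → i ≢ j → i ≢ k → j ≢ k → SumOf (ProductOf L (3 ℕ.+ d)) (5 ℕ.* productCount d)
        (det₃ (M zero i) (M zero j) (M zero k) (M (suc zero) i) (M (suc zero) j) (M (suc zero) k)
              (M (suc (suc zero)) i) (M (suc (suc zero)) j) (M (suc (suc zero)) k) * unitMinor X i j k)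
      block i j k i≢j i≢k j≢k = SumOf-resp
        (trans (solve 5 (λ s t u D E → s :* (t :* (u :* D)) :* E := D :* (s :* (t :* (u :* E)))) refl
                 (sgn i) (sgn j′) (sgn k′) _ _)
          (*-congˡ (trans (sym (unitMinor-punchIn X i j′ k′))
            (reflexive (≡.cong₂ (unitMinor X i) (Fin.punchIn-punchOut i≢j)
              (≡.trans (≡.cong (punchIn i) (Fin.punchIn-punchOut j′≢)) (Fin.punchIn-punchOut i≢k)))))))
        (SumOf-ProductOf-*
          -- The three signs go to the 3 × 3 determinant: for d = 0 the complementary minor is an
          -- empty product and could not absorb them.
          (SumOf-sign (toℕ i) (SumOf-sign (toℕ j′) (SumOf-sign (toℕ k′)
            (derksen (LM _ _) (LM _ _) (LM _ _) (LM _ _) (LM _ _) (LM _ _) (LM _ _) (LM _ _) (LM _ _)))))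
          (Det-decomposition d _ λ r c → LM _ _))
        where
        -- The position of column j once i is deleted; `k′` is that of k once both are.
        j′ = punchOut i≢j
        j′≢ : j′ ≢ punchOut i≢k
        j′≢ = j≢k ∘ Fin.punchOut-injective i≢j i≢k
        k′ = punchOut j′≢

-- Equals 2^m (m+1)!, the factor in polarisation with m differences.
polarisationConstant : ℕ → ℕ
polarisationConstant zero    = 1
polarisationConstant (suc m) = 2 ℕ.* (2 ℕ.+ m) ℕ.* polarisationConstant m

-- Iterated central differences of z ↦ zᵈ.  In the weights Δ xs h y of h at the
-- points y ± x₁ ± … ± xₘ the moments below m vanish; the moment m + 1 is
-- proportional to y x₁ ⋯ xₘ, and each further difference passes it on because the
-- moment m does not enter, by parity.
module Polarisation (P : CommutativeRing 0ℓ 0ℓ) where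
  open CommutativeRing P hiding (zero)
  open IntegerSolver P
  open Decompositions P
  open import Algebra.Properties.Ring ring using (-1*x≈-x)
  open import Algebra.Properties.Semiring.Exp semiring using (_^_; ^-congˡ)
  open import Relation.Binary.Reasoning.Setoid setoid

  Congruent : (Carrier → Carrier) → Set
  Congruent h = ∀ {x y} → x ≈ y → h x ≈ h y

  Δ : ∀ {m} → Vec Carrier m → (Carrier → Carrier) → Carrier → Carrier
  Δ []       h y = h y
  Δ (x ∷ xs) h y = Δ xs h (y + x) - Δ xs h (y - x)

  Δ-cong : ∀ {m} (xs : Vec Carrier m) {g h y} → (∀ z → g z ≈ h z) → Δ xs g y ≈ Δ xs h y
  Δ-cong []       g≈h = g≈h _
  Δ-cong (x ∷ xs) g≈h = +-cong (Δ-cong xs g≈h) (-‿cong (Δ-cong xs g≈h))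

  Δ-congʳ : ∀ {m} (xs : Vec Carrier m) {h y z} → Congruent h → y ≈ z → Δ xs h y ≈ Δ xs h z
  Δ-congʳ []       h-cong y≈z = h-cong y≈z
  Δ-congʳ (x ∷ xs) h-cong y≈z =
    +-cong (Δ-congʳ xs h-cong (+-congʳ y≈z)) (-‿cong (Δ-congʳ xs h-cong (+-congʳ y≈z)))

  Δ-linear : ∀ {m} (xs : Vec Carrier m) c {g h y} →
             Δ xs (λ z → g z + c * h z) y ≈ Δ xs g y + c * Δ xs h y
  Δ-linear []       c = refl
  Δ-linear (x ∷ xs) c = trans (+-cong (Δ-linear xs c) (-‿cong (Δ-linear xs c)))
    (solve 5 (λ c a b d e → a :+ c :* b :- (d :+ c :* e) := a :- d :+ c :* (b :- e)) refl c _ _ _ _)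

  Δ-shift : ∀ {m} (xs : Vec Carrier m) {h} → Congruent h → ∀ x y → Δ xs h (y + x) ≈ Δ xs (λ z → h (z + x)) y
  Δ-shift []        h-cong x y = refl
  Δ-shift (x′ ∷ xs) h-cong x y = +-cong (shift x′) (-‿cong (shift (- x′)))
    where
    shift : ∀ x″ → Δ xs _ (y + x + x″) ≈ Δ xs (λ z → _) (y + x″)
    shift x″ = trans
      (Δ-congʳ xs h-cong (solve 3 (λ y x x″ → y :+ x :+ x″ := y :+ x″ :+ x) refl y x x″))
      (Δ-shift xs h-cong x (y + x″))

  module Step {m} (xs : Vec Carrier m) (y x : Carrier)
              (vanish : ∀ k → k ℕ.< m → Δ xs (_^ k) y ≈ 0#) where
    M : (Carrier → Carrier) → Carrier
    M h = Δ xs h y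

    K = M (_^ suc m)

    -- Twice the parts of (z + x)^e that are odd and even in x. The recursions below take the place
    -- of the binomial theorem.
    odd even : ℕ → Carrier → Carrier
    odd  e z = (z + x) ^ e - (z - x) ^ e
    even e z = (z + x) ^ e + (z - x) ^ e

    odd-suc : ∀ j e → M (λ z → z ^ j * odd (suc e) z)
                      ≈ M (λ z → z ^ suc j * odd e z) + x * M (λ z → z ^ j * even e z)
    odd-suc j e = trans (Δ-cong xs λ z →
        solve 5 (λ z x p a b → p :* ((z :+ x) :* a :- (z :- x) :* b)
                              := z :* p :* (a :- b) :+ x :* (p :* (a :+ b))) refl z x (z ^ j) ((z + x) ^ e) ((z - x) ^ e))
      (Δ-linear xs x)

    even-suc : ∀ j e → M (λ z → z ^ j * even (suc e) z)
                       ≈ M (λ z → z ^ suc j * even e z) + x * M (λ z → z ^ j * odd e z)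
    even-suc j e = trans (Δ-cong xs λ z →
        solve 5 (λ z x p a b → p :* ((z :+ x) :* a :+ (z :- x) :* b)
                              := z :* p :* (a :+ b) :+ x :* (p :* (a :- b))) refl z x (z ^ j) ((z + x) ^ e) ((z - x) ^ e))
      (Δ-linear xs x)

    odd-base : ∀ j → M (λ z → z ^ j * odd 0 z) ≈ 0#
    odd-base j = trans (Δ-cong xs λ z →
        solve 1 (λ p → p :* (con (+ 1) :- con (+ 1)) := p :+ :- con (+ 1) :* p) refl (z ^ j))
      (trans (Δ-linear xs (- 1#)) (solve 1 (λ a → a :+ :- con (+ 1) :* a := con (+ 0)) refl _))

    even-base : ∀ j → M (λ z → z ^ j * even 0 z) ≈ M (_^ j) + M (_^ j)
    even-base j = trans (Δ-cong xs λ z →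
        solve 1 (λ p → p :* (con (+ 1) :+ con (+ 1)) := p :+ con (+ 1) :* p) refl (z ^ j))
      (trans (Δ-linear xs 1#) (+-congˡ (*-identityˡ _)))

    combine-≈0 : ∀ {a b} → a ≈ 0# → b ≈ 0# → a + x * b ≈ 0#
    combine-≈0 a≈0 b≈0 = trans (+-cong a≈0 (*-congˡ b≈0))
      (solve 1 (λ x → con (+ 0) :+ x :* con (+ 0) := con (+ 0)) refl x)

    -- An odd part contains at least one factor x, so its degree in z stays below j + e. It
    -- therefore tolerates one degree more than the even part.
    odd-vanish : ∀ e j → j ℕ.+ e ℕ.< suc m → M (λ z → z ^ j * odd e z) ≈ 0#
    even-vanish : ∀ e j → j ℕ.+ e ℕ.< m → M (λ z → z ^ j * even e z) ≈ 0#
    odd-vanish zero    j _ = odd-base j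
    odd-vanish (suc e) j h = trans (odd-suc j e) (combine-≈0
      (odd-vanish e (suc j) (≡.subst (ℕ._< suc m) (ℕ.+-suc j e) h))
      (even-vanish e j (ℕ.≤-pred (≡.subst (ℕ._< suc m) (ℕ.+-suc j e) h))))
    even-vanish zero    j h = trans (even-base j)
      (trans (+-cong (vanish j j<m) (vanish j j<m)) (+-identityˡ 0#))
      where j<m = ≡.subst (ℕ._< m) (ℕ.+-identityʳ j) h
    even-vanish (suc e) j h = trans (even-suc j e) (combine-≈0
      (even-vanish e (suc j) (≡.subst (ℕ._< m) (ℕ.+-suc j e) h))
      (odd-vanish e j (ℕ.<-trans (ℕ.n<1+n _) (ℕ.m<n⇒m<1+n (≡.subst (ℕ._< m) (ℕ.+-suc j e) h)))))

    -- The leading term in z is 2e x z^(m+1); by parity the next power is z^(m-1), whose moment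
    -- vanishes. In `even-top` the leading term is likewise 2z^(m+1).
    odd-top : ∀ e j → j ℕ.+ e ≡ 2 ℕ.+ m → M (λ z → z ^ j * odd e z) ≈ fromNat (2 ℕ.* e) * (x * K)
    even-top : ∀ e j → j ℕ.+ e ≡ suc m → M (λ z → z ^ j * even e z) ≈ K + K
    odd-top zero    j _ = trans (odd-base j) (sym (zeroˡ _))
    odd-top (suc e) j h = begin
      M (λ z → z ^ j * odd (suc e) z)
        ≈⟨ odd-suc j e ⟩
      M (λ z → z ^ suc j * odd e z) + x * M (λ z → z ^ j * even e z)
        ≈⟨ +-cong (odd-top e (suc j) j+e) (*-congˡ (even-top e j (ℕ.suc-injective j+e))) ⟩
      fromNat (2 ℕ.* e) * (x * K) + x * (K + K)
        ≈⟨ solve 3 (λ n x k → n :* (x :* k) :+ x :* (k :+ k) := (con (+ 2) :+ n) :* (x :* k)) refl _ x K ⟩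
      (fromNat 2 + fromNat (2 ℕ.* e)) * (x * K)
        ≈⟨ *-congʳ (trans (sym (fromNat-+ 2 (2 ℕ.* e))) (reflexive (≡.cong fromNat (≡.sym (ℕ.*-suc 2 e))))) ⟩
      fromNat (2 ℕ.* suc e) * (x * K) ∎
      where j+e = ≡.trans (≡.sym (ℕ.+-suc j e)) h
    even-top zero    j h rewrite ℕ.+-identityʳ j | h = even-base (suc m)
    even-top (suc e) j h = trans (even-suc j e) (trans
      (+-cong (even-top e (suc j) j+e) (*-congˡ (odd-vanish e j (ℕ.≤-reflexive j+e))))
      (solve 2 (λ k x → k :+ x :* con (+ 0) := k) refl (K + K) x))
      where j+e = ≡.trans (≡.sym (ℕ.+-suc j e)) h

    Δ-∷ : ∀ k → Δ (x ∷ xs) (_^ k) y ≈ M (λ z → z ^ 0 * odd k z)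
    Δ-∷ k = begin
      Δ xs (_^ k) (y + x) - Δ xs (_^ k) (y - x)
        ≈⟨ +-cong (Δ-shift xs (^-congˡ k) x y) (-‿cong (Δ-shift xs (^-congˡ k) (- x) y)) ⟩
      M (λ z → (z + x) ^ k) - M (λ z → (z - x) ^ k)
        ≈⟨ solve 2 (λ a b → a :- b := a :+ :- con (+ 1) :* b) refl _ _ ⟩
      M (λ z → (z + x) ^ k) + - 1# * M (λ z → (z - x) ^ k)
        ≈⟨ Δ-linear xs (- 1#) ⟨
      M (λ z → (z + x) ^ k + - 1# * (z - x) ^ k)
        ≈⟨ Δ-cong xs (λ z → solve 2 (λ a b → a :+ :- con (+ 1) :* b := con (+ 1) :* (a :- b)) refl _ _) ⟩
      M (λ z → z ^ 0 * odd k z) ∎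

  Δ-vanish : ∀ {m} (xs : Vec Carrier m) y k → k ℕ.< m → Δ xs (_^ k) y ≈ 0#
  Δ-vanish (x ∷ xs) y k k<m = trans (Δ-∷ k) (odd-vanish k 0 k<m)
    where open Step xs y x (Δ-vanish xs y)

  product : ∀ {m} → Vec Carrier m → Carrier
  product []       = 1#
  product (x ∷ xs) = x * product xs

  polarisation : ∀ {m} (xs : Vec Carrier m) y →
                 Δ xs (_^ suc m) y ≈ fromNat (polarisationConstant m) * (y * product xs)
  polarisation []       y = sym (*-identityˡ _)
  polarisation {suc m} (x ∷ xs) y = begin
    Δ (x ∷ xs) (_^ (2 ℕ.+ m)) y
      ≈⟨ trans (Δ-∷ (2 ℕ.+ m)) (odd-top (2 ℕ.+ m) 0 ≡.refl) ⟩
    fromNat (2 ℕ.* (2 ℕ.+ m)) * (x * K)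
      ≈⟨ *-congˡ (*-congˡ (polarisation xs y)) ⟩
    fromNat (2 ℕ.* (2 ℕ.+ m)) * (x * (fromNat (polarisationConstant m) * (y * product xs)))
      ≈⟨ solve 5 (λ a x b y p → a :* (x :* (b :* (y :* p))) := (a :* b) :* (y :* (x :* p))) refl _ x _ y _ ⟩
    (fromNat (2 ℕ.* (2 ℕ.+ m)) * fromNat (polarisationConstant m)) * (y * (x * product xs))
      ≈⟨ *-congʳ (fromNat-* (2 ℕ.* (2 ℕ.+ m)) (polarisationConstant m)) ⟨
    fromNat (polarisationConstant (suc m)) * (y * product (x ∷ xs)) ∎
    where open Step xs y x (Δ-vanish xs y)

  PowerOf : Pred Carrier 0ℓ → ℕ → Pred Carrier 0ℓ
  PowerOf L d p = ∃[ a ] (L a × p ≈ a ^ d)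

  ProductOf⇒Vec : ∀ {L m p} → ProductOf L m p → ∃[ xs ] (All L {m} xs × p ≈ product xs)
  ProductOf⇒Vec (unit p≈1) = [] , [] , p≈1
  ProductOf⇒Vec (mul {a = a} La X p≈aq) =
    let xs , Lxs , q≈ = ProductOf⇒Vec X in a ∷ xs , La ∷ Lxs , trans p≈aq (*-congˡ q≈)

  module _ (L : Pred Carrier 0ℓ)
           (L-+ : ∀ {a b} → L a → L b → L (a + b)) (L-neg : ∀ {a} → L a → L (- a)) where

    -- Every difference doubles the number of powers and gives half of them a minus sign, which
    -- `neg-power` absorbs.
    Δ-powers : ∀ d → (∀ {a} → L a → ∃[ b ] (L b × - 1# * a ^ d ≈ b ^ d)) →
               ∀ {m} (xs : Vec Carrier m) y → All L xs → L y → SumOf (PowerOf L d) (2 ℕ.^ m) (Δ xs (_^ d) y)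
    Δ-powers d neg-power []       y []         Ly = SumOf-single (y , Ly , refl)
    Δ-powers d neg-power {suc m} (x ∷ xs) y (Lx ∷ Lxs) Ly =
      SumOf-cong (≡.cong (2 ℕ.^ m ℕ.+_) (≡.sym (ℕ.+-identityʳ (2 ℕ.^ m))))
        (SumOf-+ (Δ-powers d neg-power xs (y + x) Lxs (L-+ Ly Lx))
          (SumOf-resp (-1*x≈-x (Δ xs (_^ d) (y - x)))
            (SumOf-scale (- 1#)
              (λ (a , La , p≈a^d) → let b , Lb , eq = neg-power La in b , Lb , trans (*-congˡ p≈a^d) eq)
              (Δ-powers d neg-power xs (y - x) Lxs (L-+ Ly (L-neg Lx))))))

    -- The factor c turns the polarisation identity into a formula without a
    -- constant, so that no d-th root of the constant is needed.
    product-powers : ∀ m {c p} → fromNat (polarisationConstant m) * c ≈ 1# → (∀ {a} → L a → L (c * a)) →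
                     (∀ {a} → L a → ∃[ b ] (L b × - 1# * a ^ suc m ≈ b ^ suc m)) →
                     ProductOf L (suc m) p → SumOf (PowerOf L (suc m)) (2 ℕ.^ m) p
    product-powers m {c} {p} kc≈1 L-c neg-power X with ProductOf⇒Vec X
    ... | x ∷ xs , Lx ∷ Lxs , p≈ = SumOf-resp value (Δ-powers (suc m) neg-power xs (c * x) Lxs (L-c Lx))
      where
      k = fromNat (polarisationConstant m)
      value : Δ xs (_^ suc m) (c * x) ≈ p
      value = begin
        Δ xs (_^ suc m) (c * x)    ≈⟨ polarisation xs (c * x) ⟩
        k * (c * x * product xs)
          ≈⟨ solve 4 (λ k c x y → k :* (c :* x :* y) := (k :* c) :* (x :* y)) refl k c x (product xs) ⟩
        (k * c) * (x * product xs) ≈⟨ *-cong kc≈1 (sym p≈) ⟩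
        1# * p                     ≈⟨ *-identityˡ p ⟩
        p                          ∎

-- The number of powers as the rational bound

fromℕ-* : ∀ m n → fromℕ (m ℕ.* n) ≡ fromℕ m ℚ.* fromℕ n
fromℕ-* m n = ℚ.toℚᵘ-injective (begin
  ℚ.toℚᵘ (fromℕ (m ℕ.* n))                         ≈⟨ ℚ.toℚᵘ-fromℚᵘ (ℚᵘ.mkℚᵘ (+ (m ℕ.* n)) 0) ⟩
  ℚᵘ.mkℚᵘ (+ (m ℕ.* n)) 0                          ≈⟨ ℚᵘ.*≡* (≡.cong (ℤ._* + 1) (ℤ.pos-* m n)) ⟩
  ℚᵘ.mkℚᵘ (+ m) 0 ℚᵘ.* ℚᵘ.mkℚᵘ (+ n) 0
    ≈⟨ ℚᵘ.*-cong (ℚ.toℚᵘ-fromℚᵘ (ℚᵘ.mkℚᵘ (+ m) 0)) (ℚ.toℚᵘ-fromℚᵘ (ℚᵘ.mkℚᵘ (+ n) 0)) ⟨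
  ℚ.toℚᵘ (fromℕ m) ℚᵘ.* ℚ.toℚᵘ (fromℕ n)           ≈⟨ ℚ.toℚᵘ-homo-* (fromℕ m) (fromℕ n) ⟨
  ℚ.toℚᵘ (fromℕ m ℚ.* fromℕ n)                     ∎)
  where open ℚᵘ.≃-Reasoning

fromℕ-mono-≤ : ∀ {m n} → m ≤ n → fromℕ m ℚ.≤ fromℕ n
fromℕ-mono-≤ {m} {n} m≤n = ℚ.toℚᵘ-cancel-≤ (ℚᵘ.≤-respʳ-≃ (ℚᵘ.≃-sym (ℚ.toℚᵘ-fromℚᵘ (ℚᵘ.mkℚᵘ (+ n) 0)))
  (ℚᵘ.≤-respˡ-≃ (ℚᵘ.≃-sym (ℚ.toℚᵘ-fromℚᵘ (ℚᵘ.mkℚᵘ (+ m) 0)))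
    (ℚᵘ.*≤* (ℤ.*-monoʳ-≤-nonNeg (+ 1) (ℤ.+≤+ m≤n)))))

2*choose₂ : ∀ n → 2 ℕ.* choose₂ (suc n) ≡ suc n ℕ.* n
2*choose₂ zero    = ≡.refl
2*choose₂ (suc n) = ≡.trans (ℕ.*-distribˡ-+ 2 (suc n) (choose₂ (suc n)))
  (≡.trans (≡.cong (2 ℕ.* suc n ℕ.+_) (2*choose₂ n))
    (ℕS.solve 1 (λ n → ℕS.con 2 ℕS.:* (ℕS.con 1 ℕS.:+ n) ℕS.:+ (ℕS.con 1 ℕS.:+ n) ℕS.:* n
                       ℕS.:= (ℕS.con 2 ℕS.:+ n) ℕS.:* (ℕS.con 1 ℕS.:+ n)) ≡.refl n))

6*choose₃ : ∀ n → 6 ℕ.* choose₃ (2 ℕ.+ n) ≡ (2 ℕ.+ n) ℕ.* (suc n ℕ.* n)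
6*choose₃ zero    = ≡.refl
6*choose₃ (suc n) = ≡.trans
  (ℕS.solve 2 (λ a b → ℕS.con 6 ℕS.:* (a ℕS.:+ b) ℕS.:= ℕS.con 3 ℕS.:* (ℕS.con 2 ℕS.:* a) ℕS.:+ ℕS.con 6 ℕS.:* b)
            ≡.refl (choose₂ (2 ℕ.+ n)) (choose₃ (2 ℕ.+ n)))
  (≡.trans (≡.cong₂ (λ a b → 3 ℕ.* a ℕ.+ b) (2*choose₂ (suc n)) (6*choose₃ n))
    (ℕS.solve 1 (λ n → ℕS.con 3 ℕS.:* ((ℕS.con 2 ℕS.:+ n) ℕS.:* (ℕS.con 1 ℕS.:+ n))
                         ℕS.:+ (ℕS.con 2 ℕS.:+ n) ℕS.:* ((ℕS.con 1 ℕS.:+ n) ℕS.:* n)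
                       ℕS.:= (ℕS.con 3 ℕS.:+ n) ℕS.:* ((ℕS.con 2 ℕS.:+ n) ℕS.:* (ℕS.con 1 ℕS.:+ n))) ≡.refl n))

fromℕ-productCount : ∀ d → let open RawSemiringDefs ℚ.+-*-rawSemiring using (_^_) in
                     fromℕ (productCount d) ≡ (+ 5 ℚ./ 6) ^ (d ℕ./ 3) ℚ.* fromℕ (d ℕ.!)
fromℕ-productCount 0 = ≡.refl
fromℕ-productCount 1 = ≡.refl
fromℕ-productCount 2 = ≡.refl
fromℕ-productCount (suc (suc (suc d))) = begin
  fromℕ (c ℕ.* (5 ℕ.* productCount d))
    ≡⟨ ≡.trans (fromℕ-* c (5 ℕ.* productCount d)) (≡.cong (fromℕ c ℚ.*_)
         (≡.trans (fromℕ-* 5 (productCount d)) (≡.cong (fromℕ 5 ℚ.*_) (fromℕ-productCount d)))) ⟩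
  -- Here 5 has become (5/6) · 6, the same rational by computation; the 6 turns C(d+3,3) into a
  -- falling factorial.
  fromℕ c ℚ.* ((q ℚ.* fromℕ 6) ℚ.* (q ^ (d ℕ./ 3) ℚ.* fromℕ (d ℕ.!)))
    ≡⟨ IntegerSolver.solve ℚ.+-*-commutativeRing 5
         (λ c q s p f → c Q.:* ((q Q.:* s) Q.:* (p Q.:* f)) Q.:= q Q.:* p Q.:* ((s Q.:* c) Q.:* f)) ≡.refl
         (fromℕ c) q (fromℕ 6) (q ^ (d ℕ./ 3)) (fromℕ (d ℕ.!)) ⟩
  q ^ suc (d ℕ./ 3) ℚ.* (fromℕ 6 ℚ.* fromℕ c ℚ.* fromℕ (d ℕ.!))
    ≡⟨ ≡.cong₂ (λ k x → q ^ k ℚ.* x) (≡.sym (ℕ.m/n≡1+[m∸n]/n {3 ℕ.+ d} {3} (ℕ.s≤s (ℕ.s≤s (ℕ.s≤s ℕ.z≤n)))))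
         (≡.trans (≡.cong (ℚ._* fromℕ (d ℕ.!)) (≡.sym (fromℕ-* 6 c))) (≡.sym (fromℕ-* (6 ℕ.* c) (d ℕ.!)))) ⟩
  q ^ ((3 ℕ.+ d) ℕ./ 3) ℚ.* fromℕ (6 ℕ.* c ℕ.* d ℕ.!)
    ≡⟨ ≡.cong (λ x → q ^ ((3 ℕ.+ d) ℕ./ 3) ℚ.* fromℕ x) (≡.trans (≡.cong (ℕ._* d ℕ.!) (6*choose₃ (suc d)))
         (ℕS.solve 4 (λ a b c f → a ℕS.:* (b ℕS.:* c) ℕS.:* f ℕS.:= a ℕS.:* (b ℕS.:* (c ℕS.:* f))) ≡.refl
           (3 ℕ.+ d) (2 ℕ.+ d) (suc d) (d ℕ.!))) ⟩
  q ^ ((3 ℕ.+ d) ℕ./ 3) ℚ.* fromℕ ((3 ℕ.+ d) ℕ.!) ∎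
  where
  open ≡.≡-Reasoning
  open RawSemiringDefs ℚ.+-*-rawSemiring using (_^_)
  module Q = IntegerSolver ℚ.+-*-commutativeRing
  q = + 5 ℚ./ 6
  c = choose₃ (3 ℕ.+ d)

rankBound≡ : ∀ d → rankBound d ≡ fromℕ (productCount d ℕ.* 2 ℕ.^ (d ℕ.∸ 1))
rankBound≡ d = begin
  p ℚ.* t ℚ.* f          ≡⟨ ℚ.*-assoc p t f ⟩
  p ℚ.* (t ℚ.* f)        ≡⟨ ≡.cong (p ℚ.*_) (ℚ.*-comm t f) ⟩
  p ℚ.* (f ℚ.* t)        ≡⟨ ℚ.*-assoc p f t ⟨
  p ℚ.* f ℚ.* t          ≡⟨ ≡.cong (ℚ._* t) (fromℕ-productCount d) ⟨
  fromℕ (productCount d) ℚ.* t   ≡⟨ fromℕ-* (productCount d) (2 ℕ.^ (d ℕ.∸ 1)) ⟨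
  fromℕ (productCount d ℕ.* 2 ℕ.^ (d ℕ.∸ 1)) ∎
  where
  open ≡.≡-Reasoning
  open RawSemiringDefs ℚ.+-*-rawSemiring using (_^_)
  p = (+ 5 ℚ./ 6) ^ (d ℕ./ 3)
  t = fromℕ (2 ℕ.^ (d ℕ.∸ 1))
  f = fromℕ (d ℕ.!)

-- Minima and limits in the natural numbers

module Classical (em : ExcludedMiddle 0ℓ) where
  -- Either nothing below k satisfies `P`, or the search moves to a smaller element; the bound `b`
  -- drops each time.
  minimum-below : ∀ {P : Pred ℕ 0ℓ} b k → k ≤ b → P k → ∃[ m ] (IsMinimum P m × m ≤ k)
  minimum-below {P} b k k≤b Pk with em {∃[ j ] (P j × j ℕ.< k)}
  minimum-below zero    k k≤b Pk | yes (j , Pj , j<k) = contradiction (ℕ.<-≤-trans j<k k≤b) λ ()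
  minimum-below (suc b) k k≤b Pk | yes (j , Pj , j<k) =
    let m , isMin , m≤j = minimum-below b j (ℕ.≤-pred (ℕ.<-≤-trans j<k k≤b)) Pj
    in m , isMin , ℕ.≤-trans m≤j (ℕ.<⇒≤ j<k)
  minimum-below b k k≤b Pk | no none =
    k , (Pk , λ j Pj → ℕ.≮⇒≥ λ j<k → none (j , Pj , j<k)) , ℕ.≤-refl

  minimum : ∀ {P : Pred ℕ 0ℓ} k → P k → ∃[ m ] (IsMinimum P m × m ≤ k)
  minimum k = minimum-below k k ℕ.≤-refl

  module _ (a : ℕ → ℕ) (mono : ∀ n → a n ≤ a (suc n)) (b : ℕ) (bounded : ∀ n → a n ≤ b) where
    mono-≤ : ∀ m {n} → m ℕ.≤′ n → a m ≤ a n
    mono-≤ m ℕ.≤′-refl     = ℕ.≤-refl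
    mono-≤ m (ℕ.≤′-step h) = ℕ.≤-trans (mono-≤ m h) (mono _)

    -- `k` bounds how many strict increases are still possible after N; each one found moves N
    -- forward and uses up one.
    eventually-constant : ∀ k N → b ≤ a N ℕ.+ k → ∃[ M ] (∀ n → M ≤ n → a n ≡ a M)
    eventually-constant k N b≤ with em {∃[ n ] (a N ℕ.< a n)}
    eventually-constant zero    N b≤ | yes (n , aN<an) = contradiction
      (ℕ.<-≤-trans aN<an (ℕ.≤-trans (bounded n) (ℕ.≤-trans b≤ (ℕ.≤-reflexive (ℕ.+-identityʳ (a N))))))
      (ℕ.<-irrefl ≡.refl)
    eventually-constant (suc k) N b≤ | yes (n , aN<an) = eventually-constant k n
      (ℕ.≤-trans b≤ (ℕ.≤-trans (ℕ.≤-reflexive (ℕ.+-suc (a N) k)) (ℕ.+-monoˡ-≤ k aN<an)))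
    eventually-constant k N b≤ | no none = N , λ n N≤n →
      ℕ.≤-antisym (ℕ.≮⇒≥ λ aN<an → none (n , aN<an)) (mono-≤ N (ℕ.≤⇒≤′ N≤n))

    monotone-limit : ∃[ L ] (HasLimit a L × L ≤ b)
    monotone-limit =
      let M , constant = eventually-constant b 0 (ℕ.m≤n+m b (a 0))
      in a M , (λ ε 0<ε → M , λ n M≤n →
           ≡.subst (λ k → fromℕ k ℚ.< ε) (≡.sym (ℕ.m≡n⇒∣m-n∣≡0 (constant n M≤n))) 0<ε) , bounded M

-- Waring rank

polarisationConstant-positive : ∀ m → 1 ≤ polarisationConstant m
polarisationConstant-positive zero    = ℕ.≤-refl
polarisationConstant-positive (suc m) =
  ℕ.*-mono-≤ {1} {2 ℕ.* (2 ℕ.+ m)} (ℕ.s≤s ℕ.z≤n) (polarisationConstant-positive m)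

element-injective : ∀ {n} (α : Subset n) {j k} → element α j ≡ element α k → j ≡ k
element-injective (inside  ∷ α) {zero}  {zero}  _ = ≡.refl
element-injective (inside  ∷ α) {suc j} {suc k} h = ≡.cong suc (element-injective α (Fin.suc-injective h))
element-injective (outside ∷ α) h = element-injective α (Fin.suc-injective h)

cast-injective : ∀ {m n} .(eq : m ≡ n) {j k} → cast eq j ≡ cast eq k → j ≡ k
cast-injective eq {j} {k} h = Fin.toℕ-injective
  (≡.trans (≡.sym (Fin.toℕ-cast eq j)) (≡.trans (≡.cong toℕ h) (Fin.toℕ-cast eq k)))

module _ (R : CommutativeRing 0ℓ 0ℓ) where
  open Polynomials (CommutativeRing.rawRing R)
  open PolynomialRing R

  -- Passes from the list of all subsets in `gPoly`, where a wrong size contributes nothing, to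
  -- Pascal's recursion in `subsetSum`.
  concatMap-allSubsets : ∀ {m} n d (s : Subset n → Poly m) (f : (α : Subset n) → .(∣ α ∣ ≡ d) → Poly m) →
    (∀ α (e : ∣ α ∣ ≡ d) → s α ≋ f α e) → (∀ α → ∣ α ∣ ≢ d → s α ≋ []) →
    List.concatMap s (allSubsets n) ≋ FiniteSums.subsetSum (polynomialRing m) n d f
  concatMap-allSubsets {m} = go
    where
    open CommutativeRing (polynomialRing m) hiding (zero)
    open FiniteSums (polynomialRing m)
    split : ∀ n (s : Subset (suc n) → Poly m) →
            List.concatMap s (allSubsets (suc n))
            ≡ List.concatMap (λ α → s (inside ∷ α)) (allSubsets n)
              List.++ List.concatMap (λ α → s (outside ∷ α)) (allSubsets n)
    split n s = ≡.trans
      (List.concatMap-++ s (List.map (inside ∷_) (allSubsets n)) (List.map (outside ∷_) (allSubsets n)))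
      (≡.cong₂ List._++_ (List.concatMap-map s (inside ∷_) (allSubsets n)) (List.concatMap-map s (outside ∷_) (allSubsets n)))
    vanish : ∀ {n} (s : Subset n → Poly m) (αs : List (Subset n)) → (∀ α → s α ≈ 0#) → List.concatMap s αs ≈ 0#
    vanish s []       h = refl
    vanish s (α ∷ αs) h = trans (+-cong (h α) (vanish s αs h)) (+-identityˡ 0#)
    go : ∀ n d (s : Subset n → Poly m) (f : (α : Subset n) → .(∣ α ∣ ≡ d) → Poly m) →
         (∀ α (e : ∣ α ∣ ≡ d) → s α ≈ f α e) → (∀ α → ∣ α ∣ ≢ d → s α ≈ 0#) →
         List.concatMap s (allSubsets n) ≈ subsetSum n d f
    go zero    zero    s f s≈f s≈0 = trans (+-identityʳ (s [])) (s≈f [] ≡.refl)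
    go zero    (suc d) s f s≈f s≈0 = trans (+-identityʳ (s [])) (s≈0 [] λ ())
    go (suc n) zero    s f s≈f s≈0 = trans (reflexive (split n s)) (trans
      (+-cong (vanish (λ α → s (inside ∷ α)) (allSubsets n) λ α → s≈0 (inside ∷ α) λ ())
              (go n zero (λ α → s (outside ∷ α)) (λ α e → f (outside ∷ α) e)
                (λ α e → s≈f (outside ∷ α) e) (λ α → s≈0 (outside ∷ α))))
      (+-identityˡ _))
    go (suc n) (suc d) s f s≈f s≈0 = trans (reflexive (split n s)) (+-cong
      (go n d (λ α → s (inside ∷ α)) (λ α e → f (inside ∷ α) (≡.cong suc e))
        (λ α e → s≈f (inside ∷ α) (≡.cong suc e)) (λ α ∣α∣≢d → s≈0 (inside ∷ α) (∣α∣≢d ∘ ℕ.suc-injective)))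
      (go n (suc d) (λ α → s (outside ∷ α)) (λ α e → f (outside ∷ α) e)
        (λ α e → s≈f (outside ∷ α) e) (λ α → s≈0 (outside ∷ α))))

  -- The polynomial ring differs from polyRing in its equality, so that powers and
  -- determinants over the two agree only propositionally.
  module _ {n : ℕ} where
    private
      module P = CommutativeRing (polynomialRing n)
      module Raw = RawSemiringDefs (RawRing.rawSemiring (polyRing n))
      module PD = Determinants (polynomialRing n)
    open FiniteSums (polynomialRing n)
    open import Algebra.Properties.Semiring.Exp P.semiring using (_^_)

    ^≡raw : ∀ (p : Poly n) k → p ^ k ≡ p Raw.^ k
    ^≡raw p zero    = ≡.refl
    ^≡raw p (suc k) = ≡.cong (p P.*_) (^≡raw p k)

    Det≋raw : ∀ {m} (M : Fin m → Fin m → Poly n) → PD.Det M ≋ Matrices.det (polyRing n) M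
    Det≋raw {zero}  M = PD.Det-zero
    Det≋raw {suc m} M = P.trans PD.Det-suc (P.trans
      (∑-cong λ j → P.*-cong (P.reflexive (^≡raw (P.- P.1#) (toℕ j))) (P.*-congˡ {M zero j} (Det≋raw _)))
      (P.reflexive (∑≡sum _)))

-- Waring decompositions of the determinant and of its substitutions

module WaringBounds (em : ExcludedMiddle 0ℓ) (ℝ : CompleteOrderedField) where
  open WaringRank ℝ
  open RealRoots em ℝ using (half; half+half; fromNat-suc≉0)
  open ComplexNumbers em ℝ
  private
    module ℝ = CompleteOrderedField ℝ
    module C = CommutativeRing complexField
    module ℝ→ℂ = Homomorphisms.Preservation ℝ.commutativeRing complexField embed-isHom
    module ι = Homomorphisms.IsRingHomomorphism ℝ.commutativeRing complexField embed-isHom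
  open PolynomialRing complexField

  invertible-fromNat : ∀ k → 1 ≤ k → ∃[ c ] (IntegerSolver.fromNat complexField k C.* c C.≈ C.1#)
  invertible-fromNat (suc k) _ =
    let i , eq = ℝ.*-inverse _ (fromNat-suc≉0 k)
    in embed i , C.trans (C.*-congʳ {embed i} (C.sym (ℝ→ℂ.fromNat-homo (suc k))))
         (C.trans (C.sym (ι.*-homo _ i)) (ι.⟦⟧-cong eq))

  module _ (n : ℕ) where
    private module P = CommutativeRing (polynomialRing n)
    open LinearForms complexField n
    open FiniteSums (polynomialRing n)
    open Decompositions (polynomialRing n)
    open Polarisation (polynomialRing n) using (PowerOf; product-powers)
    open import Algebra.Properties.CommutativeSemiring.Exp P.commutativeSemiring using (_^_; ^-congˡ; ^-distrib-*)
    private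
      module κ = Homomorphisms.IsRingHomomorphism complexField (polynomialRing n) const-isHom
      module ℂ→P = Homomorphisms.Preservation complexField (polynomialRing n) const-isHom

    Linear : Pred (Poly n) 0ℓ
    Linear p = ∃[ a ] (p P.≈ linearForm a)

    Linear-+ : ∀ {p q} → Linear p → Linear q → Linear (p P.+ q)
    Linear-+ (a , p≈) (b , q≈) = _ , P.trans (P.+-cong p≈ q≈) (P.sym (linearForm-+ a b))

    Linear-const-* : ∀ c {p} → Linear p → Linear (const c P.* p)
    Linear-const-* c (a , p≈) = _ , P.trans (P.*-congˡ {const c} p≈) (P.sym (linearForm-* c a))

    Linear-resp : ∀ {p q} → p P.≈ q → Linear p → Linear q
    Linear-resp p≈q (a , p≈) = a , P.trans (P.sym p≈q) p≈

    Linear-neg : ∀ {p} → Linear p → Linear (P.- p)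
    Linear-neg {p} Lp = Linear-resp (-1*x≈-x p) (Linear-const-* (C.- C.1#) Lp)
      where open import Algebra.Properties.Ring P.ring using (-1*x≈-x)

    Linear-0 : Linear P.0#
    Linear-0 = (λ _ → C.0#) , P.sym (P.trans (linearForm≈∑ _) (∑-≈0 λ i → monomial-0 _))

    Linear-∑ : ∀ {k} {f : Fin k → Poly n} → (∀ i → Linear (f i)) → Linear (∑ f)
    Linear-∑ {zero}  Lf = Linear-resp (P.sym ∑-zero) Linear-0
    Linear-∑ {suc k} Lf = Linear-resp (P.sym ∑-suc) (Linear-+ (Lf zero) (Linear-∑ (Lf ∘ suc)))

    hasWaringDecomposition : ∀ {d r g} (f : Fin r → Poly n) → (∀ i → PowerOf Linear d (f i)) →
                             g P.≈ ∑ f → HasWaringDecomposition d g r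
    hasWaringDecomposition {d} f powers g≈∑f = (λ i → proj₁ (proj₁ (proj₂ (powers i))))
      , coeff≈ (P.trans g≈∑f (P.trans
          (∑-cong λ i → let a , (b , a≈) , f≈ = powers i in
            P.trans f≈ (P.trans (^-congˡ d a≈) (P.reflexive (^≡raw complexField (linearForm b) d))))
          (P.reflexive (∑≡sum _))))

    -- With ω a d-th root of -1, the form `b` is ω times `a`.
    neg-power : ∀ d → 1 ≤ d → ∀ {a} → Linear a → ∃[ b ] (Linear b × P.- P.1# P.* a ^ d P.≈ b ^ d)
    neg-power d 1≤d {a} La =
      let ω , ω^d≈-1 = root-of-minus-one d 1≤d
      in const ω P.* a , Linear-const-* ω La
         , P.trans (P.*-congʳ {a ^ d} (P.sym (P.trans (P.sym (ℂ→P.^-homo ω d)) (P.trans (κ.⟦⟧-cong ω^d≈-1) (κ.-‿homo C.1#)))))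
             (P.sym (^-distrib-* (const ω) a d))

    Linear-product-powers : ∀ m {p} → ProductOf Linear (suc m) p → SumOf (PowerOf Linear (suc m)) (2 ℕ.^ m) p
    Linear-product-powers m = product-powers Linear Linear-+ Linear-neg m {const c}
      (P.trans (P.*-congʳ {const c} (P.sym (ℂ→P.fromNat-homo k)))
        (P.trans (P.sym (κ.*-homo _ c)) (κ.⟦⟧-cong kc≈1)))
      (Linear-const-* c) (neg-power (suc m) (ℕ.s≤s ℕ.z≤n))
      where
      k = polarisationConstant m
      c = proj₁ (invertible-fromNat k (polarisationConstant-positive m))
      kc≈1 = proj₂ (invertible-fromNat k (polarisationConstant-positive m))

    Linear-half : const (embed half) P.+ const (embed half) P.≈ P.1#
    Linear-half = P.trans (P.sym (κ.+-homo (embed half) (embed half)))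
      (κ.⟦⟧-cong (C.trans (C.sym (ι.+-homo half half)) (ι.⟦⟧-cong half+half)))

  detPoly-decomposition : ∀ d → 1 ≤ d → HasWaringDecomposition d (detPoly d) (productCount d ℕ.* 2 ℕ.^ (d ℕ.∸ 1))
  detPoly-decomposition d@(suc m) _ =
    let f , powers , det≈∑f = SumOf⇒∑ (SumOf-bind (Linear-product-powers (d ℕ.* d) m)
          (Det-decomposition (Linear _) (Linear-+ _) (Linear-neg _) (const (embed half)) (Linear-half _) (Linear-const-* _ (embed half))
            d (λ i j → var (combine i j)) λ i j → var-linear (combine i j)))
    in hasWaringDecomposition (d ℕ.* d) {d} f powers (P.trans (P.sym (Det≋raw complexField _)) det≈∑f)
    where
    module P = CommutativeRing (polynomialRing (d ℕ.* d))
    open LinearForms complexField (d ℕ.* d)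
    open Decompositions (polynomialRing (d ℕ.* d))
    open DeterminantDecomposition (polynomialRing (d ℕ.* d)) using (Det-decomposition)

  module _ {d n : ℕ} (A B : Matrix d n) where
    private
      module P = CommutativeRing (polynomialRing n)
      module Q = CommutativeRing (polynomialRing (d ℕ.* d))
      open LinearForms complexField n
      open LinearForms complexField (d ℕ.* d) using () renaming (linearForm≈∑ to linearForm≈∑Q)
      module PD = Determinants (polynomialRing n)
      module CD = Determinants complexField
      open FiniteSums (polynomialRing n)
      module Q∑ = FiniteSums (polynomialRing (d ℕ.* d))
      module C∑ = FiniteSums complexField
    open Evaluation {complexField} {polynomialRing n} const-isHom

    -- What is substituted for x_{ij}: the entry of A · X · Bᵀ at the pair encoded by `l`.
    entry : Fin (d ℕ.* d) → Poly n
    entry l = let i , j = remQuot d l in linearForm λ k → A i k C.* B j k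

    private
      module ev = Homomorphisms.IsRingHomomorphism (polynomialRing (d ℕ.* d)) (polynomialRing n) (evaluate-isHom entry)
      module Ev = Homomorphisms.Preservation (polynomialRing (d ℕ.* d)) (polynomialRing n) (evaluate-isHom entry)

    evaluate-detPoly : evaluate entry (detPoly d) P.≈ minorPolynomial A B
    evaluate-detPoly = P.trans (ev.⟦⟧-cong {detPoly d} (Q.sym (Det≋raw complexField _))) (P.trans Ev.Det-homo (P.trans
      (PD.Det-cong λ i j → P.trans (evaluate-monomial-unit entry C.1# (combine i j))
        (P.trans (P.*-identityˡ (entry (combine i j)))
          (P.reflexive (≡.cong (λ (i , j) → linearForm λ k → A i k C.* B j k) (Fin.remQuot-combine i j)))))
      (Det-linearForm A B)))

    evaluate-linear : ∀ a → Linear n (evaluate entry (linearForm a))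
    evaluate-linear a = Linear-resp n
      (P.sym (P.trans (ev.⟦⟧-cong (linearForm≈∑Q a)) (P.trans Ev.∑-homo
        (∑-cong λ i → evaluate-monomial-unit entry (a i) i))))
      (Linear-∑ n λ i → Linear-const-* n (a i) (_ , P.refl))

    -- Substituting linear forms is a ring homomorphism that keeps linear forms linear, so a sum of
    -- r d-th powers remains one.
    minorPolynomial-decomposition : ∀ {r} → HasWaringDecomposition d (detPoly d) r →
                                    HasWaringDecomposition d (minorPolynomial A B) r
    minorPolynomial-decomposition (ℓ , det≈) = hasWaringDecomposition n {d}
      (λ i → evaluate entry (linearForm (ℓ i) ^Q d))
      (λ i → _ , evaluate-linear (ℓ i) , Ev.^-homo (linearForm (ℓ i)) d)
      (P.trans (P.sym evaluate-detPoly) (P.trans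
        (ev.⟦⟧-cong {detPoly d} (Q.trans (record { coeff≈ = det≈ }) (Q.trans (Q.reflexive (≡.sym (Q∑.∑≡sum _)))
          (Q∑.∑-cong λ i → Q.reflexive (≡.sym (^≡raw complexField (linearForm (ℓ i)) d))))))
        Ev.∑-homo))
      where open import Algebra.Properties.Semiring.Exp Q.semiring using () renaming (_^_ to _^Q_)

    det-product : ∀ (M N : Matrix d d) → det (M · N) C.≈ CD.Det M C.* CD.Det N
    det-product M N = C.trans (C.reflexive (≡.sym (CD.Det≡det (M · N)))) (C.trans
      (CD.Det-cong λ i j → C.reflexive (≡.sym (C∑.∑≡sum λ k → M i k C.* N k j)))
      (DeterminantProducts.Det-* complexField d M N))

    private
      -- The summand of `gPoly` is local to its definition; unification against `concatMap` recovers
      -- it as the implicit `s`.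
      summand : ∀ {xs : List (Subset n)} {s : Subset n → Poly n} (p : Poly n) → p ≡ List.concatMap s xs → Subset n → Poly n
      summand {s = s} _ _ = s

      gTerm : Subset n → Poly n
      gTerm = summand {allSubsets n} (gPoly A B) ≡.refl

      minorTerm : (α : Subset n) → .(∣ α ∣ ≡ d) → Poly n
      minorTerm α e = monomial (CD.Det (λ i k → A i (select α e k)) C.* CD.Det (λ i k → B i (select α e k))) (exponent α)

      gTerm-yes : ∀ α (e : ∣ α ∣ ≡ d) → gTerm α P.≈ minorTerm α e
      gTerm-yes α e with ∣ α ∣ ℕ.≟ d
      ... | yes e′ = monomial-cong (exponent α) (det-product (columns A α e′) (columns B α e′))
      ... | no ¬e  = contradiction e ¬e

      gTerm-no : ∀ α → ∣ α ∣ ≢ d → gTerm α P.≈ P.0#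
      gTerm-no α ¬e with ∣ α ∣ ℕ.≟ d
      ... | yes e = contradiction e ¬e
      ... | no _  = P.refl

    gPoly≈minorPolynomial : gPoly A B P.≈ minorPolynomial A B
    gPoly≈minorPolynomial = concatMap-allSubsets complexField n d gTerm minorTerm gTerm-yes gTerm-no

  HasWaringDecomposition-resp : ∀ {n d r} {p q : Poly n} → p ≋ q →
                                HasWaringDecomposition d q r → HasWaringDecomposition d p r
  HasWaringDecomposition-resp p≋q (ℓ , q≈) = ℓ , λ α → C.trans (coeff≈ p≋q α) (q≈ α)

-- Nonnegative polynomials with full multilinear support

module NonnegativeMultilinear (em : ExcludedMiddle 0ℓ) (ℝ : CompleteOrderedField) where
  open WaringRank ℝ
  open WaringBounds em ℝ
  open ComplexNumbers em ℝ
  open RealRoots em ℝ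
  open Classical em
  private
    module ℝ = CompleteOrderedField ℝ
    module C = CommutativeRing complexField
    module RD = Determinants ℝ.commutativeRing
    module RP = DeterminantProducts ℝ.commutativeRing
    module CR = Restriction complexField
    module RR = Restriction ℝ.commutativeRing
    module ℝ[x] = Polynomials ℝ.rawRing
    module ℝ→ℂ = Homomorphisms.Preservation ℝ.commutativeRing complexField embed-isHom
    module ι = Homomorphisms.IsRingHomomorphism ℝ.commutativeRing complexField embed-isHom
  open PolynomialRing complexField
  open PolynomialRing ℝ.commutativeRing using () renaming (polynomialRing to realPolynomialRing)
  open Coefficients ℝ.commutativeRing using (coeff-+)

  ∏-nonzero : ∀ {n} {f : Fin n → ℝ.Carrier} → (∀ i → ¬ (f i ℝ.≈ ℝ.0#)) → ¬ (RP.∏ f ℝ.≈ ℝ.0#)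
  ∏-nonzero {zero}  f≉0 1≈0 = ℝ.0≉1 (ℝ.sym 1≈0)
  ∏-nonzero {suc n} f≉0     = *-nonzero (f≉0 zero) (∏-nonzero (f≉0 ∘ suc))

  vandermonde-nonzero : ∀ {n} (x : Fin n → ℝ.Carrier) → (∀ {i j} → x i ℝ.≈ x j → i ≡ j) →
                        ¬ (RD.Det (RP.vandermonde x) ℝ.≈ ℝ.0#)
  vandermonde-nonzero {zero}  x x-injective h = ℝ.0≉1 (ℝ.sym (ℝ.trans (ℝ.sym RD.Det-zero) h))
  vandermonde-nonzero {suc n} x x-injective h = *-nonzero
    (∏-nonzero {f = λ j → x (suc j) ℝ.- x zero} λ j → distinct j ∘ x-injective ∘ x-y≈0⇒x≈y)
    (vandermonde-nonzero (x ∘ suc) (Fin.suc-injective ∘ x-injective))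
    (ℝ.trans (ℝ.sym (RP.Det-vandermonde x)) h)
    where
    distinct : ∀ (j : Fin n) → suc j ≢ zero
    distinct j ()
    x-y≈0⇒x≈y : ∀ {x y} → x ℝ.- y ℝ.≈ ℝ.0# → x ℝ.≈ y
    x-y≈0⇒x≈y {x} {y} h = ℝ.trans (solve 2 (λ x y → x := x :- y :+ y) ℝ.refl x y)
      (ℝ.trans (ℝ.+-congʳ h) (ℝ.+-identityˡ y))
      where open IntegerSolver ℝ.commutativeRing

  module _ {m : ℕ} where
    open FiniteSums (realPolynomialRing m) using (subsetSum)

    coeff-subsetSum-nonneg : ∀ n d (f : (α : Subset n) → .(∣ α ∣ ≡ d) → ℝ[x].Poly m) β →
      (∀ α .e → ℝ.0# ℝ.≤ ℝ[x].coeff (f α e) β) → ℝ.0# ℝ.≤ ℝ[x].coeff (subsetSum n d f) β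
    coeff-subsetSum-nonneg zero    zero    f β h = h [] ≡.refl
    coeff-subsetSum-nonneg zero    (suc d) f β h = IsTotalOrder.refl ℝ.isTotalOrder
    coeff-subsetSum-nonneg (suc n) zero    f β h = coeff-subsetSum-nonneg n zero _ β λ α e → h (outside ∷ α) e
    coeff-subsetSum-nonneg (suc n) (suc d) f β h =
      nonneg-resp (ℝ.sym (coeff-+ (subsetSum n d λ α e → f (inside ∷ α) (≡.cong suc e)) _ β))
        (+-nonneg (coeff-subsetSum-nonneg n d _ β λ α e → h (inside ∷ α) (≡.cong suc e))
                  (coeff-subsetSum-nonneg n (suc d) _ β λ α e → h (outside ∷ α) e))

    coeff-subsetSum-zero : ∀ n d (f : (α : Subset n) → .(∣ α ∣ ≡ d) → ℝ[x].Poly m) β →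
      (∀ α (e : ∣ α ∣ ≡ d) → ℝ[x].coeff (f α e) β ℝ.≈ ℝ.0#) → ℝ[x].coeff (subsetSum n d f) β ℝ.≈ ℝ.0#
    coeff-subsetSum-zero zero    zero    f β h = h [] ≡.refl
    coeff-subsetSum-zero zero    (suc d) f β h = ℝ.refl
    coeff-subsetSum-zero (suc n) zero    f β h = coeff-subsetSum-zero n zero _ β λ α e → h (outside ∷ α) e
    coeff-subsetSum-zero (suc n) (suc d) f β h =
      ℝ.trans (coeff-+ (subsetSum n d λ α e → f (inside ∷ α) (≡.cong suc e)) _ β) (ℝ.trans
        (ℝ.+-cong (coeff-subsetSum-zero n d _ β λ α e → h (inside ∷ α) (≡.cong suc e))
                  (coeff-subsetSum-zero n (suc d) _ β λ α e → h (outside ∷ α) e))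
        (ℝ.+-identityˡ ℝ.0#))

    -- Nonnegative summands cannot cancel: if a sum of two vanishes, so does each part.
    coeff-subsetSum-nonzero : ∀ n d (f : (α : Subset n) → .(∣ α ∣ ≡ d) → ℝ[x].Poly m) β →
      (∀ α .e → ℝ.0# ℝ.≤ ℝ[x].coeff (f α e) β) →
      ∀ α (e : ∣ α ∣ ≡ d) → ¬ (ℝ[x].coeff (f α e) β ℝ.≈ ℝ.0#) → ¬ (ℝ[x].coeff (subsetSum n d f) β ℝ.≈ ℝ.0#)
    coeff-subsetSum-nonzero zero    zero    f β h []            e fα≉0 = fα≉0
    coeff-subsetSum-nonzero (suc n) zero    f β h (outside ∷ α) e fα≉0 =
      coeff-subsetSum-nonzero n zero _ β (λ α e → h (outside ∷ α) e) α e fα≉0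
    coeff-subsetSum-nonzero (suc n) (suc d) f β h (inside  ∷ α) e fα≉0 sum≈0 =
      coeff-subsetSum-nonzero n d _ β (λ α e → h (inside ∷ α) (≡.cong suc e)) α (ℕ.suc-injective e) fα≉0
        (nonneg-sum-zero
          (coeff-subsetSum-nonneg n (suc d) _ β λ α e → h (outside ∷ α) e)
          (coeff-subsetSum-nonneg n d _ β λ α e → h (inside ∷ α) (≡.cong suc e))
          (ℝ.trans (ℝ.+-comm _ _) (ℝ.trans (ℝ.sym (coeff-+ (subsetSum n d λ α e → f (inside ∷ α) (≡.cong suc e)) _ β)) sum≈0)))
    coeff-subsetSum-nonzero (suc n) (suc d) f β h (outside ∷ α) e fα≉0 sum≈0 =
      coeff-subsetSum-nonzero n (suc d) _ β (λ α e → h (outside ∷ α) e) α e fα≉0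
        (nonneg-sum-zero
          (coeff-subsetSum-nonneg n d _ β λ α e → h (inside ∷ α) (≡.cong suc e))
          (coeff-subsetSum-nonneg n (suc d) _ β λ α e → h (outside ∷ α) e)
          (ℝ.trans (ℝ.sym (coeff-+ (subsetSum n d λ α e → f (inside ∷ α) (≡.cong suc e)) _ β)) sum≈0))

  complexify-subsetSum : ∀ {m} n d (f : (α : Subset n) → .(∣ α ∣ ≡ d) → ℝ[x].Poly m) →
    complexify (FiniteSums.subsetSum (realPolynomialRing m) n d f)
    ≡ FiniteSums.subsetSum (polynomialRing m) n d λ α e → complexify (f α e)
  complexify-subsetSum zero    zero    f = ≡.refl
  complexify-subsetSum zero    (suc d) f = ≡.refl
  complexify-subsetSum (suc n) zero    f = complexify-subsetSum n zero _
  complexify-subsetSum (suc n) (suc d) f = ≡.trans (List.map-++ _ (FiniteSums.subsetSum (realPolynomialRing _) n d _) _)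
    (≡.cong₂ List._++_ (complexify-subsetSum n d _) (complexify-subsetSum n (suc d) _))

  complexify-restrict : ∀ {n} (g : ℝ[x].Poly (suc n)) → complexify (RR.restrict g) ≡ CR.restrict (complexify g)
  complexify-restrict []                    = ≡.refl
  complexify-restrict ((c , zero  ∷ β) ∷ g) = ≡.cong ((embed c , β) ∷_) (complexify-restrict g)
  complexify-restrict ((c , suc _ ∷ β) ∷ g) = complexify-restrict g

  IsCandidate : ℕ → ℕ → ℕ → Set
  IsCandidate n d r = ∃[ g ] (NonnegativeCoefficients {n} g × MultilinearSupport d g × IsWaringRank d (complexify g) r)

  module _ (n d : ℕ) where
    open LinearForms ℝ.commutativeRing n using (minorPolynomial)
    open LinearForms complexField n using (monomial-cong) renaming (minorPolynomial to minorPolynomialᶜ)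

    -- The nodes are 0, ..., n - 1. Any d columns form a Vandermonde matrix again, with distinct
    -- nodes in characteristic 0, so no maximal minor vanishes.
    moments : Fin d → Fin n → ℝ.Carrier
    moments = RP.vandermonde λ j → fromNat (toℕ j)
      where open IntegerSolver ℝ.commutativeRing using (fromNat)

    squaredMinor : (α : Subset n) → .(∣ α ∣ ≡ d) → ℝ.Carrier
    squaredMinor α e = RD.Det (λ i k → moments i (select α e k)) ℝ.* RD.Det (λ i k → moments i (select α e k))

    squaredMinor-nonzero : ∀ α .(e : ∣ α ∣ ≡ d) → ¬ (squaredMinor α e ℝ.≈ ℝ.0#)
    squaredMinor-nonzero α e = *-nonzero minor≉0 minor≉0
      where
      open IntegerSolver ℝ.commutativeRing using (fromNat)
      minor≉0 = vandermonde-nonzero (λ k → fromNat (toℕ (select α e k))) λ {i} {j} h →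
        cast-injective (≡.sym e) (element-injective α (Fin.toℕ-injective (fromNat-injective _ _ h)))

    squaredMinors : ℝ[x].Poly n
    squaredMinors = minorPolynomial moments moments

    squaredMinor-term-nonneg : ∀ α .(e : ∣ α ∣ ≡ d) β →
      ℝ.0# ℝ.≤ ℝ[x].coeff (ℝ[x].monomial (squaredMinor α e) (exponent α)) β
    squaredMinor-term-nonneg α e β with does (Vec.≡-dec ℕ._≟_ (exponent α) β)
    ... | true  = nonneg-resp (ℝ.sym (ℝ.+-identityʳ _)) (square-nonneg _)
    ... | false = IsTotalOrder.refl ℝ.isTotalOrder

    squaredMinors-nonneg : NonnegativeCoefficients squaredMinors
    squaredMinors-nonneg β = coeff-subsetSum-nonneg n d _ β λ α e → squaredMinor-term-nonneg α e β

    squaredMinors-support : MultilinearSupport d squaredMinors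
    squaredMinors-support β = mk⇔ to from
      where
      to : ¬ (ℝ[x].coeff squaredMinors β ℝ.≈ ℝ.0#) → ∃[ α ] (∣ α ∣ ≡ d × β ≡ exponent α)
      to g≉0 with em {∃[ α ] (∣ α ∣ ≡ d × β ≡ exponent α)}
      ... | yes found = found
      ... | no  none  = contradiction (coeff-subsetSum-zero n d _ β term-zero) g≉0
        where
        term-zero : ∀ α (e : ∣ α ∣ ≡ d) → ℝ[x].coeff (ℝ[x].monomial (squaredMinor α e) (exponent α)) β ℝ.≈ ℝ.0#
        term-zero α e with Vec.≡-dec ℕ._≟_ (exponent α) β
        ... | yes ≡.refl = contradiction (α , e , ≡.refl) none
        ... | no  _      = ℝ.refl
      from : ∃[ α ] (∣ α ∣ ≡ d × β ≡ exponent α) → ¬ (ℝ[x].coeff squaredMinors β ℝ.≈ ℝ.0#)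
      from (α , e , ≡.refl) = coeff-subsetSum-nonzero n d _ β (λ α e → squaredMinor-term-nonneg α e β) α e term-nonzero
        where
        term-nonzero : ¬ (ℝ[x].coeff (ℝ[x].monomial (squaredMinor α e) (exponent α)) (exponent α) ℝ.≈ ℝ.0#)
        term-nonzero h with Vec.≡-dec ℕ._≟_ (exponent α) (exponent α)
        ... | yes _ = squaredMinor-nonzero α e (ℝ.trans (ℝ.sym (ℝ.+-identityʳ _)) h)
        ... | no ¬p = ¬p ≡.refl

    embedded : Matrix d n
    embedded i j = embed (moments i j)

    complexify-squaredMinors : complexify squaredMinors ≋ minorPolynomialᶜ embedded embedded
    complexify-squaredMinors = P.trans (P.reflexive (complexify-subsetSum n d _))
      (FiniteSums.subsetSum-cong (polynomialRing n) n d λ α e → monomial-cong (exponent α)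
        (C.trans (ι.*-homo _ _) (C.*-cong ℝ→ℂ.Det-homo ℝ→ℂ.Det-homo)))
      where module P = CommutativeRing (polynomialRing n)

    -- Over ℂ, `squaredMinors` arises from det_d by a linear substitution, so it inherits the
    -- decomposition; its rank is then the minimum found below ρ.
    candidate-below : ∀ {ρ} → HasWaringDecomposition d (detPoly d) ρ → ∃[ r ] (IsCandidate n d r × r ≤ ρ)
    candidate-below {ρ} dec =
      let r , isRank , r≤ρ = minimum ρ (HasWaringDecomposition-resp {d = d} complexify-squaredMinors
            (minorPolynomial-decomposition embedded embedded dec))
      in r , (squaredMinors , squaredMinors-nonneg , squaredMinors-support , isRank) , r≤ρ

  module _ {n : ℕ} where
    private
      module P = CommutativeRing (polynomialRing n)
      module P₊ = CommutativeRing (polynomialRing (suc n))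
      module Σ₊ = FiniteSums (polynomialRing (suc n))
      module ρ = Homomorphisms.IsRingHomomorphism (polynomialRing (suc n)) (polynomialRing n) CR.restrict-isHom
      module ρ′ = Homomorphisms.Preservation (polynomialRing (suc n)) (polynomialRing n) CR.restrict-isHom
    open LinearForms complexField n
    open LinearForms complexField (suc n) using () renaming (linearForm≈∑ to linearForm≈∑₊)
    open FiniteSums (polynomialRing n)
    open import Algebra.Properties.Semiring.Exp P₊.semiring using (_^_)

    restrict-linearForm : ∀ a → CR.restrict (linearForm a) P.≈ linearForm (a ∘ suc)
    restrict-linearForm a = P.trans (ρ.⟦⟧-cong (linearForm≈∑₊ a)) (P.trans ρ′.∑-homo
      (P.trans ∑-suc (P.trans (P.+-identityˡ _) (P.sym (linearForm≈∑ (a ∘ suc))))))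

    restrict-decomposition : ∀ {d r} (g : Poly (suc n)) → HasWaringDecomposition d g r →
                             HasWaringDecomposition d (CR.restrict g) r
    restrict-decomposition {d} g (ℓ , g≈) = hasWaringDecomposition n {d}
      (λ i → CR.restrict (linearForm (ℓ i) ^ d))
      (λ i → _ , (_ , restrict-linearForm (ℓ i)) , ρ′.^-homo (linearForm (ℓ i)) d)
      (P.trans (ρ.⟦⟧-cong {g} (P₊.trans (record { coeff≈ = g≈ }) (P₊.trans (P₊.reflexive (≡.sym (Σ₊.∑≡sum _)))
          (Σ₊.∑-cong λ i → P₊.reflexive (≡.sym (^≡raw complexField (linearForm (ℓ i)) d))))))
        ρ′.∑-homo)

    -- Setting the first variable to 0 keeps coefficients nonnegative and leaves exactly the
    -- monomials of the subsets avoiding it. The rank may drop, hence the new `r′`.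
    restrict-candidate : ∀ {d r} → IsCandidate (suc n) d r → ∃[ r′ ] (IsCandidate n d r′ × r′ ≤ r)
    restrict-candidate {d} {r} (g , nonneg , support , isRank) =
      let r′ , isRank′ , r′≤r = minimum r (≡.subst (λ h → HasWaringDecomposition d h r) (≡.sym (complexify-restrict g))
            (restrict-decomposition {d} (complexify g) (proj₁ isRank)))
      in r′ , (RR.restrict g , nonneg′ , support′ , isRank′) , r′≤r
      where
      nonneg′ : NonnegativeCoefficients (RR.restrict g)
      nonneg′ β = ≡.subst (ℝ.0# ℝ.≤_) (≡.sym (RR.coeff-restrict g β)) (nonneg (0 ∷ β))
      support′ : MultilinearSupport d (RR.restrict g)
      support′ β rewrite RR.coeff-restrict g β = mk⇔ (drop ∘ Equivalence.to (support (0 ∷ β)))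
        λ (α , e , β≡) → Equivalence.from (support (0 ∷ β)) (outside ∷ α , e , ≡.cong (0 ∷_) β≡)
        where
        drop : ∃[ α ] (∣ α ∣ ≡ d × 0 ∷ β ≡ exponent α) → ∃[ α ] (∣ α ∣ ≡ d × β ≡ exponent α)
        drop (outside ∷ α , e , 0∷β≡) = α , e , Vec.∷-injectiveʳ 0∷β≡

proposition38 :
    ExcludedMiddle 0ℓ → (ℝ : CompleteOrderedField) → let open WaringRank ℝ in
    (d : ℕ) → 1 ≤ d →
    ∃[ ρ ] (IsWaringRank d (detPoly d) ρ
      × fromℕ ρ ℚ.≤ rankBound d
      × (∀ n → d ≤ n → (A B : Matrix d n) →
           ∃[ r ] (IsWaringRank d (gPoly A B) r × r ≤ ρ))
      × ∃[ a ] ((∀ n → IsA⁺ n d (a n))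
          × ∃[ L ] (HasLimit a L × L ≤ ρ)))
proposition38 em ℝ d 1≤d = conclude (minimum _ (detPoly-decomposition d 1≤d))
  where
  open WaringRank ℝ
  open Classical em
  open WaringBounds em ℝ
  open NonnegativeMultilinear em ℝ

  shorten : ∀ {P : Pred ℕ 0ℓ} {ρ} → ∃[ r ] (P r × r ≤ ρ) → ∃[ m ] (IsMinimum P m × m ≤ ρ)
  shorten (r , Pr , r≤ρ) = let m , isMin , m≤r = minimum r Pr in m , isMin , ℕ.≤-trans m≤r r≤ρ

  limit : ∀ ρ → (∀ n → ∃[ m ] (IsMinimum (IsCandidate n d) m × m ≤ ρ)) →
          ∃[ a ] ((∀ n → IsA⁺ n d (a n)) × ∃[ L ] (HasLimit a L × L ≤ ρ))
  limit ρ A⁺ = (λ n → proj₁ (A⁺ n)) , (λ n → proj₁ (proj₂ (A⁺ n)))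
    , monotone-limit (λ n → proj₁ (A⁺ n)) monotone ρ (λ n → proj₂ (proj₂ (A⁺ n)))
    where
    -- A minimiser in n + 1 variables restricts to a candidate in n variables of no larger rank.
    monotone : ∀ n → proj₁ (A⁺ n) ≤ proj₁ (A⁺ (suc n))
    monotone n with A⁺ n | A⁺ (suc n)
    ... | m , (_ , least) , _ | m′ , (candidate , _) , _ =
      let r , candidate′ , r≤m′ = restrict-candidate candidate in ℕ.≤-trans (least r candidate′) r≤m′

  conclude : ∃[ ρ ] (IsWaringRank d (detPoly d) ρ × ρ ≤ productCount d ℕ.* 2 ℕ.^ (d ℕ.∸ 1)) → _
  conclude (ρ , isRank , ρ≤) = ρ , isRank
    , ≡.subst (fromℕ ρ ℚ.≤_) (≡.sym (rankBound≡ d)) (fromℕ-mono-≤ ρ≤)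
    , (λ n _ A B → minimum ρ (HasWaringDecomposition-resp {d = d} (gPoly≈minorPolynomial A B)
                                (minorPolynomial-decomposition A B (proj₁ isRank))))
    , limit ρ (λ n → shorten (candidate-below n d (proj₁ isRank)))
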